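{- Let $q$ be a prime power and $\varepsilon\in\{ -1,+1\}$. Then, as formal power series in $x$, $$\Big(1+\sum_{n^-\geq1}\Big[\sum_{\lambda^-\vdash n^- }\prod_{d^-\in B(\lambda^-)}\binom{\varepsilon\,\mathrm{SRIM}^-_{d^- }(q)}{E(\lambda^-,d^-)}\Big]x^{n^- }\Big)\Big(1+\sum_{n^+\geq1}\Big[\sum_{\lambda^+\vdash n^+}\prod_{d^+\in B(\lambda^+)}\binom{\varepsilon\,\mathrm{SRIM}^+_{d^+}(q)}{ -E(\lambda^+,d^+)}\Big]x^{n^+}\Big)=\Big(\frac{1}{1-x}\Big)^{\varepsilon}.$$
   Context: For $f(x)\in\mathbf{F}_q[x]$ of degree $d$ with $f(0)\neq0$, $f^*(x)=x^df(x^{ -1})$ and $f$ is self-reciprocal if $f^*=f$. $\mathrm{SRIM}^-_d(q)$ is the number of self-reciprocal irreducible monic polynomials of degree $2d$ over $\mathbf{F}_q$; $\mathrm{SRIM}^+_d(q)$ is the number of unordered pairs $\{f,f^*/f(0)\}$ with $f$ irreducible monic of degree $d$ over $\mathbf{F}_q$, $f(0)\neq0$, $f\neq f^*/f(0)$. For a partition $\lambda$, $B(\lambda)$ is its set of distinct parts and $E(\lambda,d)$ the multiplicity of $d$. For $m\in\mathbf{Q}$ and $k\geq0$, $\binom{m}{k}=m(m-1)\cdots(m-k+1)/k!$ and $\binom{m}{ -k}=(-1)^k\binom{m}{k}$. -}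

module Defs where

open import Level using (0ℓ)
open import Algebra.Bundles using (CommutativeRing)
open import Data.Nat as ℕ using (ℕ; zero; suc; _∸_; _≤ᵇ_; _!)
open import Data.Nat.Properties using (_!≢0)
open import Data.Integer as ℤ using (ℤ; +_; -[1+_])
open import Data.Rational as ℚ using (ℚ; 0ℚ; 1ℚ)
open import Data.Sign as Sign using (Sign)
open import Data.Fin using (Fin)
open import Data.Vec as Vec using (Vec)
open import Data.List as List using (List; []; _∷_; _++_; map; concatMap; upTo; replicate; filter; deduplicate; length)
open import Data.Bool using (if_then_else_)
import Data.Fin
import Relation.Nullary
open import Data.Product using (Σ; _×_; _,_)
open import Data.Sum using (_⊎_)
open import Relation.Nullary using (¬_)
open import Relation.Binary.PropositionalEquality using (_≡_)
open import Function.Bundles using (_↔_)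

record Field : Set₁ where
  field
    cring  : CommutativeRing 0ℓ 0ℓ
  open CommutativeRing cring public hiding (ring)
  field
    ≈⇒≡    : ∀ {x y} → x ≈ y → x ≡ y
    0≢1    : ¬ (0# ≡ 1#)
    _⁻¹    : Carrier → Carrier
    ⁻¹-inv : ∀ x → ¬ (x ≡ 0#) → x * (x ⁻¹) ≡ 1#

HasCard : Field → ℕ → Set
HasCard F q = Fin q ↔ Field.Carrier F

module Poly (F : Field) where
  open Field F

  Coeffs : Set
  Coeffs = ℕ → Carrier

  IsPoly : Coeffs → Set
  IsPoly g = Σ ℕ λ b → ∀ k → b ℕ.< k → g k ≡ 0#

  convAux : Coeffs → Coeffs → ℕ → ℕ → Carrier
  convAux g h n zero    = 0#
  convAux g h n (suc i) = convAux g h n i + g i * h (n ∸ i)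

  _·_ : Coeffs → Coeffs → Coeffs
  (g · h) n = convAux g h n (suc n)

  one : Coeffs
  one zero    = 1#
  one (suc _) = 0#

  _≐_ : Coeffs → Coeffs → Set
  g ≐ h = ∀ n → g n ≡ h n

  IsZero : Coeffs → Set
  IsZero g = ∀ n → g n ≡ 0#

  IsUnit : Coeffs → Set
  IsUnit g = Σ Coeffs λ h → IsPoly h × ((g · h) ≐ one)

  Irreducible : Coeffs → Set
  Irreducible f = ¬ IsZero f × ¬ IsUnit f
    × (∀ g h → IsPoly g → IsPoly h → f ≐ (g · h) → IsUnit g ⊎ IsUnit h)

  -- A monic polynomial of degree n, given by its n lower coefficients
  -- c_0, …, c_{n-1} (the coefficient of x^n is 1).
  Monic : ℕ → Set
  Monic n = Vec Carrier n

  coeff : ∀ {n} → Monic n → Coeffs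
  coeff {n} f k with k ℕ.<? n
  ... | Relation.Nullary.yes k<n = Vec.lookup f (Data.Fin.fromℕ< k<n)
  ... | Relation.Nullary.no _ with k ℕ.≟ n
  ...   | Relation.Nullary.yes _ = 1#
  ...   | Relation.Nullary.no _  = 0#

  -- reciprocal f*(x) = x^n f(1/x): coefficient k is c_{n-k} (k ≤ n)
  recip : ∀ {n} → Monic n → Coeffs
  recip {n} f k = if k ≤ᵇ n then coeff f (n ∸ k) else 0#

  SelfReciprocal : ∀ {n} → Monic n → Set
  SelfReciprocal f = recip f ≐ coeff f

  recipNorm : ∀ {n} → Monic n → Coeffs
  recipNorm f k = recip f k * (coeff f 0 ⁻¹)

  SRIMminusSet : (d : ℕ) → Monic (d ℕ.+ d) → Set
  SRIMminusSet d f = ¬ (coeff {d ℕ.+ d} f 0 ≡ 0#) × Irreducible (coeff f) × SelfReciprocal f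

  SRIMplusSet : (d : ℕ) → Monic d → Set
  SRIMplusSet d f = ¬ (coeff f 0 ≡ 0#) × Irreducible (coeff f) × ¬ (coeff f ≐ recipNorm f)

  SamePair : (d : ℕ) → Monic d → Monic d → Set
  SamePair d f g = (g ≡ f) ⊎ (coeff g ≐ recipNorm f)

-- "N is the number of R-classes of the subset {a | P a} of A":
-- a map from the subset onto Fin N whose fibres are exactly the R-classes.

CountsClasses : {A : Set} → (A → Set) → (A → A → Set) → ℕ → Set
CountsClasses {A} P R N =
  Σ ((a : A) → P a → Fin N) λ π →
      (∀ a b (p : P a) (p' : P b) → π a p ≡ π b p' → R a b)
    × (∀ a b (p : P a) (p' : P b) → R a b → π a p ≡ π b p')
    × (∀ i → Σ A λ a → Σ (P a) λ p → π a p ≡ i)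

fallingℤ : ℤ → ℕ → ℤ
fallingℤ m zero    = + 1
fallingℤ m (suc k) = fallingℤ m k ℤ.* (m ℤ.- + k)

binomℕ : ℤ → ℕ → ℚ
binomℕ m k = (fallingℤ m k ℚ./ (k !)) {{k !≢0}}

signPow : ℕ → ℚ
signPow zero    = 1ℚ
signPow (suc k) = ℚ.- signPow k

binom : ℤ → ℤ → ℚ
binom m (+ k)      = binomℕ m k
binom m -[1+ k ]   = signPow (suc k) ℚ.* binomℕ m (suc k)

-- Partitions.  partsBounded n m = all partitions of n with parts ≤ m,
-- each listed once (as a list of its parts, nonincreasing).  A partition
-- with parts ≤ m+1 is j copies of m+1 followed by a partition of
-- n - j(m+1) with parts ≤ m.

partsBounded : ℕ → ℕ → List (List ℕ)
partsBounded zero    zero    = [] ∷ []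
partsBounded (suc _) zero    = []
partsBounded n       (suc m) =
  concatMap (λ j → if j ℕ.* suc m ≤ᵇ n
                     then map (replicate j (suc m) ++_) (partsBounded (n ∸ j ℕ.* suc m) m)
                     else [])
            (upTo (suc n))

partitions : ℕ → List (List ℕ)
partitions n = partsBounded n n

B : List ℕ → List ℕ
B λ′ = deduplicate ℕ._≟_ λ′

E : List ℕ → ℕ → ℕ
E λ′ d = length (filter (d ℕ.≟_) λ′)

sumℚ : List ℚ → ℚ
sumℚ = List.foldr ℚ._+_ 0ℚ

prodℚ : List ℚ → ℚ
prodℚ = List.foldr ℚ._*_ 1ℚ

seriesFrom : Sign → ℤ → (ℕ → ℕ) → ℕ → ℚ
seriesFrom σ ε S zero    = 1ℚ
seriesFrom σ ε S (suc n) =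
  sumℚ (map (λ λ′ → prodℚ (map (λ d → binom (ε ℤ.* + S d) (σ ℤ.◃ E λ′ d)) (B λ′)))
            (partitions (suc n)))

convℚ : (ℕ → ℚ) → (ℕ → ℚ) → ℕ → ℚ
convℚ a b n = sumℚ (map (λ i → a i ℚ.* b (n ∸ i)) (upTo (suc n)))

-- (1/(1-x))^ε for ε = ±1:  1/(1-x) = Σ xⁿ ;  (1/(1-x))^{-1} = 1 - x
geomPow : Sign → ℕ → ℚ
geomPow Sign.+ _             = 1ℚ
geomPow Sign.- zero          = 1ℚ
geomPow Sign.- (suc zero)    = ℚ.- 1ℚ
geomPow Sign.- (suc (suc _)) = 0ℚ

signℤ : Sign → ℤ
signℤ Sign.+ = + 1
signℤ Sign.- = -[1+ 0 ]

{-# OPTIONS --safe #-}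
-- Write N_d = SRIM⁻_d and M_d = SRIM⁺_d.  The two partition sums are the expansions of
-- ∏ (1 + x^d)^{ε N_d} and ∏ (1 − x^d)^{ε M_d}, so the claim is
--   (1 − x) ∏ (1 + x^d)^{N_d} (1 − x^d)^{M_d} = 1.
-- Both the monic polynomials of degree n and the palindromic monic polynomials of degree 2n are
-- enumerated by F^n, so they have the same counting series Q.  Removing the multiples of one prime
-- at a time (Euclid's lemma: removing multiples of p multiplies the series by 1 − x^{deg p}) gives
-- an Euler product for 1 / Q in each case.  The monic primes are x, the x − c with c² = 1, the
-- self-reciprocal irreducibles and the members of the reciprocal pairs; the palindromic primes are
-- (x − c)², the self-reciprocal irreducibles (now of degree d instead of 2d) and the products of
-- the pairs (of degree d).  Comparing the two products,
--   (1 − x) (1 − x)^e ∏ (1 − x^{2d})^{N_d} (1 − x^d)^{2 M_d} = (1 − x)^e ∏ (1 − x^d)^{N_d + M_d},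
-- and cancelling the right-hand side proves the claim.
module Submission where

open import Defs
open import Relation.Binary.PropositionalEquality as ≡ using (_≡_)
open import Algebra.Bundles using (CommutativeRing)
import Algebra.Solver.Ring as RingSolver
open import Algebra.Solver.Ring.AlmostCommutativeRing using (fromCommutativeRing; _-Raw-AlmostCommutative⟶_; Induced-equivalence)
open import Data.Bool using (if_then_else_; true; false; T)
open import Data.Empty using (⊥-elim; ⊥)
open import Data.Fin as Fin using (Fin; toℕ; fromℕ<)
import Data.Fin.Properties as Finₚ
open import Data.Integer as ℤ using (ℤ)
import Data.Integer.Properties as ℤₚ
open import Data.Integer.Tactic.RingSolver using (solve-∀)
open import Data.List as List using (List; []; _∷_; _++_; map; concatMap; upTo; applyUpTo; replicate; filter; length; allFin; cartesianProductWith)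
open import Data.List.Membership.Propositional using (_∈_; lose; find)
open import Data.List.Membership.Propositional.Properties using (∈-∃++; ∈-++⁺ˡ; ∈-++⁺ʳ; ∈-++⁻; ∈-filter⁺; ∈-filter⁻; ∈-map⁺; ∈-map⁻; ∈-allFin; ∈-cartesianProductWith⁺; ∈-lookup)
import Data.List.Properties as Listₚ
open import Data.List.Relation.Binary.Subset.Propositional using (_⊆_)
open import Data.List.Relation.Unary.All as All using (All; []; _∷_)
import Data.List.Relation.Unary.All.Properties as Allₚ
open import Data.List.Relation.Unary.AllPairs as AllPairs using (AllPairs; []; _∷_)
import Data.List.Relation.Unary.AllPairs.Properties as AllPairsₚ
open import Data.List.Relation.Unary.Any as Any using (Any; here; there)
import Data.List.Relation.Unary.Any.Properties as Anyₚ
open import Data.List.Relation.Unary.Unique.Propositional using (Unique)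
import Data.List.Relation.Unary.Unique.Propositional.Properties as Uniqueₚ
open import Data.Maybe using (just; nothing; Maybe)
open import Data.Maybe.Properties using (just-injective)
open import Data.Nat as ℕ using (ℕ; zero; suc; _≤_; z≤n; s≤s; _∸_; _<_; _≤ᵇ_)
open import Data.Nat.Induction using (<-rec)
open import Data.Nat.Properties as ℕₚ using (_!≢0)
open import Data.Product using (_,_; _×_; Σ; proj₁; proj₂)
open import Data.Rational as ℚ using (ℚ; 0ℚ; 1ℚ; toℚᵘ)
import Data.Rational.Properties as ℚₚ
import Data.Rational.Unnormalised as ℚᵘ
import Data.Rational.Unnormalised.Properties as ℚᵘₚ
open import Data.Sign as Sign using (Sign)
open import Data.Sum using (_⊎_; inj₁; inj₂)
open import Data.Unit using (⊤; tt)
open import Data.Vec as Vec using (Vec; []; _∷_; lookup; tabulate)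
import Data.Vec.Properties as Vecₚ
open import Function using (_∘_)
open import Function.Bundles using (Inverse)
open import Level using (0ℓ)
open import Relation.Binary.Definitions using (WeaklyDecidable; DecidableEquality; tri<; tri≈; tri>)
import Relation.Binary.Reasoning.Setoid as SetoidReasoning
open import Relation.Nullary using (yes; no; ¬_; ¬?; Dec; _×-dec_)
open import Relation.Nullary.Decidable using (map′)
open import Relation.Unary using (Decidable)

-- No infinite product is ever formed: everything is compared modulo x^(N+1), with finite lists that
-- contain all primes of degree at most N. The sieve rests on two facts only: multiplying by one
-- prime does not change divisibility by another, and every element of positive degree has a listed
-- prime divisor. The series Q enters only as the common value of two counts; for this a palindrome
-- of degree 2n is graded by n, the number of its free coefficients. The delicate primes are the x -
-- c with c² = 1, whose degree is odd and whose reversal is -c (x - c). Two facts are required: such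
-- a factor divides a palindrome to even order, and an irreducible f = f*/f(0) of even degree has
-- f(0) = 1. Both reduce to showing that h of odd degree with reversal -c h is divisible by x - c.
-- Evaluation at c yields just 2 h(c) = 0, so an explicit folding of the coefficients is used
-- instead, uniform in the characteristic. In the same way the number e of such c (1 or 2) is never
-- determined, because it contributes equally to both Euler products.

-- Polynomial identities valid in every commutative ring.

module RingLemmas (R : CommutativeRing 0ℓ 0ℓ) where

  open import Data.Integer using (+_; -[1+_])
  open CommutativeRing R
  open import Algebra.Properties.Ring ring using (-‿distribˡ-*; -0#≈0#; -‿involutive; -‿+-comm)
  open import Algebra.Properties.Semiring.Mult.TCOptimised semiring using (×-homo-+; 1+×) renaming (_×_ to _⋆_)

  private
    ⟦_⟧ℤ : ℤ → Carrier
    ⟦ + n      ⟧ℤ = n ⋆ 1#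
    ⟦ -[1+ n ] ⟧ℤ = - (suc n ⋆ 1#)

    open SetoidReasoning setoid

    neg-homo : ∀ i → ⟦ ℤ.- i ⟧ℤ ≈ - ⟦ i ⟧ℤ
    neg-homo (+ zero)  = sym -0#≈0#
    neg-homo (+ suc n) = refl
    neg-homo -[1+ n ]  = sym (-‿involutive _)

    ⊖-homo : ∀ m n → ⟦ m ℤ.⊖ n ⟧ℤ ≈ m ⋆ 1# - n ⋆ 1#
    ⊖-homo m       zero    = sym (trans (+-congˡ -0#≈0#) (+-identityʳ _))
    ⊖-homo zero    (suc n) = sym (+-identityˡ _)
    ⊖-homo (suc m) (suc n) = begin
      ⟦ suc m ℤ.⊖ suc n ⟧ℤ                   ≡⟨ ≡.cong ⟦_⟧ℤ (ℤₚ.[1+m]⊖[1+n]≡m⊖n m n) ⟩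
      ⟦ m ℤ.⊖ n ⟧ℤ                           ≈⟨ ⊖-homo m n ⟩
      m ⋆ 1# - n ⋆ 1#                        ≈⟨ +-congʳ (+-identityʳ _) ⟨
      (m ⋆ 1# + 0#) - n ⋆ 1#                 ≈⟨ +-congʳ (+-congˡ (-‿inverseʳ 1#)) ⟨
      (m ⋆ 1# + (1# - 1#)) - n ⋆ 1#          ≈⟨ +-congʳ (+-assoc _ _ _) ⟨
      ((m ⋆ 1# + 1#) - 1#) - n ⋆ 1#          ≈⟨ +-assoc _ _ _ ⟩
      (m ⋆ 1# + 1#) + (- 1# - n ⋆ 1#)        ≈⟨ +-cong (+-comm _ _) (-‿+-comm 1# (n ⋆ 1#)) ⟩
      (1# + m ⋆ 1#) - (1# + n ⋆ 1#)          ≈⟨ +-cong (1+× m 1#) (-‿cong (1+× n 1#)) ⟨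
      suc m ⋆ 1# - suc n ⋆ 1#                ∎

    +-homo : ∀ i j → ⟦ i ℤ.+ j ⟧ℤ ≈ ⟦ i ⟧ℤ + ⟦ j ⟧ℤ
    +-homo (+ m)    (+ n)    = ×-homo-+ 1# m n
    +-homo (+ m)    -[1+ n ] = ⊖-homo m (suc n)
    +-homo -[1+ m ] (+ n)    = trans (⊖-homo n (suc m)) (+-comm _ _)
    +-homo -[1+ m ] -[1+ n ] = begin
      - (suc (suc (m ℕ.+ n)) ⋆ 1#)           ≡⟨ ≡.cong (λ k → - (suc k ⋆ 1#)) (ℕₚ.+-suc m n) ⟨
      - ((suc m ℕ.+ suc n) ⋆ 1#)             ≈⟨ -‿cong (×-homo-+ 1# (suc m) (suc n)) ⟩
      - (suc m ⋆ 1# + suc n ⋆ 1#)            ≈⟨ -‿+-comm _ _ ⟨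
      - (suc m ⋆ 1#) - suc n ⋆ 1#            ∎

    *-homo⁺ : ∀ m j → ⟦ + m ℤ.* j ⟧ℤ ≈ m ⋆ 1# * ⟦ j ⟧ℤ
    *-homo⁺ zero    j = trans (reflexive (≡.cong ⟦_⟧ℤ (ℤₚ.*-zeroˡ j))) (sym (zeroˡ _))
    *-homo⁺ (suc m) j = begin
      ⟦ + suc m ℤ.* j ⟧ℤ                     ≡⟨ ≡.cong ⟦_⟧ℤ (ℤₚ.suc-* (+ m) j) ⟩
      ⟦ j ℤ.+ + m ℤ.* j ⟧ℤ                   ≈⟨ +-homo j (+ m ℤ.* j) ⟩
      ⟦ j ⟧ℤ + ⟦ + m ℤ.* j ⟧ℤ                ≈⟨ +-cong (sym (*-identityˡ _)) (*-homo⁺ m j) ⟩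
      1# * ⟦ j ⟧ℤ + m ⋆ 1# * ⟦ j ⟧ℤ          ≈⟨ distribʳ _ _ _ ⟨
      (1# + m ⋆ 1#) * ⟦ j ⟧ℤ                 ≈⟨ *-congʳ (1+× m 1#) ⟨
      suc m ⋆ 1# * ⟦ j ⟧ℤ                    ∎

    *-homo : ∀ i j → ⟦ i ℤ.* j ⟧ℤ ≈ ⟦ i ⟧ℤ * ⟦ j ⟧ℤ
    *-homo (+ m)    j = *-homo⁺ m j
    *-homo -[1+ m ] j = begin
      ⟦ -[1+ m ] ℤ.* j ⟧ℤ                    ≡⟨ ≡.cong ⟦_⟧ℤ (ℤₚ.neg-distribˡ-* (+ suc m) j) ⟨
      ⟦ ℤ.- (+ suc m ℤ.* j) ⟧ℤ               ≈⟨ neg-homo (+ suc m ℤ.* j) ⟩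
      - ⟦ + suc m ℤ.* j ⟧ℤ                   ≈⟨ -‿cong (*-homo⁺ (suc m) j) ⟩
      - (suc m ⋆ 1# * ⟦ j ⟧ℤ)                ≈⟨ -‿distribˡ-* _ _ ⟩
      - (suc m ⋆ 1#) * ⟦ j ⟧ℤ                ∎

    -- Normalisation has to recognise cancelling coefficients, and equality in `R` may be
    -- undecidable. The coefficients are therefore integers, mapped into `R` by the canonical
    -- homomorphism.
    ℤ-coefficients : ℤ.+-*-rawRing -Raw-AlmostCommutative⟶ fromCommutativeRing R
    ℤ-coefficients = record
      { ⟦_⟧ = ⟦_⟧ℤ ; +-homo = +-homo ; *-homo = *-homo ; -‿homo = neg-homo ; 0-homo = refl ; 1-homo = refl }

    coeff≟ : WeaklyDecidable (Induced-equivalence ℤ-coefficients)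
    coeff≟ i j with i ℤ.≟ j
    ... | yes i≡j = just (reflexive (≡.cong ⟦_⟧ℤ i≡j))
    ... | no  _   = nothing

    open RingSolver ℤ.+-*-rawRing (fromCommutativeRing R) ℤ-coefficients coeff≟

    one : ∀ {n} → Polynomial n
    one = con (+ 1)

  abstract
    +-swap : ∀ a b c → a + (b + c) ≈ b + (a + c)
    +-swap = solve 3 (λ a b c → a :+ (b :+ c) := b :+ (a :+ c)) refl

    +-interchange : ∀ a b c d → (a + b) + (c + d) ≈ (a + c) + (b + d)
    +-interchange = solve 4 (λ a b c d → (a :+ b) :+ (c :+ d) := (a :+ c) :+ (b :+ d)) refl

    *-swap : ∀ a b c → a * (b * c) ≈ (b * a) * c
    *-swap = solve 3 (λ a b c → a :* (b :* c) := (b :* a) :* c) refl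

    *-pair : ∀ l u v a b → (l * (u * v)) * (a * b) ≈ l * ((u * a) * (v * b))
    *-pair = solve 5 (λ l u v a b → (l :* (u :* v)) :* (a :* b) := l :* ((u :* a) :* (v :* b))) refl

    conjugates : ∀ y → (1# - y) * (1# + y) ≈ 1# - y * y
    conjugates = solve 1 (λ y → (one :- y) :* (one :+ y) := one :- y :* y) refl

    division-step : ∀ f x g q r c → f + x * (g * q + r) ≈ g * (c + x * q) + ((f + x * r) - c * g)
    division-step = solve 6 (λ f x g q r c → f :+ x :* (g :* q :+ r) := g :* (c :+ x :* q) :+ ((f :+ x :* r) :- c :* g)) refl

    *-distribˡ-- : ∀ p a b → p * (a - b) ≈ p * a - p * b
    *-distribˡ-- = solve 3 (λ p a b → p :* (a :- b) := p :* a :- p :* b) refl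

    cancel-+ : ∀ a b → (a + b) - a ≈ b
    cancel-+ = solve 2 (λ a b → (a :+ b) :- a := b) refl

    remainder-* : ∀ P u q r h → P ≈ u * q + r → r * h ≈ P * h - q * (u * h)
    remainder-* P u q r h eq = trans (solve 4 (λ u q r h → r :* h := (u :* q :+ r) :* h :- q :* (u :* h)) refl u q r h)
      (+-congʳ (*-congʳ (sym eq)))

    -- Read `a + x * L` as a polynomial with constant term `a`, `y` as x^(k+1) and `R + a * y` as
    -- its reversal. The outermost pair of coefficients splits off as a multiple of 1 - c x y²,
    -- leaving the same expression for `L`.
    peel : ∀ a x L c y R → (a + x * L) - c * ((x * y) * (R + a * y)) ≈ a * (1# - c * (x * (y * y))) + x * (L - c * (y * R))
    peel = solve 6 (λ a x L c y R → (a :+ x :* L) :- c :* ((x :* y) :* (R :+ a :* y)) :=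
      a :* (one :- c :* (x :* (y :* y))) :+ x :* (L :- c :* (y :* R))) refl

    -- Raises the exponent in 1 - c x^(2k+1) by two, with `y` = x^k; the correction is a multiple of
    -- 1 - x².
    raise : ∀ c x y → 1# - c * (x * ((x * y) * (x * y))) ≈ (1# - c * (x * (y * y))) + (c * (x * (y * y))) * (1# - x * x)
    raise = solve 3 (λ c x y → one :- c :* (x :* ((x :* y) :* (x :* y))) :=
      (one :- c :* (x :* (y :* y))) :+ (c :* (x :* (y :* y))) :* (one :- x :* x)) refl

    square-difference : ∀ c x → c * c ≈ 1# → 1# - x * x ≈ (x - c) * (- (x + c))
    square-difference c x cc≈1 = trans (+-congʳ (sym cc≈1))
      (solve 2 (λ c x → c :* c :- x :* x := (x :- c) :* (:- (x :+ c))) refl c x)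

    linear-factor : ∀ c x → c * c ≈ 1# → 1# - c * (x * (1# * 1#)) ≈ (x - c) * (- c)
    linear-factor c x cc≈1 = trans (+-congʳ (sym cc≈1))
      (solve 2 (λ c x → c :* c :- c :* (x :* (one :* one)) := (x :- c) :* (:- c)) refl c x)

    *-exchange : ∀ a b c d → (a * b) * (c * d) ≈ a * (c * (b * d))
    *-exchange = solve 4 (λ a b c d → (a :* b) :* (c :* d) := a :* (c :* (b :* d))) refl

    -‿square : ∀ a → (- a) * (- a) ≈ a * a
    -‿square = solve 1 (λ a → (:- a) :* (:- a) := a :* a) refl

    *-medial : ∀ a b c d → (a * b) * (c * d) ≈ (a * c) * (b * d)
    *-medial = solve 4 (λ a b c d → (a :* b) :* (c :* d) := (a :* c) :* (b :* d)) refl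

    *-cross : ∀ r c w → r * (c * w) ≈ w * (c * r)
    *-cross = solve 3 (λ r c w → r :* (c :* w) := w :* (c :* r)) refl

    -- To be read with l = 1 - x, r the product over the roots of c² = 1, a = ∏ (1 - x^d)^{N_d}, u =
    -- ∏ (1 + x^d)^{N_d} and v = ∏ (1 - x^d)^{M_d}.
    euler-ratio : ∀ l r a u v → l * (r * ((a * u) * (v * v))) ≈ (r * (a * v)) * (l * (u * v))
    euler-ratio = solve 5 (λ l r a u v → l :* (r :* ((a :* u) :* (v :* v))) := (r :* (a :* v)) :* (l :* (u :* v))) refl

-- Formal power series and their truncations.

module Series (R : CommutativeRing 0ℓ 0ℓ) where

  open CommutativeRing R
  open SetoidReasoning setoid

  open RingLemmas R using (+-swap; +-interchange)

  Ser : Set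
  Ser = ℕ → Carrier

  infix 4 _≋_
  _≋_ : Ser → Ser → Set
  f ≋ g = ∀ n → f n ≈ g n

  tail : Ser → Ser
  tail f n = f (suc n)

  0S : Ser
  0S _ = 0#

  const : Carrier → Ser
  const c zero    = c
  const c (suc _) = 0#

  1S : Ser
  1S = const 1#

  infixl 6 _⊕_
  infixl 7 _⊗_
  _⊕_ : Ser → Ser → Ser
  (f ⊕ g) n = f n + g n

  ⊖_ : Ser → Ser
  (⊖ f) n = - f n

  scale : Carrier → Ser → Ser
  scale c f n = c * f n

  -- The Cauchy product through f = f(0) + x · tail f, which lets the ring laws be proved by
  -- induction on the exponent, free of index sums.
  _⊗_ : Ser → Ser → Ser
  (f ⊗ g) zero    = f 0 * g 0
  (f ⊗ g) (suc n) = f 0 * g (suc n) + (tail f ⊗ g) n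

  -- Coefficient `n` of a product sees only exponents up to `n`. This is what makes truncation
  -- compatible with multiplication.
  ⊗-cong-≤ : ∀ n {f f′ g g′} → (∀ k → k ≤ n → f k ≈ f′ k) → (∀ k → k ≤ n → g k ≈ g′ k) → (f ⊗ g) n ≈ (f′ ⊗ g′) n
  ⊗-cong-≤ zero    p q = *-cong (p 0 z≤n) (q 0 z≤n)
  ⊗-cong-≤ (suc n) p q = +-cong (*-cong (p 0 z≤n) (q (suc n) ℕₚ.≤-refl))
    (⊗-cong-≤ n (λ k le → p (suc k) (s≤s le)) (λ k le → q k (ℕₚ.m≤n⇒m≤1+n le)))

  ⊗-cong : ∀ {f f′ g g′} → f ≋ f′ → g ≋ g′ → f ⊗ g ≋ f′ ⊗ g′
  ⊗-cong p q n = ⊗-cong-≤ n (λ k _ → p k) (λ k _ → q k)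

  ⊗-congˡ : ∀ f {g g′} → g ≋ g′ → f ⊗ g ≋ f ⊗ g′
  ⊗-congˡ f = ⊗-cong {f = f} (λ _ → refl)

  ⊗-congʳ : ∀ {f f′} g → f ≋ f′ → f ⊗ g ≋ f′ ⊗ g
  ⊗-congʳ g p = ⊗-cong {g = g} p (λ _ → refl)

  ⊗-zeroˡ : ∀ g → 0S ⊗ g ≋ 0S
  ⊗-zeroˡ g zero    = zeroˡ _
  ⊗-zeroˡ g (suc n) = trans (+-cong (zeroˡ _) (⊗-zeroˡ g n)) (+-identityˡ 0#)

  const-⊗ : ∀ c g → const c ⊗ g ≋ scale c g
  const-⊗ c g zero    = refl
  const-⊗ c g (suc n) = trans (+-congˡ (⊗-zeroˡ g n)) (+-identityʳ _)

  ⊗-distribʳ : ∀ h f g → (f ⊕ g) ⊗ h ≋ (f ⊗ h) ⊕ (g ⊗ h)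
  ⊗-distribʳ h f g zero    = distribʳ _ _ _
  ⊗-distribʳ h f g (suc n) =
    trans (+-cong (distribʳ _ _ _) (⊗-distribʳ h (tail f) (tail g) n)) (+-interchange _ _ _ _)

  scale-⊗ : ∀ c f g → scale c f ⊗ g ≋ scale c (f ⊗ g)
  scale-⊗ c f g zero    = *-assoc _ _ _
  scale-⊗ c f g (suc n) =
    trans (+-cong (*-assoc _ _ _) (scale-⊗ c (tail f) g n)) (sym (distribˡ _ _ _))

  ⊗-sucʳ : ∀ f g n → (f ⊗ g) (suc n) ≈ f (suc n) * g 0 + (f ⊗ tail g) n
  ⊗-sucʳ f g zero    = +-comm _ _
  ⊗-sucʳ f g (suc n) = trans (+-congˡ (⊗-sucʳ (tail f) g n)) (+-swap _ _ _)

  ⊗-comm : ∀ f g → f ⊗ g ≋ g ⊗ f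
  ⊗-comm f g zero    = *-comm _ _
  ⊗-comm f g (suc n) =
    trans (+-cong (*-comm _ _) (⊗-comm (tail f) g n)) (sym (⊗-sucʳ g f n))

  ⊗-assoc : ∀ f g h → (f ⊗ g) ⊗ h ≋ f ⊗ (g ⊗ h)
  ⊗-assoc f g h zero    = *-assoc _ _ _
  ⊗-assoc f g h (suc n) = begin
    (f 0 * g 0) * h (suc n) + (tail (f ⊗ g) ⊗ h) n
      ≈⟨ +-congˡ (⊗-distribʳ h (scale (f 0) (tail g)) (tail f ⊗ g) n) ⟩
    (f 0 * g 0) * h (suc n) + ((scale (f 0) (tail g) ⊗ h) n + ((tail f ⊗ g) ⊗ h) n)
      ≈⟨ +-cong (*-assoc _ _ _) (+-cong (scale-⊗ (f 0) (tail g) h n) (⊗-assoc (tail f) g h n)) ⟩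
    f 0 * (g 0 * h (suc n)) + (f 0 * (tail g ⊗ h) n + (tail f ⊗ (g ⊗ h)) n)
      ≈⟨ +-assoc _ _ _ ⟨
    (f 0 * (g 0 * h (suc n)) + f 0 * (tail g ⊗ h) n) + (tail f ⊗ (g ⊗ h)) n
      ≈⟨ +-congʳ (distribˡ _ _ _) ⟨
    f 0 * (g ⊗ h) (suc n) + (tail f ⊗ (g ⊗ h)) n ∎

  ⊗-identityˡ : ∀ f → 1S ⊗ f ≋ f
  ⊗-identityˡ f n = trans (const-⊗ 1# f n) (*-identityˡ _)

  ⊗-identityʳ : ∀ f → f ⊗ 1S ≋ f
  ⊗-identityʳ f n = trans (⊗-comm f 1S n) (⊗-identityˡ f n)

  ⊗-distribˡ : ∀ h f g → h ⊗ (f ⊕ g) ≋ (h ⊗ f) ⊕ (h ⊗ g)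
  ⊗-distribˡ h f g n = trans (⊗-comm h (f ⊕ g) n)
    (trans (⊗-distribʳ h f g n) (+-cong (⊗-comm f h n) (⊗-comm g h n)))

  -- Power series with two series identified when they agree on a downward closed
  -- set of exponents; J = everything gives R[[x]], J = (_≤ N) gives R[x]/(x^{N+1}).
  ringOn : (J : ℕ → Set) → (∀ {m n} → m ≤ n → J n → J m) → CommutativeRing 0ℓ 0ℓ
  ringOn J down = record
    { Carrier = Ser ; _≈_ = λ f g → ∀ n → J n → f n ≈ g n
    ; _+_ = _⊕_ ; _*_ = _⊗_ ; -_ = ⊖_ ; 0# = 0S ; 1# = 1S
    ; isCommutativeRing = record
      { isRing = record
        { +-isAbelianGroup = record
          { isGroup = record
            { isMonoid = record
              { isSemigroup = record
                { isMagma = record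
                  { isEquivalence = record
                    { refl = λ n _ → refl ; sym = λ p n j → sym (p n j) ; trans = λ p q n j → trans (p n j) (q n j) }
                  ; ∙-cong = λ p q n j → +-cong (p n j) (q n j) }
                ; assoc = λ f g h n _ → +-assoc _ _ _ }
              ; identity = (λ f n _ → +-identityˡ _) , (λ f n _ → +-identityʳ _) }
            ; inverse = (λ f n _ → -‿inverseˡ _) , (λ f n _ → -‿inverseʳ _)
            ; ⁻¹-cong = λ p n j → -‿cong (p n j) }
          ; comm = λ f g n _ → +-comm _ _ }
        ; *-cong = λ p q n j → ⊗-cong-≤ n (λ k le → p k (down le j)) (λ k le → q k (down le j))
        ; *-assoc = λ f g h n _ → ⊗-assoc f g h n
        ; *-identity = (λ f n _ → ⊗-identityˡ f n) , (λ f n _ → ⊗-identityʳ f n)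
        ; distrib = (λ h f g n _ → ⊗-distribˡ h f g n) , (λ h f g n _ → ⊗-distribʳ h f g n) }
      ; *-comm = λ f g n _ → ⊗-comm f g n } }

  X : Ser → Ser
  X f zero    = 0#
  X f (suc n) = f n

  shift : ℕ → Ser → Ser
  shift zero    f = f
  shift (suc d) f = X (shift d f)

  X-cong : ∀ {f g} → f ≋ g → X f ≋ X g
  X-cong p zero    = refl
  X-cong p (suc n) = p n

  X-⊗ : ∀ f g → X f ⊗ g ≋ X (f ⊗ g)
  X-⊗ f g zero    = zeroˡ _
  X-⊗ f g (suc n) = trans (+-congʳ (zeroˡ _)) (+-identityˡ _)

  shift-⊗ : ∀ d f g → shift d f ⊗ g ≋ shift d (f ⊗ g)
  shift-⊗ zero    f g n = refl
  shift-⊗ (suc d) f g n = trans (X-⊗ (shift d f) g n) (X-cong (shift-⊗ d f g) n)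

  shift-cong : ∀ d {f g} → f ≋ g → shift d f ≋ shift d g
  shift-cong zero    p = p
  shift-cong (suc d) p = X-cong (shift-cong d p)

  shift-+ : ∀ d f n → shift d f (d ℕ.+ n) ≡ f n
  shift-+ zero    f n = ≡.refl
  shift-+ (suc d) f n = shift-+ d f n

  shift-< : ∀ d f n → n ℕ.< d → shift d f n ≡ 0#
  shift-< (suc d) f zero    _       = ≡.refl
  shift-< (suc d) f (suc n) (s≤s p) = shift-< d f n p

  x^ : ℕ → Ser
  x^ d = shift d 1S

  x^-⊗ : ∀ d g → x^ d ⊗ g ≋ shift d g
  x^-⊗ d g n = trans (shift-⊗ d 1S g n) (shift-cong d (⊗-identityˡ g) n)

  shift-shift : ∀ a b f → shift a (shift b f) ≡ shift (a ℕ.+ b) f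
  shift-shift zero    b f = ≡.refl
  shift-shift (suc a) b f = ≡.cong X (shift-shift a b f)

  x^-+ : ∀ a b → x^ a ⊗ x^ b ≋ x^ (a ℕ.+ b)
  x^-+ a b n = trans (x^-⊗ a (x^ b) n) (reflexive (≡.cong (λ f → f n) (shift-shift a b 1S)))

open import Relation.Binary.PropositionalEquality

-- Pascal's rule for binomial coefficients with integer upper argument.

module Binomials where

  open import Data.Nat using (_!; NonZero)
  open import Data.Integer using (+_; -[1+_])
  toℚᵘ-/ : ∀ i d .{{_ : NonZero d}} → toℚᵘ (i ℚ./ d) ℚᵘ.≃ (i ℚᵘ./ d)
  toℚᵘ-/ i (suc d) = ℚₚ.toℚᵘ-fromℚᵘ (ℚᵘ.mkℚᵘ i d)

  -- Among unnormalised fractions equality is cross multiplication, so the integer identity suffices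
  -- and no gcd appears.
  /-≡-+ : ∀ x y z a b c .{{_ : NonZero a}} .{{_ : NonZero b}} .{{_ : NonZero c}} →
          z ℤ.* (+ a ℤ.* + b) ≡ (x ℤ.* + b ℤ.+ y ℤ.* + a) ℤ.* + c →
          z ℚ./ c ≡ x ℚ./ a ℚ.+ y ℚ./ b
  /-≡-+ x y z a@(suc _) b@(suc _) c@(suc _) eq = ℚₚ.toℚᵘ-injective (begin
    toℚᵘ (z ℚ./ c)                          ≈⟨ toℚᵘ-/ z c ⟩
    z ℚᵘ./ c                                ≈⟨ ℚᵘ.*≡* eq ⟩
    x ℚᵘ./ a ℚᵘ.+ y ℚᵘ./ b                  ≈⟨ ℚᵘₚ.+-cong (ℚᵘₚ.≃-sym (toℚᵘ-/ x a)) (ℚᵘₚ.≃-sym (toℚᵘ-/ y b)) ⟩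
    toℚᵘ (x ℚ./ a) ℚᵘ.+ toℚᵘ (y ℚ./ b)      ≈⟨ ℚᵘₚ.≃-sym (ℚₚ.toℚᵘ-homo-+ (x ℚ./ a) (y ℚ./ b)) ⟩
    toℚᵘ (x ℚ./ a ℚ.+ y ℚ./ b)              ∎)
    where open import Relation.Binary.Reasoning.Setoid ℚᵘₚ.≃-setoid

  -- The recursion of `fallingℤ` multiplies by the lowest factor; Pascal's rule needs the highest
  -- one split off, so that both sides share `fallingℤ m k`.
  fallingℤ-suc : ∀ m k → fallingℤ (ℤ.suc m) (suc k) ≡ ℤ.suc m ℤ.* fallingℤ m k
  fallingℤ-suc m zero    = lemma m
    where
    lemma : ∀ m → + 1 ℤ.* ((+ 1 ℤ.+ m) ℤ.- + 0) ≡ (+ 1 ℤ.+ m) ℤ.* + 1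
    lemma = solve-∀
  fallingℤ-suc m (suc k) = begin
    fallingℤ (ℤ.suc m) (suc k) ℤ.* (ℤ.suc m ℤ.- + suc k)
      ≡⟨ cong₂ ℤ._*_ (fallingℤ-suc m k) (lemma m (+ k)) ⟩
    (ℤ.suc m ℤ.* fallingℤ m k) ℤ.* (m ℤ.- + k)
      ≡⟨ ℤₚ.*-assoc (ℤ.suc m) (fallingℤ m k) (m ℤ.- + k) ⟩
    ℤ.suc m ℤ.* fallingℤ m (suc k) ∎
    where
    open ≡-Reasoning
    lemma : ∀ m k → (+ 1 ℤ.+ m) ℤ.- (+ 1 ℤ.+ k) ≡ m ℤ.- k
    lemma = solve-∀

  fallingℤ-pascal : ∀ m k → fallingℤ (ℤ.suc m) (suc k) ≡ fallingℤ m (suc k) ℤ.+ fallingℤ m k ℤ.* + suc k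
  fallingℤ-pascal m k = trans (fallingℤ-suc m k) (lemma m (+ k) (fallingℤ m k))
    where
    lemma : ∀ m k f → (+ 1 ℤ.+ m) ℤ.* f ≡ f ℤ.* (m ℤ.- k) ℤ.+ f ℤ.* (+ 1 ℤ.+ k)
    lemma = solve-∀

  binomℕ-pascal : ∀ m k → binomℕ (ℤ.suc m) (suc k) ≡ binomℕ m (suc k) ℚ.+ binomℕ m k
  binomℕ-pascal m k = /-≡-+ x y (fallingℤ (ℤ.suc m) (suc k)) (suc k !) (k !) (suc k !)
    {{suc k !≢0}} {{k !≢0}} {{suc k !≢0}} (begin
    fallingℤ (ℤ.suc m) (suc k) ℤ.* (+ (suc k !) ℤ.* + (k !))
      ≡⟨ cong₂ (λ z c → z ℤ.* (c ℤ.* + (k !))) (fallingℤ-pascal m k) (ℤₚ.pos-* (suc k) (k !)) ⟩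
    (x ℤ.+ y ℤ.* + suc k) ℤ.* ((+ suc k ℤ.* + (k !)) ℤ.* + (k !))
      ≡⟨ lemma x y (+ suc k) (+ (k !)) ⟩
    (x ℤ.* + (k !) ℤ.+ y ℤ.* (+ suc k ℤ.* + (k !))) ℤ.* (+ suc k ℤ.* + (k !))
      ≡⟨ cong (λ c → (x ℤ.* + (k !) ℤ.+ y ℤ.* c) ℤ.* c) (ℤₚ.pos-* (suc k) (k !)) ⟨
    (x ℤ.* + (k !) ℤ.+ y ℤ.* + (suc k !)) ℤ.* + (suc k !) ∎)
    where
    open ≡-Reasoning
    x = fallingℤ m (suc k)
    y = fallingℤ m k
    lemma : ∀ x y n w → (x ℤ.+ y ℤ.* n) ℤ.* ((n ℤ.* w) ℤ.* w) ≡ (x ℤ.* w ℤ.+ y ℤ.* (n ℤ.* w)) ℤ.* (n ℤ.* w)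
    lemma = solve-∀

  signℚ : Sign → ℚ
  signℚ Sign.+ = 1ℚ
  signℚ Sign.- = ℚ.- 1ℚ

  -- The coefficients of (1 + t)^m for `Sign.+` and of (1 - t)^m for `Sign.-`: the negative lower
  -- argument supplies the factor (-1)^k.
  binomSeries : Sign → ℤ → ℕ → ℚ
  binomSeries σ m k = binom m (σ ℤ.◃ k)

  binomSeries-zero : ∀ σ m → binomSeries σ m 0 ≡ 1ℚ
  binomSeries-zero Sign.+ m = refl
  binomSeries-zero Sign.- m = refl

  binomSeries-0 : ∀ σ k → binomSeries σ (+ 0) (suc k) ≡ 0ℚ
  binomSeries-0 σ k = helper σ
    where
    falling-0 : ∀ k → fallingℤ (+ 0) (suc k) ≡ + 0
    falling-0 zero    = refl
    falling-0 (suc k) = cong (ℤ._* (+ 0 ℤ.- + suc k)) (falling-0 k)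
    binomℕ-0 : binomℕ (+ 0) (suc k) ≡ 0ℚ
    binomℕ-0 = trans (cong (λ z → (z ℚ./ (suc k !)) {{suc k !≢0}}) (falling-0 k))
      (ℚₚ.0/n≡0 (suc k !) {{suc k !≢0}})
    helper : ∀ σ → binomSeries σ (+ 0) (suc k) ≡ 0ℚ
    helper Sign.+ = binomℕ-0
    helper Sign.- = trans (cong (signPow (suc k) ℚ.*_) binomℕ-0) (ℚₚ.*-zeroʳ (signPow (suc k)))

  -- This is (1 ± t)^(m+1) = (1 ± t)(1 ± t)^m on coefficients. It holds for all integers `m`, so it
  -- serves for climbing from exponent 0 as well as for climbing up to 0 from a negative one.
  binomSeries-pascal : ∀ σ m k → binomSeries σ (ℤ.suc m) (suc k) ≡
                       binomSeries σ m (suc k) ℚ.+ signℚ σ ℚ.* binomSeries σ m k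
  binomSeries-pascal Sign.+ m k =
    trans (binomℕ-pascal m k) (cong (binomℕ m (suc k) ℚ.+_) (trans (sym (ℚₚ.*-identityˡ _)) (cong (λ j → 1ℚ ℚ.* binom m j) (sym (ℤₚ.+◃n≡+n k)))))
  binomSeries-pascal Sign.- m k = begin
    signPow (suc k) ℚ.* binomℕ (ℤ.suc m) (suc k)
      ≡⟨ cong (signPow (suc k) ℚ.*_) (binomℕ-pascal m k) ⟩
    signPow (suc k) ℚ.* (binomℕ m (suc k) ℚ.+ binomℕ m k)
      ≡⟨ ℚₚ.*-distribˡ-+ (signPow (suc k)) _ _ ⟩
    signPow (suc k) ℚ.* binomℕ m (suc k) ℚ.+ signPow (suc k) ℚ.* binomℕ m k
      ≡⟨ cong (signPow (suc k) ℚ.* binomℕ m (suc k) ℚ.+_) (begin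
        (ℚ.- signPow k) ℚ.* binomℕ m k         ≡⟨ ℚₚ.neg-distribˡ-* (signPow k) _ ⟨
        ℚ.- (signPow k ℚ.* binomℕ m k)         ≡⟨ cong ℚ.-_ (trans (signed k) (sym (ℚₚ.*-identityˡ _))) ⟩
        ℚ.- (1ℚ ℚ.* binomSeries Sign.- m k)    ≡⟨ ℚₚ.neg-distribˡ-* 1ℚ (binomSeries Sign.- m k) ⟩
        ℚ.- 1ℚ ℚ.* binomSeries Sign.- m k      ∎) ⟩
    signPow (suc k) ℚ.* binomℕ m (suc k) ℚ.+ ℚ.- 1ℚ ℚ.* binomSeries Sign.- m k ∎
    where
    open ≡-Reasoning
    signed : ∀ k → signPow k ℚ.* binomℕ m k ≡ binomSeries Sign.- m k
    signed zero    = refl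
    signed (suc k) = refl

-- Substitution of x^d in a binomial series.

module PartitionSeries where

  open import Data.Rational using (_+_; _*_)
  open Binomials

  ℚring = ℚₚ.+-*-commutativeRing
  open Series ℚring
  open CommutativeRing ℚring using (+-assoc; +-identityˡ; +-identityʳ; *-identityˡ; zeroˡ; zeroʳ; distribˡ; distribʳ; *-assoc)

  open RingLemmas ℚring using () renaming (+-interchange to interchange)

  Σ< : ℕ → (ℕ → ℚ) → ℚ
  Σ< n f = sumℚ (applyUpTo f n)

  Σ<-cong : ∀ n {f g} → (∀ i → i < n → f i ≡ g i) → Σ< n f ≡ Σ< n g
  Σ<-cong zero    p = refl
  Σ<-cong (suc n) p = cong₂ _+_ (p 0 (s≤s z≤n)) (Σ<-cong n (λ i lt → p (suc i) (s≤s lt)))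

  Σ<-0 : ∀ n → Σ< n (λ _ → 0ℚ) ≡ 0ℚ
  Σ<-0 zero    = refl
  Σ<-0 (suc n) = trans (+-identityˡ _) (Σ<-0 n)

  Σ<-+ : ∀ n f g → Σ< n (λ i → f i + g i) ≡ Σ< n f + Σ< n g
  Σ<-+ zero    f g = refl
  Σ<-+ (suc n) f g = trans (cong (f 0 + g 0 +_) (Σ<-+ n (f ∘ suc) (g ∘ suc))) (interchange (f 0) (g 0) _ _)

  Σ<-* : ∀ n c f → Σ< n (λ i → c * f i) ≡ c * Σ< n f
  Σ<-* zero    c f = sym (zeroʳ c)
  Σ<-* (suc n) c f = trans (cong (c * f 0 +_) (Σ<-* n c (f ∘ suc))) (sym (distribˡ c _ _))

  Σ<-extend : ∀ {m n} f → m ≤ n → (∀ i → m ≤ i → f i ≡ 0ℚ) → Σ< n f ≡ Σ< m f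
  Σ<-extend {n = n} f z≤n p = trans (Σ<-cong n (λ i _ → p i z≤n)) (Σ<-0 n)
  Σ<-extend f (s≤s le) p = cong (f 0 +_) (Σ<-extend (f ∘ suc) le (λ i q → p (suc i) (s≤s q)))

  -- substPow d b G is the series b(x^d) · G.
  module _ (d : ℕ) (b : ℕ → ℚ) (G : Ser) where
    partial : ℕ → Ser
    partial k n = Σ< k (λ j → b j * shift (j ℕ.* d) G n)

    substPow : Ser
    substPow n = partial (suc n) n

  shift-Σ : ∀ d k (f : ℕ → Ser) n → shift d (λ m → Σ< k (λ j → f j m)) n ≡ Σ< k (λ j → shift d (f j) n)
  shift-Σ zero    k f n       = refl
  shift-Σ (suc d) k f zero    = sym (Σ<-0 k)
  shift-Σ (suc d) k f (suc n) = shift-Σ d k f n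

  shift-scale : ∀ d c f n → shift d (scale c f) n ≡ c * shift d f n
  shift-scale zero    c f n       = refl
  shift-scale (suc d) c f zero    = sym (zeroʳ c)
  shift-scale (suc d) c f (suc n) = shift-scale d c f n

  shift-⊕ : ∀ d f g n → shift d (f ⊕ g) n ≡ shift d f n + shift d g n
  shift-⊕ zero    f g n       = refl
  shift-⊕ (suc d) f g zero    = refl
  shift-⊕ (suc d) f g (suc n) = shift-⊕ d f g n

  -- The terms with j > n are shifted by at least j and so miss exponent `n`: extending the sum
  -- changes nothing.
  partial-stable : ∀ d b G {k n} → n < k → partial (suc d) b G k n ≡ substPow (suc d) b G n
  partial-stable d b G {k} {n} n<k = Σ<-extend _ n<k (λ i n<i →
    trans (cong (b i *_) (shift-< (i ℕ.* suc d) G n (ℕₚ.<-≤-trans n<i (ℕₚ.m≤m*n i (suc d))))) (zeroʳ (b i)))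

  -- From b(y) = b(0) + y · (tail b)(y) at y = x^d. The only delicate point is that the sum on the
  -- left stops at the exponent before the shift, which `partial-stable` absorbs.
  substPow-unfold : ∀ d b G → substPow (suc d) b G ≋ scale (b 0) G ⊕ shift (suc d) (substPow (suc d) (tail b) G)
  substPow-unfold d b G n = cong (b 0 * G n +_) (begin
    Σ< n (λ j → tail b j * shift (suc d ℕ.+ j ℕ.* suc d) G n)
      ≡⟨ Σ<-cong n (λ j _ → trans (cong (λ f → tail b j * f n) (sym (shift-shift (suc d) (j ℕ.* suc d) G)))
           (sym (shift-scale (suc d) (tail b j) (shift (j ℕ.* suc d) G) n))) ⟩
    Σ< n (λ j → shift (suc d) (scale (tail b j) (shift (j ℕ.* suc d) G)) n)
      ≡⟨ shift-Σ (suc d) n (λ j → scale (tail b j) (shift (j ℕ.* suc d) G)) n ⟨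
    shift (suc d) (partial (suc d) (tail b) G n) n
      ≡⟨ stable n (ℕₚ.≤-<-connex (suc d) n) ⟩
    shift (suc d) (substPow (suc d) (tail b) G) n ∎)
    where
    open ≡-Reasoning
    open import Data.Sum using (_⊎_; inj₁; inj₂)
    stable : ∀ n → suc d ≤ n ⊎ n < suc d →
      shift (suc d) (partial (suc d) (tail b) G n) n ≡ shift (suc d) (substPow (suc d) (tail b) G) n
    stable n (inj₂ n<d) = trans (shift-< (suc d) _ n n<d) (sym (shift-< (suc d) _ n n<d))
    stable n (inj₁ d≤n) with ℕₚ.m≤n⇒∃[o]m+o≡n d≤n
    ... | m , refl = trans (shift-+ (suc d) _ m) (trans (partial-stable d (tail b) G (s≤s (ℕₚ.m≤n+m m d))) (sym (shift-+ (suc d) _ m)))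

  substPow-cong : ∀ d {b b′} G → b ≋ b′ → substPow d b G ≋ substPow d b′ G
  substPow-cong d G p n = Σ<-cong (suc n) (λ j _ → cong (_* shift (j ℕ.* d) G n) (p j))

  substPow-⊕-scale : ∀ d b c b′ G → substPow d (b ⊕ scale c b′) G ≋ substPow d b G ⊕ scale c (substPow d b′ G)
  substPow-⊕-scale d b c b′ G n = begin
    Σ< (suc n) (λ j → (b j + c * b′ j) * s j)
      ≡⟨ Σ<-cong (suc n) (λ j _ → trans (distribʳ (s j) (b j) (c * b′ j)) (cong (b j * s j +_) (*-assoc c (b′ j) (s j)))) ⟩
    Σ< (suc n) (λ j → b j * s j + c * (b′ j * s j))
      ≡⟨ Σ<-+ (suc n) (λ j → b j * s j) (λ j → c * (b′ j * s j)) ⟩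
    substPow d b G n + Σ< (suc n) (λ j → c * (b′ j * s j))
      ≡⟨ cong (substPow d b G n +_) (Σ<-* (suc n) c (λ j → b′ j * s j)) ⟩
    substPow d b G n + c * substPow d b′ G n ∎
    where
    open ≡-Reasoning
    s : ℕ → ℚ
    s j = shift (j ℕ.* d) G n

  substPow-1S : ∀ d {b} G → b ≋ 1S → substPow (suc d) b G ≋ G
  substPow-1S d {b} G p n = begin
    substPow (suc d) b G n                                 ≡⟨ substPow-cong (suc d) G p n ⟩
    substPow (suc d) 1S G n                                ≡⟨ cong₂ _+_ (*-identityˡ (G n))
      (trans (Σ<-cong n {λ j → 0ℚ * shift (suc j ℕ.* suc d) G n} (λ j _ → zeroˡ (shift (suc j ℕ.* suc d) G n))) (Σ<-0 n)) ⟩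
    G n + 0ℚ                                               ≡⟨ +-identityʳ _ ⟩
    G n                                                    ∎
    where open ≡-Reasoning

  1+_·x^_ : ℚ → ℕ → Ser
  1+ t ·x^ d = 1S ⊕ scale t (x^ d)

  -- The hypotheses say b′(y) = (1 + t y) b(y); substitution of x^d preserves this.
  substPow-pascal : ∀ d t {b b′} G → b′ 0 ≡ b 0 → (∀ k → b′ (suc k) ≡ b (suc k) + t * b k) →
                    substPow (suc d) b′ G ≋ (1+ t ·x^ (suc d)) ⊗ substPow (suc d) b G
  substPow-pascal d t {b} {b′} G p q n = begin
    substPow (suc d) b′ G n
      ≡⟨ substPow-unfold d b′ G n ⟩
    b′ 0 * G n + shift (suc d) (substPow (suc d) (tail b′) G) n
      ≡⟨ cong₂ _+_ (cong (_* G n) p) (shift-cong (suc d) (λ m → trans (substPow-cong (suc d) G q m)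
           (substPow-⊕-scale (suc d) (tail b) t b G m)) n) ⟩
    b 0 * G n + shift (suc d) (substPow (suc d) (tail b) G ⊕ scale t S) n
      ≡⟨ cong (b 0 * G n +_) (shift-⊕ (suc d) (substPow (suc d) (tail b) G) (scale t S) n) ⟩
    b 0 * G n + (shift (suc d) (substPow (suc d) (tail b) G) n + shift (suc d) (scale t S) n)
      ≡⟨ +-assoc (b 0 * G n) _ _ ⟨
    (b 0 * G n + shift (suc d) (substPow (suc d) (tail b) G) n) + shift (suc d) (scale t S) n
      ≡⟨ cong₂ _+_ (substPow-unfold d b G n) (sym (shift-scale (suc d) t S n)) ⟨
    S n + t * shift (suc d) S n
      ≡⟨ cong₂ _+_ (⊗-identityˡ S n) (trans (scale-⊗ t (x^ (suc d)) S n) (cong (t *_) (x^-⊗ (suc d) S n))) ⟨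
    (1S ⊗ S) n + (scale t (x^ (suc d)) ⊗ S) n
      ≡⟨ ⊗-distribʳ S 1S (scale t (x^ (suc d))) n ⟨
    ((1+ t ·x^ (suc d)) ⊗ S) n ∎
    where
    open ≡-Reasoning
    S = substPow (suc d) b G

  infixr 8 _^^_
  _^^_ : Ser → ℕ → Ser
  f ^^ zero  = 1S
  f ^^ suc n = f ⊗ f ^^ n

  substPow-binom⁺ : ∀ σ d s G → substPow (suc d) (binomSeries σ (ℤ.+ s)) G ≋ (1+ signℚ σ ·x^ (suc d)) ^^ s ⊗ G
  substPow-binom⁺ σ d zero G n = trans (substPow-1S d G ≋1S n) (sym (⊗-identityˡ G n))
    where
    ≋1S : binomSeries σ (ℤ.+ 0) ≋ 1S
    ≋1S zero    = binomSeries-zero σ (ℤ.+ 0)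
    ≋1S (suc k) = binomSeries-0 σ k
  substPow-binom⁺ σ d (suc s) G n = begin
    substPow (suc d) (binomSeries σ (ℤ.+ suc s)) G n
      ≡⟨ substPow-pascal d (signℚ σ) {binomSeries σ (ℤ.+ s)} {binomSeries σ (ℤ.+ suc s)} G
           (trans (binomSeries-zero σ (ℤ.+ suc s)) (sym (binomSeries-zero σ (ℤ.+ s)))) (binomSeries-pascal σ (ℤ.+ s)) n ⟩
    (f ⊗ substPow (suc d) (binomSeries σ (ℤ.+ s)) G) n
      ≡⟨ ⊗-congˡ f (substPow-binom⁺ σ d s G) n ⟩
    (f ⊗ (f ^^ s ⊗ G)) n
      ≡⟨ ⊗-assoc f (f ^^ s) G n ⟨
    (f ^^ suc s ⊗ G) n ∎
    where
    open ≡-Reasoning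
    f = 1+ signℚ σ ·x^ (suc d)

  -- Each factor 1 ± x^d raises the exponent -(s+1) by one until it reaches 0. Stating the result as
  -- a product keeps inverses of series out of the argument.
  substPow-binom⁻ : ∀ σ d s G → (1+ signℚ σ ·x^ (suc d)) ^^ s ⊗ substPow (suc d) (binomSeries σ (ℤ.- (ℤ.+ s))) G ≋ G
  substPow-binom⁻ σ d zero G n = trans (⊗-identityˡ (substPow (suc d) (binomSeries σ (ℤ.+ 0)) G) n)
    (trans (substPow-binom⁺ σ d 0 G n) (⊗-identityˡ G n))
  substPow-binom⁻ σ d (suc s) G n = begin
    ((f ⊗ f ^^ s) ⊗ S) n
      ≡⟨ ⊗-congʳ S (⊗-comm f (f ^^ s)) n ⟩
    ((f ^^ s ⊗ f) ⊗ S) n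
      ≡⟨ ⊗-assoc (f ^^ s) f S n ⟩
    (f ^^ s ⊗ (f ⊗ S)) n
      ≡⟨ ⊗-congˡ (f ^^ s) (substPow-pascal d (signℚ σ) {binomSeries σ m} {binomSeries σ (ℤ.suc m)} G
           (trans (binomSeries-zero σ (ℤ.suc m)) (sym (binomSeries-zero σ m))) (binomSeries-pascal σ m)) n ⟨
    (f ^^ s ⊗ substPow (suc d) (binomSeries σ (ℤ.suc m)) G) n
      ≡⟨ cong (λ i → (f ^^ s ⊗ substPow (suc d) (binomSeries σ i) G) n) (suc-neg s) ⟩
    (f ^^ s ⊗ substPow (suc d) (binomSeries σ (ℤ.- (ℤ.+ s))) G) n
      ≡⟨ substPow-binom⁻ σ d s G n ⟩
    G n ∎
    where
    open ≡-Reasoning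
    f = 1+ signℚ σ ·x^ (suc d)
    m = ℤ.- (ℤ.+ suc s)
    S = substPow (suc d) (binomSeries σ m) G
    suc-neg : ∀ s → ℤ.suc (ℤ.- (ℤ.+ suc s)) ≡ ℤ.- (ℤ.+ s)
    suc-neg zero    = refl
    suc-neg (suc s) = refl

  -- Sums over partitions as products over part sizes.

  sumℚ-++ : ∀ xs ys → sumℚ (xs ++ ys) ≡ sumℚ xs + sumℚ ys
  sumℚ-++ []       ys = sym (+-identityˡ _)
  sumℚ-++ (x ∷ xs) ys = trans (cong (x +_) (sumℚ-++ xs ys)) (sym (+-assoc x _ _))

  sumℚ-concatMap : ∀ {A B : Set} (w : B → ℚ) (f : A → List B) xs →
                   sumℚ (map w (concatMap f xs)) ≡ sumℚ (map (λ x → sumℚ (map w (f x))) xs)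
  sumℚ-concatMap w f []       = refl
  sumℚ-concatMap w f (x ∷ xs) = begin
    sumℚ (map w (f x ++ concatMap f xs))               ≡⟨ cong sumℚ (Listₚ.map-++ w (f x) _) ⟩
    sumℚ (map w (f x) ++ map w (concatMap f xs))       ≡⟨ sumℚ-++ (map w (f x)) _ ⟩
    sumℚ (map w (f x)) + sumℚ (map w (concatMap f xs)) ≡⟨ cong (sumℚ (map w (f x)) +_) (sumℚ-concatMap w f xs) ⟩
    sumℚ (map w (f x)) + sumℚ (map (λ x → sumℚ (map w (f x))) xs) ∎
    where open ≡-Reasoning

  sumℚ-scale : ∀ {A : Set} (c : ℚ) {v : A → ℚ} (w : A → ℚ) {xs} → All (λ a → v a ≡ c * w a) xs → sumℚ (map v xs) ≡ c * sumℚ (map w xs)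
  sumℚ-scale c w []       = sym (zeroʳ c)
  sumℚ-scale c w (p ∷ ps) = trans (cong₂ _+_ p (sumℚ-scale c w ps)) (sym (distribˡ c _ _))

  partsBounded-suc : ∀ n m → partsBounded n (suc m) ≡
    concatMap (λ j → if j ℕ.* suc m ≤ᵇ n then map (replicate j (suc m) ++_) (partsBounded (n ∸ j ℕ.* suc m) m) else [])
              (upTo (suc n))
  partsBounded-suc zero    m = refl
  partsBounded-suc (suc n) m = refl

  partsBounded-≤ : ∀ n m → All (All (_≤ m)) (partsBounded n m)
  partsBounded-≤ zero    zero = [] ∷ []
  partsBounded-≤ (suc n) zero = []
  partsBounded-≤ n (suc m) rewrite partsBounded-suc n m =
    Allₚ.concat⁺ (Allₚ.map⁺ (All.universal block (upTo (suc n))))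
    where
    block : ∀ j → All (All (_≤ suc m)) (if j ℕ.* suc m ≤ᵇ n then map (replicate j (suc m) ++_) (partsBounded (n ∸ j ℕ.* suc m) m) else [])
    block j with j ℕ.* suc m ≤ᵇ n
    ... | true  = Allₚ.map⁺ (All.map (λ ps → Allₚ.++⁺ (Allₚ.replicate⁺ j ℕₚ.≤-refl) (All.map ℕₚ.m≤n⇒m≤1+n ps))
                    (partsBounded-≤ (n ∸ j ℕ.* suc m) m))
    ... | false = []

  module _ {d : ℕ} {μ : List ℕ} (fresh : All (d ≢_) μ) where
    private
      filter-fresh : ∀ {ν} → All (d ≢_) ν → filter (λ y → ¬? (d ℕ.≟ y)) ν ≡ ν
      filter-fresh = Listₚ.filter-all (λ y → ¬? (d ℕ.≟ y))

    B-replicate : ∀ j → B (replicate (suc j) d ++ μ) ≡ d ∷ B μ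
    B-replicate zero    = cong (d ∷_) (filter-fresh (Allₚ.deduplicate⁺ ℕ._≟_ fresh))
    B-replicate (suc j) = cong (d ∷_) (trans (cong (filter (λ y → ¬? (d ℕ.≟ y))) (B-replicate j))
      (trans (Listₚ.filter-reject (λ y → ¬? (d ℕ.≟ y)) (λ d≢d → d≢d refl)) (filter-fresh (Allₚ.deduplicate⁺ ℕ._≟_ fresh))))

    E-replicate : ∀ j → E (replicate j d ++ μ) d ≡ j
    E-replicate zero    = cong length (Listₚ.filter-none (d ℕ.≟_) fresh)
    E-replicate (suc j) = trans (cong length (Listₚ.filter-accept (d ℕ.≟_) refl)) (cong suc (E-replicate j))

    E-replicate-other : ∀ j {c} → d ≢ c → E (replicate j d ++ μ) c ≡ E μ c
    E-replicate-other zero    d≢c = refl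
    E-replicate-other (suc j) d≢c = trans (cong length (Listₚ.filter-reject (_ ℕ.≟_) (λ c≡d → d≢c (sym c≡d)))) (E-replicate-other j d≢c)

  module PartitionSum (b : ℕ → ℕ → ℚ) (b-zero : ∀ d → b d 0 ≡ 1ℚ) where

    weight : List ℕ → ℚ
    weight λ′ = prodℚ (map (λ d → b d (E λ′ d)) (B λ′))

    -- For j ≥ 1 the block adds the single distinct part `d`. For j = 0 it adds none, and `b-zero`
    -- turns the missing factor into b_d(0) = 1.
    weight-replicate : ∀ {d μ} j → All (d ≢_) μ → weight (replicate j d ++ μ) ≡ b d j * weight μ
    weight-replicate {d} {μ} zero    fresh = trans (sym (*-identityˡ (weight μ))) (cong (_* weight μ) (sym (b-zero d)))
    weight-replicate {d} {μ} (suc j) fresh = begin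
      prodℚ (map w (B (replicate (suc j) d ++ μ)))  ≡⟨ cong (λ l → prodℚ (map w l)) (B-replicate fresh j) ⟩
      w d * prodℚ (map w (B μ))                     ≡⟨ cong₂ (λ e l → b d e * prodℚ l) (E-replicate fresh (suc j))
        (Listₚ.map-cong-local (All.map (λ {c} d≢c → cong (b c) (E-replicate-other fresh (suc j) d≢c)) (Allₚ.deduplicate⁺ ℕ._≟_ fresh))) ⟩
      b d (suc j) * weight μ ∎
      where
      open ≡-Reasoning
      w : ℕ → ℚ
      w c = b c (E (replicate (suc j) d ++ μ) c)

    -- The product of b_d(x^d) over d ≤ m, built in the order in which `partsBounded` strips off the
    -- copies of the largest part.
    gf : ℕ → Ser
    gf zero    = 1S
    gf (suc m) = substPow (suc m) (b (suc m)) (gf m)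

    sum-partsBounded : ∀ m n → sumℚ (map weight (partsBounded n m)) ≡ gf m n
    sum-partsBounded zero    zero    = refl
    sum-partsBounded zero    (suc n) = refl
    sum-partsBounded (suc m) n = begin
      sumℚ (map weight (partsBounded n (suc m)))
        ≡⟨ cong (λ l → sumℚ (map weight l)) (partsBounded-suc n m) ⟩
      sumℚ (map weight (concatMap block (upTo (suc n))))
        ≡⟨ sumℚ-concatMap weight block (upTo (suc n)) ⟩
      sumℚ (map (λ j → sumℚ (map weight (block j))) (upTo (suc n)))
        ≡⟨ cong sumℚ (Listₚ.map-cong term (upTo (suc n))) ⟩
      sumℚ (map (λ j → b (suc m) j * shift (j ℕ.* suc m) (gf m) n) (upTo (suc n)))
        ≡⟨ cong sumℚ (Listₚ.map-upTo (λ j → b (suc m) j * shift (j ℕ.* suc m) (gf m) n) (suc n)) ⟩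
      gf (suc m) n ∎
      where
      open ≡-Reasoning
      block : ℕ → List (List ℕ)
      block j = if j ℕ.* suc m ≤ᵇ n then map (replicate j (suc m) ++_) (partsBounded (n ∸ j ℕ.* suc m) m) else []
      fresh : ∀ {μ} → All (_≤ m) μ → All (suc m ≢_) μ
      fresh = All.map (λ { le refl → ℕₚ.1+n≰n le })
      term : ∀ j → sumℚ (map weight (block j)) ≡ b (suc m) j * shift (j ℕ.* suc m) (gf m) n
      term j with j ℕ.* suc m ≤ᵇ n in eq
      ... | true  = begin
        sumℚ (map weight (map (replicate j (suc m) ++_) parts))
          ≡⟨ cong sumℚ (sym (Listₚ.map-∘ parts)) ⟩
        sumℚ (map (weight ∘ (replicate j (suc m) ++_)) parts)
          ≡⟨ sumℚ-scale (b (suc m) j) weight (All.map (λ ps → weight-replicate j (fresh ps)) (partsBounded-≤ (n ∸ j ℕ.* suc m) m)) ⟩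
        b (suc m) j * sumℚ (map weight parts)
          ≡⟨ cong (b (suc m) j *_) (sum-partsBounded m (n ∸ j ℕ.* suc m)) ⟩
        b (suc m) j * gf m (n ∸ j ℕ.* suc m)
          ≡⟨ cong (b (suc m) j *_) (shift-+ (j ℕ.* suc m) (gf m) (n ∸ j ℕ.* suc m)) ⟨
        b (suc m) j * shift (j ℕ.* suc m) (gf m) (j ℕ.* suc m ℕ.+ (n ∸ j ℕ.* suc m))
          ≡⟨ cong (λ k → b (suc m) j * shift (j ℕ.* suc m) (gf m) k) (ℕₚ.m+[n∸m]≡n (ℕₚ.≤ᵇ⇒≤ (j ℕ.* suc m) n (subst T (sym eq) _))) ⟩
        b (suc m) j * shift (j ℕ.* suc m) (gf m) n ∎
        where parts = partsBounded (n ∸ j ℕ.* suc m) m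
      ... | false = sym (trans (cong (b (suc m) j *_) (shift-< (j ℕ.* suc m) (gf m) n
        (ℕₚ.≰⇒> (λ le → subst T eq (ℕₚ.≤⇒≤ᵇ le))))) (zeroʳ (b (suc m) j)))

    -- The factor for a part d > n is 1 + O(x^d), by `b-zero`, and cannot reach exponent `n`.
    gf-stable : ∀ {m n} → n ≤ m → gf m n ≡ gf n n
    gf-stable {m} {n} n≤m with ℕₚ.m≤n⇒∃[o]m+o≡n n≤m
    ... | o , refl = go o
      where
      open ≡-Reasoning
      go : ∀ o → gf (n ℕ.+ o) n ≡ gf n n
      go zero    = cong (λ k → gf k n) (ℕₚ.+-identityʳ n)
      go (suc o) = begin
        gf (n ℕ.+ suc o) n       ≡⟨ cong (λ k → gf k n) (ℕₚ.+-suc n o) ⟩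
        gf (suc (n ℕ.+ o)) n     ≡⟨ substPow-unfold (n ℕ.+ o) (b (suc (n ℕ.+ o))) (gf (n ℕ.+ o)) n ⟩
        b (suc (n ℕ.+ o)) 0 * gf (n ℕ.+ o) n + shift (suc (n ℕ.+ o)) _ n
          ≡⟨ cong₂ _+_ (trans (cong (_* gf (n ℕ.+ o) n) (b-zero _)) (*-identityˡ (gf (n ℕ.+ o) n))) (shift-< (suc (n ℕ.+ o)) _ n (s≤s (ℕₚ.m≤m+n n o))) ⟩
        gf (n ℕ.+ o) n + 0ℚ      ≡⟨ +-identityʳ _ ⟩
        gf (n ℕ.+ o) n           ≡⟨ go o ⟩
        gf n n                   ∎

  powProd : Sign → (ℕ → ℕ) → ℕ → Ser
  powProd σ S zero    = 1S
  powProd σ S (suc m) = (1+ signℚ σ ·x^ (suc m)) ^^ S (suc m) ⊗ powProd σ S m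

  module SeriesFrom (σ : Sign) (S : ℕ → ℕ) where

    module _ (ε : ℤ) where
      open PartitionSum (λ d → binomSeries σ (ε ℤ.* ℤ.+ S d)) (λ d → binomSeries-zero σ (ε ℤ.* ℤ.+ S d)) public

      seriesFrom-gf : ∀ {n m} → n ≤ m → seriesFrom σ ε S n ≡ gf m n
      seriesFrom-gf {n} n≤m = trans (at n) (sym (gf-stable n≤m))
        where
        at : ∀ n → seriesFrom σ ε S n ≡ gf n n
        at zero    = refl
        at (suc n) = sum-partsBounded (suc n) (suc n)

    gf-pos : ∀ m → gf (signℤ Sign.+) m ≋ powProd σ S m
    gf-pos zero    n = refl
    gf-pos (suc m) n = begin
      substPow (suc m) (binomSeries σ (ℤ.+ 1 ℤ.* ℤ.+ s)) (gf (ℤ.+ 1) m) n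
        ≡⟨ cong (λ i → substPow (suc m) (binomSeries σ i) (gf (ℤ.+ 1) m) n) (ℤₚ.*-identityˡ (ℤ.+ s)) ⟩
      substPow (suc m) (binomSeries σ (ℤ.+ s)) (gf (ℤ.+ 1) m) n
        ≡⟨ substPow-binom⁺ σ m s (gf (ℤ.+ 1) m) n ⟩
      ((1+ signℚ σ ·x^ (suc m)) ^^ s ⊗ gf (ℤ.+ 1) m) n
        ≡⟨ ⊗-congˡ ((1+ signℚ σ ·x^ (suc m)) ^^ s) (gf-pos m) n ⟩
      powProd σ S (suc m) n ∎
      where
      open ≡-Reasoning
      s = S (suc m)

    -- For ε = -1 the partition series is characterised as an inverse; the final cancellation uses
    -- it in this form.
    gf-neg : ∀ m → powProd σ S m ⊗ gf (signℤ Sign.-) m ≋ 1S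
    gf-neg zero    n = ⊗-identityˡ 1S n
    gf-neg (suc m) n = begin
      ((f ⊗ P) ⊗ substPow (suc m) (binomSeries σ (ℤ.-1ℤ ℤ.* ℤ.+ s)) G) n
        ≡⟨ cong (λ i → ((f ⊗ P) ⊗ substPow (suc m) (binomSeries σ i) G) n) (ℤₚ.-1*i≡-i (ℤ.+ s)) ⟩
      ((f ⊗ P) ⊗ D) n  ≡⟨ ⊗-congʳ D (⊗-comm f P) n ⟩
      ((P ⊗ f) ⊗ D) n  ≡⟨ ⊗-assoc P f D n ⟩
      (P ⊗ (f ⊗ D)) n  ≡⟨ ⊗-congˡ P (substPow-binom⁻ σ m s G) n ⟩
      (P ⊗ G) n        ≡⟨ gf-neg m n ⟩
      1S n             ∎
      where
      open ≡-Reasoning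
      s = S (suc m)
      f = (1+ signℚ σ ·x^ (suc m)) ^^ s
      P = powProd σ S m
      G = gf ℤ.-1ℤ m
      D = substPow (suc m) (binomSeries σ (ℤ.- (ℤ.+ s))) G

  convℚ-⊗ : ∀ a b → convℚ a b ≋ a ⊗ b
  convℚ-⊗ a b n = trans (cong sumℚ (Listₚ.map-upTo (λ i → a i * b (n ∸ i)) (suc n))) (go a n)
    where
    go : ∀ a n → Σ< (suc n) (λ i → a i * b (n ∸ i)) ≡ (a ⊗ b) n
    go a zero    = +-identityʳ _
    go a (suc n) = cong (a 0 * b (suc n) +_) (go (tail a) n)

  Truncated : ℕ → CommutativeRing 0ℓ 0ℓ
  Truncated N = ringOn (_≤ N) ℕₚ.≤-trans

  1-x^_ : ℕ → Ser
  1-x^ d = 1+ ℚ.- 1ℚ ·x^ d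

  1-x : Ser
  1-x = 1-x^ 1

  module _ (S⁻ S⁺ : ℕ → ℕ) where

    -- Coefficient `N` sees only exponents up to `N`, so both partition series may be replaced by
    -- finite products. For ε = +1 these are `U` and `V`, and (1 - x) U V = 1 is multiplied by 1/(1
    -- - x); for ε = -1 they are the inverses of `U` and `V` and cancel in (1 - x) U V.
    conv-geomPow : ∀ N → (∀ n → n ≤ N → (1-x ⊗ (powProd Sign.+ S⁻ N ⊗ powProd Sign.- S⁺ N)) n ≡ 1S n) →
                   ∀ ε → convℚ (seriesFrom Sign.+ (signℤ ε) S⁻) (seriesFrom Sign.- (signℤ ε) S⁺) N ≡ geomPow ε N
    conv-geomPow N hyp ε = trans (convℚ-⊗ (seriesFrom Sign.+ (signℤ ε) S⁻) (seriesFrom Sign.- (signℤ ε) S⁺) N)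
      (trans (⊗-cong-≤ N (λ k → M.seriesFrom-gf (signℤ ε)) (λ k → P.seriesFrom-gf (signℤ ε))) (go ε N ℕₚ.≤-refl))
      where
      module M = SeriesFrom Sign.+ S⁻
      module P = SeriesFrom Sign.- S⁺
      module T = CommutativeRing (Truncated N)
      U = powProd Sign.+ S⁻ N
      V = powProd Sign.- S⁺ N
      open RingLemmas (Truncated N) using (*-swap; *-pair)
      tail-1-x : tail 1-x ≋ const (ℚ.- 1ℚ)
      tail-1-x zero    = refl
      tail-1-x (suc n) = refl
      geo : 1-x ⊗ geomPow Sign.+ ≋ 1S
      geo zero          = refl
      geo (suc n)       = cong (1ℚ * 1ℚ +_) (trans (⊗-congʳ (geomPow Sign.+) tail-1-x n) (const-⊗ (ℚ.- 1ℚ) (geomPow Sign.+) n))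
      open import Relation.Binary.Reasoning.Setoid T.setoid
      go : ∀ ε → M.gf (signℤ ε) N ⊗ P.gf (signℤ ε) N T.≈ geomPow ε
      go Sign.+ = begin
        M.gf (signℤ Sign.+) N ⊗ P.gf (signℤ Sign.+) N  ≈⟨ T.*-cong (λ n _ → M.gf-pos N n) (λ n _ → P.gf-pos N n) ⟩
        U ⊗ V                                          ≈⟨ T.*-identityˡ (U ⊗ V) ⟨
        1S ⊗ (U ⊗ V)                                   ≈⟨ T.*-congʳ (λ n _ → geo n) ⟨
        (1-x ⊗ geomPow Sign.+) ⊗ (U ⊗ V)               ≈⟨ *-swap (geomPow Sign.+) 1-x (U ⊗ V) ⟨
        geomPow Sign.+ ⊗ (1-x ⊗ (U ⊗ V))               ≈⟨ T.*-congˡ hyp ⟩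
        geomPow Sign.+ ⊗ 1S                            ≈⟨ T.*-identityʳ (geomPow Sign.+) ⟩
        geomPow Sign.+                                 ∎
      go Sign.- = begin
        A⁻ ⊗ B⁻                           ≈⟨ T.*-identityˡ (A⁻ ⊗ B⁻) ⟨
        1S ⊗ (A⁻ ⊗ B⁻)                    ≈⟨ T.*-congʳ hyp ⟨
        (1-x ⊗ (U ⊗ V)) ⊗ (A⁻ ⊗ B⁻)       ≈⟨ *-pair 1-x U V A⁻ B⁻ ⟩
        1-x ⊗ ((U ⊗ A⁻) ⊗ (V ⊗ B⁻))       ≈⟨ T.*-congˡ (T.*-cong (λ n _ → M.gf-neg N n) (λ n _ → P.gf-neg N n)) ⟩
        1-x ⊗ (1S ⊗ 1S)                 ≈⟨ T.*-congˡ (T.*-identityˡ 1S) ⟩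
        1-x ⊗ 1S                        ≈⟨ T.*-identityʳ 1-x ⟩
        1-x                             ≈⟨ (λ { zero _ → refl ; (suc zero) _ → refl ; (suc (suc n)) _ → refl }) ⟩
        geomPow Sign.-                  ∎
        where
        A⁻ = M.gf (signℤ Sign.-) N
        B⁻ = P.gf (signℤ Sign.-) N

-- A sieve over graded finite sets, yielding Euler products.

module Sieve (X : ℕ → Set) (enum : ∀ n → List (X n)) (enum-unique : ∀ n → Unique (enum n)) (∈-enum : ∀ {n} (x : X n) → x ∈ enum n) where

  open PartitionSeries
  open Series ℚring hiding (X)
  open import Algebra.Properties.Monoid.Mult (CommutativeRing.+-monoid ℚring) using (×-homo-+) renaming (_×_ to _⋆_)
  import Algebra.Properties.Ring (CommutativeRing.ring ℚring) as ℚRing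

  length-⊆ : ∀ {A : Set} {xs ys : List A} → Unique xs → xs ⊆ ys → length xs ≤ length ys
  length-⊆ []         _  = z≤n
  length-⊆ {xs = x ∷ xs} (x∉ ∷ u) xs⊆ys with ∈-∃++ (xs⊆ys (here refl))
  ... | as , bs , refl = subst (suc (length xs) ≤_) length-removed (s≤s (length-⊆ u removed))
    where
    length-removed : suc (length (as ++ bs)) ≡ length (as ++ x ∷ bs)
    length-removed = trans (cong suc (Listₚ.length-++ as)) (trans (sym (ℕₚ.+-suc (length as) (length bs))) (sym (Listₚ.length-++ as)))
    removed : xs ⊆ as ++ bs
    removed {y} y∈xs with ∈-++⁻ as (xs⊆ys (there y∈xs))
    ... | inj₁ y∈as           = ∈-++⁺ˡ y∈as
    ... | inj₂ (here refl)    = ⊥-elim (All.lookup x∉ y∈xs refl)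
    ... | inj₂ (there y∈bs)   = ∈-++⁺ʳ as y∈bs

  length-filter-split : ∀ {p d q} {A : Set} {P : A → Set p} {D : A → Set d} {Q : A → Set q} (P? : Decidable P) (D? : Decidable D) (Q? : Decidable Q) →
    (∀ {a} → P a → ¬ D a → Q a) → (∀ {a} → Q a → P a × ¬ D a) → ∀ xs →
    length (filter P? xs) ≡ length (filter Q? xs) ℕ.+ length (filter (λ a → P? a ×-dec D? a) xs)
  length-filter-split P? D? Q? to from []       = refl
  length-filter-split P? D? Q? to from (x ∷ xs) with ih ← length-filter-split P? D? Q? to from xs | P? x | D? x | Q? x
  ... | yes p | yes d | yes q = ⊥-elim (proj₂ (from q) d)
  ... | yes p | yes d | no ¬q = trans (cong suc ih) (sym (ℕₚ.+-suc _ _))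
  ... | yes p | no ¬d | yes q = cong suc ih
  ... | yes p | no ¬d | no ¬q = ⊥-elim (¬q (to p ¬d))
  ... | no ¬p | yes d | yes q = ⊥-elim (¬p (proj₁ (from q)))
  ... | no ¬p | yes d | no ¬q = ih
  ... | no ¬p | no ¬d | yes q = ⊥-elim (¬p (proj₁ (from q)))
  ... | no ¬p | no ¬d | no ¬q = ih

  -- All that the sieve knows of a prime: multiplication by it is an injection onto its multiples
  -- and raises the grade by `degree`. The grade need not be a polynomial degree, so palindromes fit
  -- as well.
  record Generator : Set₁ where
    field
      degree          : ℕ
      Divides         : ∀ {n} → X n → Set
      divides?        : ∀ {n} (f : X n) → Dec (Divides f)
      times           : ∀ {n} → X n → X (degree ℕ.+ n)
      times-injective : ∀ {n} {f g : X n} → times f ≡ times g → f ≡ g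
      divides-times   : ∀ {n} (f : X n) → Divides (times f)
      divides-degree  : ∀ {n} (f : X n) → Divides f → degree ≤ n
      quotient        : ∀ {n} (f : X (degree ℕ.+ n)) → Divides f → Σ (X n) λ g → f ≡ times g

  open Generator

  -- The first half is Euclid's lemma, in the form in which the sieve consumes it.
  Independent : Generator → Generator → Set
  Independent i j = ∀ n (f : X n) → (Divides j (times i f) → Divides j f) × (Divides j f → Divides j (times i f))

  Free : List Generator → ∀ {n} → X n → Set₁
  Free L f = All (λ i → ¬ Divides i f) L

  free? : ∀ L {n} → Decidable (Free L {n})
  free? L f = All.all? (λ i → ¬? (divides? i f)) L

  #free : List Generator → ℕ → ℕ
  #free L n = length (filter (free? L) (enum n))

  freeSeries : List Generator → Ser
  freeSeries L n = #free L n ⋆ 1ℚ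

  eulerProduct : List Generator → Ser
  eulerProduct []      = 1S
  eulerProduct (i ∷ L) = (1-x^ degree i) ⊗ eulerProduct L

  module _ (i : Generator) (L : List Generator) (ind : All (Independent i) L) where

    private
      multiples : ∀ n → List (X n)
      multiples n = filter (λ f → free? L f ×-dec divides? i f) (enum n)

      free-times : ∀ {n} (f : X n) → Free L f → Free L (times i f)
      free-times f fr = All.zipWith (λ (ind-j , ¬d) d → ¬d (proj₁ (ind-j _ f) d)) (ind , fr)

      times-free : ∀ {n} (f : X n) → Free L (times i f) → Free L f
      times-free f fr = All.zipWith (λ (ind-j , ¬d) d → ¬d (proj₂ (ind-j _ f) d)) (ind , fr)

      multiples-⊆ : ∀ m → multiples (degree i ℕ.+ m) ⊆ map (times i) (filter (free? L) (enum m))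
      multiples-⊆ m f∈ with ∈-filter⁻ (λ f → free? L f ×-dec divides? i f) {xs = enum (degree i ℕ.+ m)} f∈
      ... | _ , fr , d with quotient i _ d
      ... | g , refl = ∈-map⁺ (times i) (∈-filter⁺ (free? L) (∈-enum g) (times-free g fr))

      ⊆-multiples : ∀ m → map (times i) (filter (free? L) (enum m)) ⊆ multiples (degree i ℕ.+ m)
      ⊆-multiples m f∈ with ∈-map⁻ (times i) f∈
      ... | g , g∈ , refl = ∈-filter⁺ (λ f → free? L f ×-dec divides? i f) (∈-enum _)
        (free-times g (proj₂ (∈-filter⁻ (free? L) {xs = enum m} g∈)) , divides-times i g)

      -- Independence makes multiplication by `i` a bijection from the `L`-free elements of grade
      -- `m` to the `L`-free multiples of `i`; the two inequalities come from the two inclusions of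
      -- duplicate-free lists.
      #multiples : ∀ m → length (multiples (degree i ℕ.+ m)) ≡ #free L m
      #multiples m = trans (ℕₚ.≤-antisym
          (length-⊆ (Uniqueₚ.filter⁺ _ (enum-unique (degree i ℕ.+ m))) (multiples-⊆ m))
          (length-⊆ (Uniqueₚ.map⁺ (times-injective i) (Uniqueₚ.filter⁺ _ (enum-unique m))) (⊆-multiples m)))
        (Listₚ.length-map (times i) (filter (free? L) (enum m)))

      multiples-small : ∀ {n} → n < degree i → multiples n ≡ []
      multiples-small {n} n<d = Listₚ.filter-none (λ f → free? L f ×-dec divides? i f)
        (All.universal (λ f (_ , d) → ℕₚ.<⇒≱ n<d (divides-degree i f d)) (enum n))

      multiplesSeries : ∀ n → length (multiples n) ⋆ 1ℚ ≡ shift (degree i) (freeSeries L) n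
      multiplesSeries n with ℕₚ.≤-<-connex (degree i) n
      ... | inj₂ n<d = trans (cong (λ l → length l ⋆ 1ℚ) (multiples-small n<d)) (sym (shift-< (degree i) _ n n<d))
      ... | inj₁ d≤n with ℕₚ.m≤n⇒∃[o]m+o≡n d≤n
      ... | m , refl = trans (cong (_⋆ 1ℚ) (#multiples m)) (sym (shift-+ (degree i) (freeSeries L) m))

    freeSeries-split : ∀ n → freeSeries L n ≡ freeSeries (i ∷ L) n ℚ.+ shift (degree i) (freeSeries L) n
    freeSeries-split n = begin
      #free L n ⋆ 1ℚ
        ≡⟨ cong (_⋆ 1ℚ) (length-filter-split (free? L) (divides? i) (free? (i ∷ L))
             (λ fr ¬d → ¬d ∷ fr) (λ { (¬d ∷ fr) → fr , ¬d }) (enum n)) ⟩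
      (#free (i ∷ L) n ℕ.+ length (multiples n)) ⋆ 1ℚ
        ≡⟨ ×-homo-+ 1ℚ (#free (i ∷ L) n) (length (multiples n)) ⟩
      freeSeries (i ∷ L) n ℚ.+ length (multiples n) ⋆ 1ℚ
        ≡⟨ cong (freeSeries (i ∷ L) n ℚ.+_) (multiplesSeries n) ⟩
      freeSeries (i ∷ L) n ℚ.+ shift (degree i) (freeSeries L) n ∎
      where open ≡-Reasoning

    -- The `L`-free elements not divisible by `i` are all of them minus the multiples, and the
    -- multiples are counted by the shifted series.
    freeSeries-∷ : freeSeries (i ∷ L) ≋ (1-x^ degree i) ⊗ freeSeries L
    freeSeries-∷ n = begin
      a                                    ≡⟨ ℚₚ.+-identityʳ a ⟨
      a ℚ.+ 0ℚ                             ≡⟨ cong (a ℚ.+_) (ℚₚ.+-inverseʳ s) ⟨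
      a ℚ.+ (s ℚ.- s)                      ≡⟨ ℚₚ.+-assoc a s (ℚ.- s) ⟨
      (a ℚ.+ s) ℚ.- s                      ≡⟨ cong₂ ℚ._+_ (freeSeries-split n) (ℚRing.-1*x≈-x s) ⟨
      freeSeries L n ℚ.+ (ℚ.- 1ℚ) ℚ.* s    ≡⟨ cong₂ ℚ._+_ (⊗-identityˡ (freeSeries L) n)
        (trans (scale-⊗ (ℚ.- 1ℚ) (x^ (degree i)) (freeSeries L) n) (cong ((ℚ.- 1ℚ) ℚ.*_) (x^-⊗ (degree i) (freeSeries L) n))) ⟨
      (1S ⊗ freeSeries L) n ℚ.+ (scale (ℚ.- 1ℚ) (x^ (degree i)) ⊗ freeSeries L) n
                                           ≡⟨ ⊗-distribʳ (freeSeries L) 1S (scale (ℚ.- 1ℚ) (x^ (degree i))) n ⟨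
      ((1-x^ degree i) ⊗ freeSeries L) n   ∎
      where
      open ≡-Reasoning
      a s : ℚ
      a = freeSeries (i ∷ L) n
      s = shift (degree i) (freeSeries L) n

  freeSeries-eulerProduct : ∀ {L} → AllPairs Independent L → freeSeries L ≋ eulerProduct L ⊗ freeSeries []
  freeSeries-eulerProduct {[]}    []         n = sym (⊗-identityˡ (freeSeries []) n)
  freeSeries-eulerProduct {i ∷ L} (ind ∷ ps) n = trans (freeSeries-∷ i L ind n)
    (trans (⊗-congˡ (1-x^ degree i) (freeSeries-eulerProduct ps) n) (sym (⊗-assoc (1-x^ degree i) (eulerProduct L) (freeSeries []) n)))

  -- In grade 0 nothing is divisible by a generator of positive degree, so the single element
  -- survives; in grades 1 to `N` the covering hypothesis removes everything. Hence the sieved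
  -- series is 1 up to `N`.
  euler-identity : ∀ {L} N → length (enum 0) ≡ 1 → AllPairs Independent L → All (λ i → 0 < degree i) L →
    (∀ {n} → 0 < n → n ≤ N → (f : X n) → Any (λ i → Divides i f) L) →
    ∀ n → n ≤ N → (eulerProduct L ⊗ freeSeries []) n ≡ 1S n
  euler-identity {L} N single ps pos cover n n≤N = trans (sym (freeSeries-eulerProduct ps n)) (at n n≤N)
    where
    at : ∀ n → n ≤ N → freeSeries L n ≡ 1S n
    at zero    _   = cong (_⋆ 1ℚ) (trans (cong length (Listₚ.filter-all (free? L)
      (All.universal (λ f → All.map (λ {i} 0<d d → ℕₚ.<⇒≱ 0<d (divides-degree i f d)) pos) (enum 0)))) single)
    at (suc n) n<N = cong (λ l → length l ⋆ 1ℚ) (Listₚ.filter-none (free? L)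
      (All.universal (λ f fr → Allₚ.All¬⇒¬Any fr (cover (s≤s z≤n) n<N f)) (enum (suc n))))

-- Coefficient field, degree bounds and the polynomial ring.

module PolynomialRing (F : Field) (q : ℕ) (card : HasCard F q) where

  open Field F using (Carrier; cring; ≈⇒≡; _⁻¹; ⁻¹-inv; 0≢1)
  open Inverse card using (to; from; strictlyInverseˡ; strictlyInverseʳ)

  from-injective : ∀ {x y} → from x ≡ from y → x ≡ y
  from-injective {x} {y} eq = trans (sym (strictlyInverseˡ x)) (trans (cong to eq) (strictlyInverseˡ y))

  _≟_ : DecidableEquality Carrier
  x ≟ y = map′ from-injective (cong from) (from x Fin.≟ from y)

  -- The ring of `F` with propositional equality in place of its own relation. Through `≈⇒≡` nothing
  -- is lost, and the notions of irreducibility and reciprocity to be matched are stated with `_≡_`.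
  K : CommutativeRing 0ℓ 0ℓ
  K = record
    { Carrier = Carrier ; _≈_ = _≡_ ; _+_ = C._+_ ; _*_ = C._*_ ; -_ = C.-_ ; 0# = C.0# ; 1# = C.1#
    ; isCommutativeRing = record
      { isRing = record
        { +-isAbelianGroup = record
          { isGroup = record
            { isMonoid = record
              { isSemigroup = record
                { isMagma = record { isEquivalence = isEquivalence ; ∙-cong = cong₂ C._+_ }
                ; assoc = λ a b c → ≈⇒≡ (C.+-assoc a b c) }
              ; identity = (λ a → ≈⇒≡ (C.+-identityˡ a)) , (λ a → ≈⇒≡ (C.+-identityʳ a)) }
            ; inverse = (λ a → ≈⇒≡ (C.-‿inverseˡ a)) , (λ a → ≈⇒≡ (C.-‿inverseʳ a))
            ; ⁻¹-cong = cong (λ a → C.- a) }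
          ; comm = λ a b → ≈⇒≡ (C.+-comm a b) }
        ; *-cong = cong₂ C._*_
        ; *-assoc = λ a b c → ≈⇒≡ (C.*-assoc a b c)
        ; *-identity = (λ a → ≈⇒≡ (C.*-identityˡ a)) , (λ a → ≈⇒≡ (C.*-identityʳ a))
        ; distrib = (λ a b c → ≈⇒≡ (C.distribˡ a b c)) , (λ a b c → ≈⇒≡ (C.distribʳ a b c)) }
      ; *-comm = λ a b → ≈⇒≡ (C.*-comm a b) } }
    where module C = CommutativeRing cring

  module K = CommutativeRing K
  open K using (_+_; _*_; -_; 0#; 1#; _-_)
  open import Algebra.Properties.Ring K.ring using (-0#≈0#)
  open Series K

  ≢0-* : ∀ {a b} → a ≢ 0# → b ≢ 0# → a * b ≢ 0#
  ≢0-* {a} {b} a≢0 b≢0 ab≡0 = b≢0 (begin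
    b                  ≡⟨ K.*-identityˡ b ⟨
    1# * b             ≡⟨ cong (_* b) (⁻¹-inv a a≢0) ⟨
    (a * a ⁻¹) * b     ≡⟨ cong (_* b) (K.*-comm a (a ⁻¹)) ⟩
    (a ⁻¹ * a) * b     ≡⟨ K.*-assoc (a ⁻¹) a b ⟩
    a ⁻¹ * (a * b)     ≡⟨ cong (a ⁻¹ *_) ab≡0 ⟩
    a ⁻¹ * 0#          ≡⟨ K.zeroʳ (a ⁻¹) ⟩
    0#                 ∎)
    where open ≡-Reasoning

  ⁻¹≢0 : ∀ {a} → a ≢ 0# → a ⁻¹ ≢ 0#
  ⁻¹≢0 {a} a≢0 eq = 0≢1 (trans (sym (K.zeroʳ a)) (trans (cong (a *_) (sym eq)) (⁻¹-inv a a≢0)))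

  1≢0 : 1# ≢ 0#
  1≢0 eq = 0≢1 (sym eq)

  -- Degree strictly below `n`, which includes the zero polynomial; `Bound (suc n)` is the usual
  -- degree at most n.
  Bound : ℕ → Ser → Set
  Bound n f = ∀ k → n ≤ k → f k ≡ 0#

  bound-weaken : ∀ {m n f} → m ≤ n → Bound m f → Bound n f
  bound-weaken m≤n b k n≤k = b k (ℕₚ.≤-trans m≤n n≤k)

  bound-≋ : ∀ {n f g} → f ≋ g → Bound n f → Bound n g
  bound-≋ eq b k n≤k = trans (sym (eq k)) (b k n≤k)

  bound-⊕ : ∀ {n f g} → Bound n f → Bound n g → Bound n (f ⊕ g)
  bound-⊕ p q k n≤k = trans (cong₂ _+_ (p k n≤k) (q k n≤k)) (K.+-identityˡ 0#)

  bound-⊖ : ∀ {n f} → Bound n f → Bound n (⊖ f)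
  bound-⊖ p k n≤k = trans (cong -_ (p k n≤k)) -0#≈0#

  bound-scale : ∀ {n} c {f} → Bound n f → Bound n (scale c f)
  bound-scale c p k n≤k = trans (cong (c *_) (p k n≤k)) (K.zeroʳ c)

  bound-⊗ : ∀ {m n f g} → Bound m f → Bound n g → Bound (m ℕ.+ n) (f ⊗ g)
  bound-⊗ {zero} {g = g} p q k _ = trans (⊗-congʳ g (λ j → p j z≤n) k) (⊗-zeroˡ g k)
  bound-⊗ {suc m} {n} {f} {g} p q (suc k) (s≤s le) = trans
    (cong₂ _+_ (trans (cong (f 0 *_) (q (suc k) (ℕₚ.m≤n⇒m≤1+n (ℕₚ.m+n≤o⇒n≤o m le)))) (K.zeroʳ (f 0)))
               (bound-⊗ {m} {n} (λ j m≤j → p (suc j) (s≤s m≤j)) q k le))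
    (K.+-identityˡ 0#)

  bound-const : ∀ c → Bound 1 (const c)
  bound-const c (suc k) _ = refl

  bound-X : ∀ {n f} → Bound n f → Bound (suc n) (X f)
  bound-X p (suc k) (s≤s le) = p k le

  bound-shift : ∀ d {n f} → Bound n f → Bound (d ℕ.+ n) (shift d f)
  bound-shift zero    p = p
  bound-shift (suc d) p = bound-X (bound-shift d p)

  bound-tail : ∀ {n f} → Bound (suc n) f → Bound n (tail f)
  bound-tail p k n≤k = p (suc k) (s≤s n≤k)

  bound₁-⊗ : ∀ {f} g → Bound 1 f → f ⊗ g ≋ scale (f 0) g
  bound₁-⊗ {f} g p k = trans (⊗-congʳ g (λ { zero → refl ; (suc j) → p (suc j) (s≤s z≤n) }) k) (const-⊗ (f 0) g k)

  lead-⊗ : ∀ {m n f g} → Bound (suc m) f → Bound (suc n) g → (f ⊗ g) (m ℕ.+ n) ≡ f m * g n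
  lead-⊗ {zero}  {n} {f} {g} p q = bound₁-⊗ g p n
  lead-⊗ {suc m} {n} {f} {g} p q = trans
    (cong₂ _+_ (trans (cong (f 0 *_) (q (suc (m ℕ.+ n)) (s≤s (ℕₚ.m≤n+m n m)))) (K.zeroʳ (f 0)))
               (lead-⊗ {m} {n} {tail f} {g} (bound-tail p) q))
    (K.+-identityˡ _)

  bound-suc-⊗ : ∀ {m n f g} → Bound (suc m) f → Bound (suc n) g → Bound (suc (m ℕ.+ n)) (f ⊗ g)
  bound-suc-⊗ {zero}  {n} {f} {g} p q = bound-≋ (λ k → sym (bound₁-⊗ g p k)) (bound-scale (f 0) q)
  bound-suc-⊗ {suc m} {n} {f} {g} p q (suc k) (s≤s le) = trans
    (cong₂ _+_ (trans (cong (f 0 *_) (q (suc k) (s≤s (ℕₚ.≤-trans (ℕₚ.m≤n+m n (suc m)) le)))) (K.zeroʳ (f 0)))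
               (bound-suc-⊗ {m} {n} (bound-tail p) q k le))
    (K.+-identityˡ 0#)

  record Pol : Set where
    no-eta-equality
    constructor pol
    field
      co    : Ser
      {bnd} : ℕ
      bound : Bound bnd co
  open Pol public

  infix 4 _≈_
  record _≈_ (f g : Pol) : Set where
    constructor mk≈
    field at : co f ≋ co g
  open _≈_ public

  infixl 6 _⊞_ _⊟_
  infixl 7 _⊠_
  _⊞_ _⊠_ : Pol → Pol → Pol
  (f ⊞ g) .co    = co f ⊕ co g
  (f ⊞ g) .bnd   = bnd f ℕ.⊔ bnd g
  (f ⊞ g) .bound = bound-⊕ (bound-weaken (ℕₚ.m≤m⊔n (bnd f) (bnd g)) (bound f)) (bound-weaken (ℕₚ.m≤n⊔m (bnd f) (bnd g)) (bound g))
  (f ⊠ g) .co    = co f ⊗ co g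
  (f ⊠ g) .bnd   = bnd f ℕ.+ bnd g
  (f ⊠ g) .bound = bound-⊗ (bound f) (bound g)

  neg : Pol → Pol
  neg f .co    = ⊖ co f
  neg f .bnd   = bnd f
  neg f .bound = bound-⊖ (bound f)

  ⟨_⟩ : Carrier → Pol
  ⟨ c ⟩ .co    = const c
  ⟨ c ⟩ .bnd   = 1
  ⟨ c ⟩ .bound = bound-const c

  𝟘 : Pol
  𝟘 .co _      = 0#
  𝟘 .bnd       = 0
  𝟘 .bound _ _ = refl

  polRing : CommutativeRing 0ℓ 0ℓ
  polRing = record
    { Carrier = Pol ; _≈_ = _≈_ ; _+_ = _⊞_ ; _*_ = _⊠_ ; -_ = neg ; 0# = 𝟘 ; 1# = ⟨ 1# ⟩
    ; isCommutativeRing = record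
      { isRing = record
        { +-isAbelianGroup = record
          { isGroup = record
            { isMonoid = record
              { isSemigroup = record
                { isMagma = record
                  { isEquivalence = record
                    { refl = mk≈ λ n → refl ; sym = λ p → mk≈ λ n → sym (at p n) ; trans = λ p q → mk≈ λ n → trans (at p n) (at q n) }
                  ; ∙-cong = λ p q → mk≈ λ n → cong₂ _+_ (at p n) (at q n) }
                ; assoc = λ f g h → mk≈ λ n → K.+-assoc _ _ _ }
              ; identity = (λ f → mk≈ λ n → K.+-identityˡ _) , (λ f → mk≈ λ n → K.+-identityʳ _) }
            ; inverse = (λ f → mk≈ λ n → K.-‿inverseˡ _) , (λ f → mk≈ λ n → K.-‿inverseʳ _)
            ; ⁻¹-cong = λ p → mk≈ λ n → cong -_ (at p n) }
          ; comm = λ f g → mk≈ λ n → K.+-comm _ _ }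
        ; *-cong = λ p q → mk≈ (⊗-cong (at p) (at q))
        ; *-assoc = λ f g h → mk≈ (⊗-assoc (co f) (co g) (co h))
        ; *-identity = (λ f → mk≈ (⊗-identityˡ (co f))) , (λ f → mk≈ (⊗-identityʳ (co f)))
        ; distrib = (λ h f g → mk≈ (⊗-distribˡ (co h) (co f) (co g))) , (λ h f g → mk≈ (⊗-distribʳ (co h) (co f) (co g))) }
      ; *-comm = λ f g → mk≈ (⊗-comm (co f) (co g)) } }

  module P = CommutativeRing polRing
  module PL = RingLemmas polRing
  module P-Reasoning = SetoidReasoning P.setoid

  _⊟_ : Pol → Pol → Pol
  f ⊟ g = f ⊞ neg g

  ⊞-congˡ : ∀ {f g g′} → g ≈ g′ → f ⊞ g ≈ f ⊞ g′
  ⊞-congˡ eq = P.+-cong P.refl eq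

  ⊞-congʳ : ∀ {f f′ g} → f ≈ f′ → f ⊞ g ≈ f′ ⊞ g
  ⊞-congʳ eq = P.+-cong eq P.refl

  ⊠-congˡ : ∀ {f g g′} → g ≈ g′ → f ⊠ g ≈ f ⊠ g′
  ⊠-congˡ eq = P.*-cong P.refl eq

  ⊠-congʳ : ∀ {f f′ g} → f ≈ f′ → f ⊠ g ≈ f′ ⊠ g
  ⊠-congʳ eq = P.*-cong eq P.refl

  ⟨⟩-⊠ : ∀ c f → co (⟨ c ⟩ ⊠ f) ≋ scale c (co f)
  ⟨⟩-⊠ c f = const-⊗ c (co f)

  var : Pol
  var .co    = x^ 1
  var .bnd   = 2
  var .bound = bound-X (bound-const 1#)

  var-⊠ : ∀ f → co (var ⊠ f) ≋ X (co f)
  var-⊠ f = x^-⊗ 1 (co f)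

  tailP : Pol → Pol
  tailP f .co        = tail (co f)
  tailP f .bnd       = bnd f
  tailP f .bound k p = bound f (suc k) (ℕₚ.m≤n⇒m≤1+n p)

  head-tail : ∀ f → f ≈ ⟨ co f 0 ⟩ ⊞ var ⊠ tailP f
  head-tail f .at zero    = sym (trans (cong (co f 0 +_) (var-⊠ (tailP f) 0)) (K.+-identityʳ _))
  head-tail f .at (suc n) = sym (trans (cong (0# +_) (var-⊠ (tailP f) (suc n))) (K.+-identityˡ _))

  record HasDegree (d : ℕ) (f : Pol) : Set where
    constructor mkDegree
    field
      lead≢0  : co f d ≢ 0#
      bounded : Bound (suc d) (co f)
  open HasDegree public

  degree-≈ : ∀ {d f g} → f ≈ g → HasDegree d f → HasDegree d g
  degree-≈ eq (mkDegree nz b) = mkDegree (λ z → nz (trans (at eq _) z)) (bound-≋ (at eq) b)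

  degree-unique : ∀ {d e f} → HasDegree d f → HasDegree e f → d ≡ e
  degree-unique {d} {e} (mkDegree nz b) (mkDegree nz′ b′) with ℕₚ.<-cmp d e
  ... | tri< d<e _ _ = ⊥-elim (nz′ (b e d<e))
  ... | tri≈ _ d≡e _ = d≡e
  ... | tri> _ _ e<d = ⊥-elim (nz (b′ d e<d))

  degree-⊠ : ∀ {d e f g} → HasDegree d f → HasDegree e g → HasDegree (d ℕ.+ e) (f ⊠ g)
  degree-⊠ (mkDegree nz b) (mkDegree nz′ b′) =
    mkDegree (λ z → ≢0-* nz nz′ (trans (sym (lead-⊗ b b′)) z)) (bound-suc-⊗ b b′)

  degree-≉0 : ∀ {d f} → HasDegree d f → ¬ f ≈ 𝟘
  degree-≉0 {d} df eq = lead≢0 df (at eq d)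

  degree-cases : ∀ n f → Bound n (co f) → f ≈ 𝟘 ⊎ Σ ℕ λ d → d < n × HasDegree d f
  degree-cases zero    f b = inj₁ (mk≈ λ k → b k z≤n)
  degree-cases (suc n) f b with co f n ≟ 0#
  ... | no nz = inj₂ (n , ℕₚ.n<1+n n , mkDegree nz b)
  ... | yes z with degree-cases n f lower
    where
    lower : Bound n (co f)
    lower k n≤k with ℕₚ.m≤n⇒m<n∨m≡n n≤k
    ... | inj₁ n<k  = b k n<k
    ... | inj₂ refl = z
  ... | inj₁ f≈0             = inj₁ f≈0
  ... | inj₂ (d , d<n , deg) = inj₂ (d , ℕₚ.m≤n⇒m≤1+n d<n , deg)

  degree? : ∀ f → f ≈ 𝟘 ⊎ Σ ℕ λ d → HasDegree d f
  degree? f with degree-cases (bnd f) f (bound f)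
  ... | inj₁ z             = inj₁ z
  ... | inj₂ (d , _ , deg) = inj₂ (d , deg)

  degree-factor : ∀ {d e f} g → HasDegree d f → HasDegree e (f ⊠ g) → Σ ℕ λ c → e ≡ d ℕ.+ c × HasDegree c g
  degree-factor {f = f} g df dfg with degree? g
  ... | inj₁ z        = ⊥-elim (degree-≉0 dfg (P.trans (⊠-congˡ z) (P.zeroʳ f)))
  ... | inj₂ (c , dg) = c , degree-unique dfg (degree-⊠ df dg) , dg

  -- If a - b were nonzero it would have a degree, and then so would p (a - b), which is zero.
  ⊠-cancelˡ : ∀ {d p a b} → HasDegree d p → p ⊠ a ≈ p ⊠ b → a ≈ b
  ⊠-cancelˡ {p = p} {a} {b} dp eq with degree? (a ⊟ b)
  ... | inj₁ z        = x∙y⁻¹≈ε⇒x≈y a b z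
    where open import Algebra.Properties.Group P.+-group using (x∙y⁻¹≈ε⇒x≈y)
  ... | inj₂ (c , dc) = ⊥-elim (degree-≉0 (degree-⊠ dp dc) (begin
    p ⊠ (a ⊟ b)      ≈⟨ PL.*-distribˡ-- p a b ⟩
    p ⊠ a ⊟ p ⊠ b    ≈⟨ ⊞-congʳ eq ⟩
    p ⊠ b ⊟ p ⊠ b    ≈⟨ P.-‿inverseʳ (p ⊠ b) ⟩
    𝟘                ∎))
    where open P-Reasoning

  -- Horner style: f = f(0) + x · tail f, and the tail is divided first. If its remainder is r, then
  -- f(0) + x r has degree at most n, and one multiple of `g` brings it below n.
  divMod : ∀ {n g} → HasDegree n g → ∀ f → Σ Pol λ q → Σ Pol λ r → (f ≈ g ⊠ q ⊞ r) × Bound n (co r)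
  divMod {n} {g} (mkDegree nz bg) f = go (bnd f) f (bound f)
    where
    go : ∀ b f → Bound b (co f) → Σ Pol λ q → Σ Pol λ r → (f ≈ g ⊠ q ⊞ r) × Bound n (co r)
    go zero    f bf = 𝟘 , 𝟘 , mk≈ (λ k → trans (bf k z≤n) (sym (trans (K.+-identityʳ _) (at (P.zeroʳ g) k)))) , λ _ _ → refl
    go (suc b) f bf with go b (tailP f) (bound-tail bf)
    ... | q , r , eq , br = ⟨ c ⟩ ⊞ var ⊠ q , s ⊟ ⟨ c ⟩ ⊠ g , eq′ , br′
      where
      s : Pol
      s = ⟨ co f 0 ⟩ ⊞ var ⊠ r
      -- The quotient of the coefficients of x^n, chosen so that `top` vanishes.
      c : Carrier
      c = co s n * (co g n) ⁻¹
      eq′ : f ≈ g ⊠ (⟨ c ⟩ ⊞ var ⊠ q) ⊞ (s ⊟ ⟨ c ⟩ ⊠ g)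
      eq′ = begin
        f                                                 ≈⟨ head-tail f ⟩
        ⟨ co f 0 ⟩ ⊞ var ⊠ tailP f                        ≈⟨ ⊞-congˡ (⊠-congˡ eq) ⟩
        ⟨ co f 0 ⟩ ⊞ var ⊠ (g ⊠ q ⊞ r)                    ≈⟨ PL.division-step ⟨ co f 0 ⟩ var g q r ⟨ c ⟩ ⟩
        g ⊠ (⟨ c ⟩ ⊞ var ⊠ q) ⊞ (s ⊟ ⟨ c ⟩ ⊠ g)           ∎
        where open P-Reasoning
      bs : Bound (suc n) (co s)
      bs = bound-⊕ (bound-weaken (s≤s z≤n) (bound-const (co f 0))) (bound-≋ (λ k → sym (var-⊠ r k)) (bound-X br))
      top : co s n - c * co g n ≡ 0#
      top = trans (cong (λ y → co s n - y) (begin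
        (co s n * (co g n) ⁻¹) * co g n   ≡⟨ K.*-assoc (co s n) ((co g n) ⁻¹) (co g n) ⟩
        co s n * ((co g n) ⁻¹ * co g n)   ≡⟨ cong (co s n *_) (trans (K.*-comm _ _) (⁻¹-inv (co g n) nz)) ⟩
        co s n * 1#                       ≡⟨ K.*-identityʳ (co s n) ⟩
        co s n                            ∎)) (K.-‿inverseʳ (co s n))
        where open ≡-Reasoning
      br′ : Bound n (co (s ⊟ ⟨ c ⟩ ⊠ g))
      br′ k n≤k with ℕₚ.m≤n⇒m<n∨m≡n n≤k
      ... | inj₁ n<k  = bound-⊕ bs (bound-⊖ (bound-≋ (λ j → sym (⟨⟩-⊠ c g j)) (bound-scale c bg))) k n<k
      ... | inj₂ refl = trans (cong (λ y → co s n - y) (⟨⟩-⊠ c g n)) top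

  -- Divisibility, irreducibles and Euclid's lemma.

  infix 4 _∣_
  record _∣_ (p f : Pol) : Set where
    constructor _,_
    field
      quot    : Pol
      quot-eq : p ⊠ quot ≈ f
  open _∣_ public

  ∣-≈ : ∀ {p p′ f f′} → p ≈ p′ → f ≈ f′ → p ∣ f → p′ ∣ f′
  ∣-≈ ep ef (h , eq) = h , P.trans (⊠-congʳ (P.sym ep)) (P.trans eq ef)

  ∣-resp : ∀ {p f f′} → f ≈ f′ → p ∣ f → p ∣ f′
  ∣-resp = ∣-≈ P.refl

  ∣-trans : ∀ {p q f} → p ∣ q → q ∣ f → p ∣ f
  ∣-trans {p} (h , eq) (k , eq′) = h ⊠ k , P.trans (P.sym (P.*-assoc p h k)) (P.trans (⊠-congʳ eq) eq′)

  ∣-⊠ʳ : ∀ p h → p ∣ p ⊠ h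
  ∣-⊠ʳ p h = h , P.refl

  ∣-⊠ˡ : ∀ p h → p ∣ h ⊠ p
  ∣-⊠ˡ p h = h , P.*-comm p h

  ∣-⊞ : ∀ {p f g} → p ∣ f → p ∣ g → p ∣ f ⊞ g
  ∣-⊞ {p} (h , eq) (k , eq′) = h ⊞ k , P.trans (P.distribˡ p h k) (P.+-cong eq eq′)

  ∣-⊟ : ∀ {p f g} → p ∣ f → p ∣ g → p ∣ f ⊟ g
  ∣-⊟ {p} (h , eq) (k , eq′) = h ⊟ k , P.trans (PL.*-distribˡ-- p h k) (P.+-cong eq (P.-‿cong eq′))

  exact : ∀ {p q r f} → f ≈ p ⊠ q ⊞ r → r ≈ 𝟘 → p ∣ f
  exact {p} {q} eq z = q , P.sym (P.trans eq (P.trans (⊞-congˡ z) (P.+-identityʳ (p ⊠ q))))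

  -- A nonzero remainder r refutes divisibility: p h = f gives p (h - q) = r, whose degree would be
  -- at least n.
  divides? : ∀ {n p} → HasDegree n p → ∀ f → Dec (p ∣ f)
  divides? {n} {p} dp f with divMod dp f
  ... | q , r , eq , br with degree-cases n r br
  ... | inj₁ z = yes (exact eq z)
  ... | inj₂ (d , d<n , dr) = no λ (h , ph≈f) → absurd h ph≈f
    where
    absurd : ∀ h → p ⊠ h ≈ f → ⊥
    absurd h ph≈f with degree-factor (h ⊟ q) dp (degree-≈ (P.sym (P.trans (PL.*-distribˡ-- p h q)
        (P.trans (⊞-congʳ (P.trans ph≈f eq)) (PL.cancel-+ (p ⊠ q) r)))) dr)
    ... | c , refl , _ = ℕₚ.<⇒≱ d<n (ℕₚ.m≤m+n n c)

  record Monic (n : ℕ) (p : Pol) : Set where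
    constructor mkMonic
    field
      lead≡1 : co p n ≡ 1#
      vanish : Bound (suc n) (co p)
    hasDegree : HasDegree n p
    hasDegree = mkDegree (λ z → 1≢0 (trans (sym lead≡1) z)) vanish
  open Monic public

  -- Irreducibility through the degrees of divisors, the form that the Euclidean descent uses. With
  -- monicity included, associated irreducibles are equal.
  record Irr (n : ℕ) (p : Pol) : Set where
    constructor mkIrr
    field
      monic    : Monic n p
      positive : 0 < n
      divisors : ∀ {d g} → HasDegree d g → g ∣ p → d ≡ 0 ⊎ d ≡ n
  open Irr public

  degree-0 : ∀ {g} → HasDegree 0 g → g ≈ ⟨ co g 0 ⟩
  degree-0 dg .at zero    = refl
  degree-0 dg .at (suc n) = bounded dg (suc n) (s≤s z≤n)

  ⟨⟩-cancel : ∀ c f → c ≢ 0# → ⟨ c ⁻¹ ⟩ ⊠ (⟨ c ⟩ ⊠ f) ≈ f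
  ⟨⟩-cancel c f c≢0 .at n = begin
    co (⟨ c ⁻¹ ⟩ ⊠ (⟨ c ⟩ ⊠ f)) n    ≡⟨ ⟨⟩-⊠ (c ⁻¹) (⟨ c ⟩ ⊠ f) n ⟩
    c ⁻¹ * co (⟨ c ⟩ ⊠ f) n          ≡⟨ cong (c ⁻¹ *_) (⟨⟩-⊠ c f n) ⟩
    c ⁻¹ * (c * co f n)              ≡⟨ K.*-assoc (c ⁻¹) c (co f n) ⟨
    (c ⁻¹ * c) * co f n              ≡⟨ cong (_* co f n) (trans (K.*-comm (c ⁻¹) c) (⁻¹-inv c c≢0)) ⟩
    1# * co f n                      ≡⟨ K.*-identityˡ (co f n) ⟩
    co f n                           ∎
    where open ≡-Reasoning

  ∣-⟨⟩-⊠ : ∀ {p c f} → c ≢ 0# → p ∣ ⟨ c ⟩ ⊠ f → p ∣ f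
  ∣-⟨⟩-⊠ {p} {c} {f} c≢0 p∣cf = ∣-resp (⟨⟩-cancel c f c≢0) (∣-trans p∣cf (∣-⊠ˡ (⟨ c ⟩ ⊠ f) ⟨ c ⁻¹ ⟩))

  -- Division of p by u replaces u by the remainder, which has smaller degree.
  euclid-small : ∀ {n p} → Irr n p → ∀ f d u → HasDegree d u → d < n → p ∣ u ⊠ f → p ∣ f
  euclid-small {n} {p} irr f = <-rec _ step
    where
    step : ∀ d → (∀ {e} → e < d → ∀ u → HasDegree e u → e < n → p ∣ u ⊠ f → p ∣ f) →
           ∀ u → HasDegree d u → d < n → p ∣ u ⊠ f → p ∣ f
    step zero    rec u du d<n p∣uf = ∣-⟨⟩-⊠ (lead≢0 du) (∣-resp (⊠-congʳ (degree-0 du)) p∣uf)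
    step (suc d) rec u du d<n p∣uf with divMod du p
    ... | q , r , eq , br with degree-cases (suc d) r br
    ... | inj₂ (e , e<d , dr) = rec e<d r dr (ℕₚ.<-trans e<d d<n) (∣-resp (P.sym (PL.remainder-* p u q r f eq))
            (∣-⊟ (∣-⊠ʳ p f) (∣-trans p∣uf (∣-⊠ˡ (u ⊠ f) q))))
    ... | inj₁ z with divisors irr du (exact eq z)
    ...   | inj₂ refl = ⊥-elim (ℕₚ.<-irrefl refl d<n)

  -- Modulo `p`, `u` may be replaced by its remainder: either that is zero, or its degree is below n
  -- and `euclid-small` applies.
  euclid : ∀ {n p} → Irr n p → ∀ u f → p ∣ u ⊠ f → p ∣ u ⊎ p ∣ f
  euclid {n} {p} irr u f p∣uf with divMod (hasDegree (monic irr)) u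
  ... | q , r , eq , br with degree-cases n r br
  ... | inj₁ z = inj₁ (exact eq z)
  ... | inj₂ (d , d<n , dr) = inj₂ (euclid-small irr f d r dr d<n (∣-resp (P.sym (PL.remainder-* u p q r f eq))
      (∣-⊟ p∣uf (∣-trans (∣-⊠ʳ p f) (∣-⊠ˡ (p ⊠ f) q)))))

  -- Reversal and the normalised reciprocal.

  reverse : ℕ → Ser → Ser
  reverse n f k = if k ≤ᵇ n then f (n ∸ k) else 0#

  ≤ᵇ-true : ∀ {k n} → k ≤ n → (k ≤ᵇ n) ≡ true
  ≤ᵇ-true {k} {n} k≤n with k ≤ᵇ n | ℕₚ.≤⇒≤ᵇ k≤n
  ... | true | _ = refl

  ≤ᵇ-false : ∀ {k n} → n < k → (k ≤ᵇ n) ≡ false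
  ≤ᵇ-false {k} {n} n<k with k ≤ᵇ n in eq
  ... | true  = ⊥-elim (ℕₚ.<⇒≱ n<k (ℕₚ.≤ᵇ⇒≤ k n (subst T (sym eq) _)))
  ... | false = refl

  reverse-≤ : ∀ {n k} f → k ≤ n → reverse n f k ≡ f (n ∸ k)
  reverse-≤ {n} {k} f k≤n rewrite ≤ᵇ-true k≤n = refl

  reverse-> : ∀ {n} f → Bound (suc n) (reverse n f)
  reverse-> {n} f k n<k rewrite ≤ᵇ-false n<k = refl

  reverse-+ : ∀ m f n → reverse (m ℕ.+ n) f n ≡ f m
  reverse-+ m f n = trans (reverse-≤ {m ℕ.+ n} {n} f (ℕₚ.m≤n+m n m)) (cong f (ℕₚ.m+n∸n≡m m n))

  reverse-cong : ∀ n {f g} → f ≋ g → reverse n f ≋ reverse n g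
  reverse-cong n eq k with k ≤ᵇ n
  ... | true  = eq (n ∸ k)
  ... | false = refl

  reverse-scale : ∀ n c f → reverse n (scale c f) ≋ scale c (reverse n f)
  reverse-scale n c f k with k ≤ᵇ n
  ... | true  = refl
  ... | false = sym (K.zeroʳ c)

  reverse-⊕ : ∀ n f g → reverse n (f ⊕ g) ≋ reverse n f ⊕ reverse n g
  reverse-⊕ n f g k with k ≤ᵇ n
  ... | true  = refl
  ... | false = sym (K.+-identityˡ 0#)

  reverse-involutive : ∀ {n f} → Bound (suc n) f → reverse n (reverse n f) ≋ f
  reverse-involutive {n} {f} b k with ℕₚ.≤-<-connex k n
  ... | inj₁ k≤n = trans (reverse-≤ (reverse n f) k≤n) (trans (reverse-≤ f (ℕₚ.m∸n≤m n k)) (cong f (ℕₚ.m∸[m∸n]≡n k≤n)))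
  ... | inj₂ n<k = trans (reverse-> (reverse n f) k n<k) (sym (b k n<k))

  -- From f = f(0) + x · tail f: reversal sends the constant term to x^(n+1). The multiplicativity
  -- of reversal is an induction on this recursion.
  reverse-suc : ∀ n f → reverse (suc n) f ≋ reverse n (tail f) ⊕ shift (suc n) (const (f 0))
  reverse-suc n f k with ℕₚ.<-cmp k (suc n)
  ... | tri< k<1+n _ _ = begin
    reverse (suc n) f k                                        ≡⟨ reverse-≤ f (ℕₚ.<⇒≤ k<1+n) ⟩
    f (suc n ∸ k)                                              ≡⟨ cong f (ℕₚ.+-∸-assoc 1 k≤n) ⟩
    tail f (n ∸ k)                                             ≡⟨ reverse-≤ (tail f) k≤n ⟨
    reverse n (tail f) k                                       ≡⟨ K.+-identityʳ _ ⟨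
    reverse n (tail f) k + 0#                                  ≡⟨ cong (reverse n (tail f) k +_) (shift-< (suc n) (const (f 0)) k k<1+n) ⟨
    reverse n (tail f) k + shift (suc n) (const (f 0)) k       ∎
    where
    open ≡-Reasoning
    k≤n = ℕₚ.≤-pred k<1+n
  ... | tri≈ _ refl _ = trans (reverse-+ 0 f (suc n)) (sym (trans
      (cong₂ _+_ (reverse-> (tail f) (suc n) ℕₚ.≤-refl)
        (trans (cong (shift (suc n) (const (f 0))) (sym (ℕₚ.+-identityʳ (suc n)))) (shift-+ (suc n) (const (f 0)) 0)))
      (K.+-identityˡ (f 0))))
  ... | tri> _ _ 1+n<k = trans (reverse-> f k 1+n<k) (sym (trans
      (cong₂ _+_ (reverse-> (tail f) k (ℕₚ.<-trans (ℕₚ.n<1+n n) 1+n<k))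
        (bound-shift (suc n) (bound-const (f 0)) k (subst (_≤ k) (sym (ℕₚ.+-comm (suc n) 1)) 1+n<k)))
      (K.+-identityˡ 0#)))

  -- Reversing with respect to a length j larger than the degree bound costs a factor x^j. It is
  -- needed because the two terms of f g = f(0) g + x (tail f) g have different degrees.
  reverse-pad : ∀ j {m f} → Bound (suc m) f → reverse (j ℕ.+ m) f ≋ shift j (reverse m f)
  reverse-pad zero    b k = refl
  reverse-pad (suc j) {m} {f} b k = trans (reverse-suc (j ℕ.+ m) f k) (go k)
    where
    open ≡-Reasoning
    go : ∀ k → reverse (j ℕ.+ m) (tail f) k + shift (suc (j ℕ.+ m)) (const (f 0)) k ≡ X (shift j (reverse m f)) k
    go zero    = trans (K.+-identityʳ _) (trans (reverse-≤ {j ℕ.+ m} (tail f) z≤n) (b (suc (j ℕ.+ m)) (s≤s (ℕₚ.m≤n+m m j))))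
    go (suc k) = trans (sym (reverse-suc (j ℕ.+ m) f (suc k))) (trans (drop k) (reverse-pad j b k))
      where
      drop : ∀ k → reverse (suc j ℕ.+ m) f (suc k) ≡ reverse (j ℕ.+ m) f k
      drop k with ℕₚ.≤-<-connex k (j ℕ.+ m)
      ... | inj₁ k≤ = trans (reverse-≤ f (s≤s k≤)) (sym (reverse-≤ f k≤))
      ... | inj₂ k> = trans (reverse-> f (suc k) (s≤s k>)) (sym (reverse-> f k k>))

  ⊗-head-tail : ∀ f g → f ⊗ g ≋ scale (f 0) g ⊕ X (tail f ⊗ g)
  ⊗-head-tail f g zero    = sym (K.+-identityʳ _)
  ⊗-head-tail f g (suc n) = refl

  reverse-X : ∀ n f → reverse (suc n) (X f) ≋ reverse n f
  reverse-X n f k = trans (reverse-suc n (X f) k) (trans (cong (reverse n f k +_) (zeros (suc n) k)) (K.+-identityʳ _))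
    where
    zeros : ∀ d k → shift d (const 0#) k ≡ 0#
    zeros zero    zero    = refl
    zeros zero    (suc k) = refl
    zeros (suc d) zero    = refl
    zeros (suc d) (suc k) = zeros d k

  reverse-⊗ : ∀ {m n f g} → Bound (suc m) f → Bound (suc n) g → reverse (m ℕ.+ n) (f ⊗ g) ≋ reverse m f ⊗ reverse n g
  reverse-⊗ {zero} {n} {f} {g} p q k = begin
    reverse n (f ⊗ g) k                 ≡⟨ reverse-cong n (bound₁-⊗ g p) k ⟩
    reverse n (scale (f 0) g) k         ≡⟨ reverse-scale n (f 0) g k ⟩
    f 0 * reverse n g k                 ≡⟨ bound₁-⊗ (reverse n g) (reverse-> f) k ⟨
    (reverse 0 f ⊗ reverse n g) k       ∎
    where open ≡-Reasoning
  reverse-⊗ {suc m} {n} {f} {g} p q k = begin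
    reverse (suc m ℕ.+ n) (f ⊗ g) k
      ≡⟨ reverse-cong (suc m ℕ.+ n) (⊗-head-tail f g) k ⟩
    reverse (suc m ℕ.+ n) (scale (f 0) g ⊕ X (tail f ⊗ g)) k
      ≡⟨ reverse-⊕ (suc m ℕ.+ n) (scale (f 0) g) (X (tail f ⊗ g)) k ⟩
    reverse (suc m ℕ.+ n) (scale (f 0) g) k + reverse (suc m ℕ.+ n) (X (tail f ⊗ g)) k
      ≡⟨ cong₂ _+_ (trans (reverse-pad (suc m) (bound-scale (f 0) q) k)
                     (shift-cong (suc m) (λ j → trans (reverse-scale n (f 0) g j) (sym (const-⊗ (f 0) (reverse n g) j))) k))
                   (trans (reverse-X (m ℕ.+ n) (tail f ⊗ g) k) (reverse-⊗ {m} {n} (bound-tail p) q k)) ⟩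
    shift (suc m) (const (f 0) ⊗ reverse n g) k + (reverse m (tail f) ⊗ reverse n g) k
      ≡⟨ K.+-comm _ _ ⟩
    (reverse m (tail f) ⊗ reverse n g) k + shift (suc m) (const (f 0) ⊗ reverse n g) k
      ≡⟨ cong ((reverse m (tail f) ⊗ reverse n g) k +_) (shift-⊗ (suc m) (const (f 0)) (reverse n g) k) ⟨
    (reverse m (tail f) ⊗ reverse n g) k + (shift (suc m) (const (f 0)) ⊗ reverse n g) k
      ≡⟨ ⊗-distribʳ (reverse n g) (reverse m (tail f)) (shift (suc m) (const (f 0))) k ⟨
    ((reverse m (tail f) ⊕ shift (suc m) (const (f 0))) ⊗ reverse n g) k
      ≡⟨ ⊗-congʳ (reverse n g) (λ j → sym (reverse-suc m f j)) k ⟩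
    (reverse (suc m) f ⊗ reverse n g) k ∎
    where open ≡-Reasoning

  rev : ℕ → Pol → Pol
  rev n f .co    = reverse n (co f)
  rev n f .bnd   = suc n
  rev n f .bound = reverse-> (co f)

  rev-⊠ : ∀ {m n f g} → HasDegree m f → HasDegree n g → rev (m ℕ.+ n) (f ⊠ g) ≈ rev m f ⊠ rev n g
  rev-⊠ {m} {n} df dg = mk≈ (reverse-⊗ {m} {n} (bounded df) (bounded dg))

  rev-cong : ∀ n {f g} → f ≈ g → rev n f ≈ rev n g
  rev-cong n eq = mk≈ (reverse-cong n (at eq))

  degree-rev : ∀ {n f} → co f 0 ≢ 0# → HasDegree n (rev n f)
  degree-rev {n} {f} nz = mkDegree (λ z → nz (trans (sym (reverse-+ 0 (co f) n)) z)) (reverse-> (co f))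

  star : ℕ → Pol → Pol
  star n p .co k       = reverse n (co p) k * (co p 0) ⁻¹
  star n p .bnd        = suc n
  star n p .bound k le = trans (cong (_* (co p 0) ⁻¹) (reverse-> (co p) k le)) (K.zeroˡ _)

  star-rev : ∀ n p → star n p ≈ ⟨ (co p 0) ⁻¹ ⟩ ⊠ rev n p
  star-rev n p .at k = trans (K.*-comm _ _) (sym (⟨⟩-⊠ ((co p 0) ⁻¹) (rev n p) k))

  star-cong : ∀ n {p q} → p ≈ q → star n p ≈ star n q
  star-cong n eq .at k = cong₂ (λ a b → a * b ⁻¹) (reverse-cong n (at eq) k) (at eq 0)

  monic-star : ∀ {n p} → co p 0 ≢ 0# → Monic n (star n p)
  monic-star {n} {p} nz = mkMonic (trans (cong (_* (co p 0) ⁻¹) (reverse-+ 0 (co p) n)) (⁻¹-inv (co p 0) nz)) (bound (star n p))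

  star-0 : ∀ {n p} → Monic n p → co (star n p) 0 ≡ (co p 0) ⁻¹
  star-0 {n} {p} mp = trans (cong (_* (co p 0) ⁻¹) (trans (reverse-≤ {n} (co p) z≤n) (lead≡1 mp))) (K.*-identityˡ _)

  star-0≢0 : ∀ {n p} → Monic n p → co p 0 ≢ 0# → co (star n p) 0 ≢ 0#
  star-0≢0 mp nz z = ⁻¹≢0 nz (trans (sym (star-0 mp)) z)

  rev-star : ∀ {n p} → Monic n p → rev n (star n p) ≈ ⟨ (co p 0) ⁻¹ ⟩ ⊠ p
  rev-star {n} {p} mp .at k = begin
    reverse n (co (star n p)) k                       ≡⟨ reverse-cong n (λ j → K.*-comm (reverse n (co p) j) ((co p 0) ⁻¹)) k ⟩
    reverse n (scale ((co p 0) ⁻¹) (reverse n (co p))) k  ≡⟨ reverse-scale n ((co p 0) ⁻¹) (reverse n (co p)) k ⟩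
    (co p 0) ⁻¹ * reverse n (reverse n (co p)) k      ≡⟨ cong ((co p 0) ⁻¹ *_) (reverse-involutive (vanish mp) k) ⟩
    (co p 0) ⁻¹ * co p k                              ≡⟨ ⟨⟩-⊠ ((co p 0) ⁻¹) p k ⟨
    co (⟨ (co p 0) ⁻¹ ⟩ ⊠ p) k                        ∎
    where open ≡-Reasoning

  star-involutive : ∀ {n p} → Monic n p → co p 0 ≢ 0# → star n (star n p) ≈ p
  star-involutive {n} {p} mp nz = begin
    star n (star n p)                                       ≈⟨ star-rev n (star n p) ⟩
    ⟨ (co (star n p) 0) ⁻¹ ⟩ ⊠ rev n (star n p)             ≈⟨ ⊠-congˡ (rev-star mp) ⟩
    ⟨ (co (star n p) 0) ⁻¹ ⟩ ⊠ (⟨ (co p 0) ⁻¹ ⟩ ⊠ p)        ≡⟨ cong (λ c → ⟨ c ⁻¹ ⟩ ⊠ (⟨ (co p 0) ⁻¹ ⟩ ⊠ p)) (star-0 mp) ⟩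
    ⟨ ((co p 0) ⁻¹) ⁻¹ ⟩ ⊠ (⟨ (co p 0) ⁻¹ ⟩ ⊠ p)            ≈⟨ ⟨⟩-cancel ((co p 0) ⁻¹) p (⁻¹≢0 nz) ⟩
    p                                                       ∎
    where open P-Reasoning

  monic-degree : ∀ {m n p} → Monic m p → Monic n p → m ≡ n
  monic-degree mp mp′ = degree-unique (hasDegree mp) (hasDegree mp′)

  rev-∣ : ∀ {d n g f} → HasDegree d g → HasDegree n f → g ∣ f → rev d g ∣ rev n f
  rev-∣ {d} {n} {g} {f} dg df (h , eq) with degree-factor h dg (degree-≈ (P.sym eq) df)
  ... | e , refl , dh = rev e h , P.trans (P.sym (rev-⊠ dg dh)) (rev-cong n eq)

  head-∣ : ∀ {g f} → g ∣ f → co f 0 ≢ 0# → co g 0 ≢ 0#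
  head-∣ {g} {f} (h , eq) nz z = nz (trans (sym (at eq 0)) (trans (cong (_* co h 0) z) (K.zeroˡ _)))

  -- Reversal carries a divisor of `star n p` to a divisor of a constant times `p`. It keeps the
  -- degree, since the divisor inherits a nonzero constant term.
  irr-star : ∀ {n p} → Irr n p → co p 0 ≢ 0# → Irr n (star n p)
  irr-star {n} {p} irr nz = mkIrr (monic-star nz) (positive irr) divs
    where
    divs : ∀ {d g} → HasDegree d g → g ∣ star n p → d ≡ 0 ⊎ d ≡ n
    divs {d} {g} dg g∣ = divisors irr (degree-rev (head-∣ g∣ (star-0≢0 (monic irr) nz)))
      (∣-⟨⟩-⊠ (⁻¹≢0 nz) (∣-resp (rev-star (monic irr)) (rev-∣ dg (hasDegree (monic-star nz)) g∣)))

  irr-∣-irr : ∀ {m n p q} → Irr m p → Irr n q → p ∣ q → p ≈ q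
  irr-∣-irr {m} {n} {p} {q} ip iq p∣q@(h , eq) with divisors iq (hasDegree (monic ip)) p∣q
  ... | inj₁ refl = ⊥-elim (ℕₚ.<-irrefl refl (positive ip))
  ... | inj₂ refl with degree-factor h (hasDegree (monic ip)) (degree-≈ (P.sym eq) (hasDegree (monic iq)))
  ... | e , n≡n+e , dh with ℕₚ.+-cancelˡ-≡ n e 0 (trans (sym n≡n+e) (sym (ℕₚ.+-identityʳ n)))
  ... | refl = P.trans (P.sym (P.*-identityʳ p)) (P.trans (⊠-congˡ (P.sym h≈1)) eq)
    where
    h0≡1 : co h 0 ≡ 1#
    h0≡1 = begin
      co h 0                      ≡⟨ K.*-identityˡ _ ⟨
      1# * co h 0                 ≡⟨ cong (_* co h 0) (lead≡1 (monic ip)) ⟨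
      co p n * co h 0             ≡⟨ lead-⊗ (vanish (monic ip)) (bounded dh) ⟨
      co (p ⊠ h) (n ℕ.+ 0)        ≡⟨ cong (co (p ⊠ h)) (ℕₚ.+-identityʳ n) ⟩
      co (p ⊠ h) n                ≡⟨ at eq n ⟩
      co q n                      ≡⟨ lead≡1 (monic iq) ⟩
      1#                          ∎
      where open ≡-Reasoning
    h≈1 : h ≈ ⟨ 1# ⟩
    h≈1 = P.trans (degree-0 dh) (P.reflexive (cong ⟨_⟩ h0≡1))

  -- Coprimality as cancellation, exactly what independence in the sieve requires; no Bézout
  -- relation has to be constructed for products.
  record Coprime (p q : Pol) : Set where
    constructor mkCoprime
    field cancel : ∀ {f} → p ∣ q ⊠ f → p ∣ f
  open Coprime public

  irr-coprime : ∀ {m n p q} → Irr m p → Irr n q → ¬ p ≈ q → Coprime p q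
  irr-coprime {q = q} ip iq p≉q .cancel {f} p∣qf with euclid ip q f p∣qf
  ... | inj₁ p∣q = ⊥-elim (p≉q (irr-∣-irr ip iq p∣q))
  ... | inj₂ p∣f = p∣f

  coprime-⊠ʳ : ∀ {p a b} → Coprime p a → Coprime p b → Coprime p (a ⊠ b)
  coprime-⊠ʳ {p} {a} {b} ca cb .cancel {f} d = cancel cb (cancel ca (∣-resp (P.*-assoc a b f) d))

  coprime-∣ : ∀ {a b f} → Coprime b a → a ∣ f → b ∣ f → a ⊠ b ∣ f
  coprime-∣ {a} {b} cba (h , eq) b∣f with cancel cba (∣-resp (P.sym eq) b∣f)
  ... | k , eq′ = k , P.trans (P.*-assoc a b k) (P.trans (⊠-congˡ eq′) eq)

  -- From a b k = q f and f = a h, cancelling `a` leaves b k = q h, so `b` divides `h`. Nothing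
  -- relates `a` to `b`, so this covers the square (x - c)².
  coprime-⊠ˡ : ∀ {a b q d} → HasDegree d a → Coprime a q → Coprime b q → Coprime (a ⊠ b) q
  coprime-⊠ˡ {a} {b} {q} da ca cb .cancel {f} ab∣qf@(k , eq) with cancel ca (∣-trans (∣-⊠ʳ a b) ab∣qf)
  ... | h , ah≈f with cancel cb {h} (k , ⊠-cancelˡ da (begin
    a ⊠ (b ⊠ k)    ≈⟨ P.*-assoc a b k ⟨
    (a ⊠ b) ⊠ k    ≈⟨ eq ⟩
    q ⊠ f          ≈⟨ ⊠-congˡ ah≈f ⟨
    q ⊠ (a ⊠ h)    ≈⟨ PL.*-swap q a h ⟩
    (a ⊠ q) ⊠ h    ≈⟨ P.*-assoc a q h ⟩
    a ⊠ (q ⊠ h)    ∎))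
    where open P-Reasoning
  ... | l , bl≈h = l , P.trans (P.*-assoc a b l) (P.trans (⊠-congˡ bl≈h) ah≈f)

  -- Linear factors x - c with c² = 1.

  lin : Carrier → Pol
  lin c = var ⊟ ⟨ c ⟩

  monic-lin : ∀ c → Monic 1 (lin c)
  monic-lin c = mkMonic (trans (cong (1# +_) -0#≈0#) (K.+-identityʳ 1#))
    λ { (suc zero) (s≤s ()) ; (suc (suc k)) _ → trans (cong (0# +_) -0#≈0#) (K.+-identityʳ 0#) }

  lin-0 : ∀ c → co (lin c) 0 ≡ - c
  lin-0 c = K.+-identityˡ (- c)

  irr-linear : ∀ {p} → Monic 1 p → Irr 1 p
  irr-linear {p} mp = mkIrr mp (s≤s z≤n) divs
    where
    divs : ∀ {d g} → HasDegree d g → g ∣ p → d ≡ 0 ⊎ d ≡ 1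
    divs {zero}  dg g∣p = inj₁ refl
    divs {suc d} dg (h , eq) with degree-factor h dg (degree-≈ (P.sym eq) (hasDegree mp))
    ... | e , 1≡ , _ = inj₂ (cong suc (ℕₚ.m+n≡0⇒m≡0 d (sym (ℕₚ.suc-injective 1≡))))

  powVar : ℕ → Pol
  powVar n .co    = x^ n
  powVar n .bnd   = n ℕ.+ 1
  powVar n .bound = bound-shift n (bound-const 1#)

  powVar-suc : ∀ n → powVar (suc n) ≈ var ⊠ powVar n
  powVar-suc n .at k = sym (x^-⊗ 1 (x^ n) k)

  ⟨⟩-shift : ∀ c n → co (⟨ c ⟩ ⊠ powVar n) ≋ shift n (const c)
  ⟨⟩-shift c n k = trans (⊗-comm (const c) (x^ n) k) (x^-⊗ n (const c) k)

  module _ {c : Carrier} (c²≡1 : c * c ≡ 1#) where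

    ⟨c⟩²≈1 : ⟨ c ⟩ ⊠ ⟨ c ⟩ ≈ ⟨ 1# ⟩
    ⟨c⟩²≈1 .at zero    = c²≡1
    ⟨c⟩²≈1 .at (suc k) = trans (⟨⟩-⊠ c ⟨ c ⟩ (suc k)) (K.zeroʳ c)

    -- The value of 1 - c x^(2k+1) at x = c is 1 - (c²)^(k+1) = 0; the induction raises the exponent
    -- by two through 1 - x².
    lin-∣-odd : ∀ k → lin c ∣ ⟨ 1# ⟩ ⊟ ⟨ c ⟩ ⊠ (var ⊠ (powVar k ⊠ powVar k))
    lin-∣-odd zero = neg ⟨ c ⟩ , P.sym (P.trans (⊞-congˡ (P.-‿cong (⊠-congˡ (⊠-congˡ (P.*-cong one≈ one≈))))) (PL.linear-factor ⟨ c ⟩ var ⟨c⟩²≈1))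
      where
      one≈ : powVar 0 ≈ ⟨ 1# ⟩
      one≈ = mk≈ λ _ → refl
    lin-∣-odd (suc k) = ∣-resp (P.sym (P.trans (⊞-congˡ (P.-‿cong (⊠-congˡ (⊠-congˡ (P.*-cong (powVar-suc k) (powVar-suc k))))))
        (PL.raise ⟨ c ⟩ var (powVar k))))
      (∣-⊞ (lin-∣-odd k) (∣-trans (_ , P.sym (PL.square-difference ⟨ c ⟩ var ⟨c⟩²≈1)) (∣-⊠ˡ _ _)))

    -- Peeling off opposite coefficients never divides by 2, so this covers characteristic 2 as well.
    lin-∣-fold : ∀ k L → Bound (suc k) (co L) → lin c ∣ L ⊟ ⟨ c ⟩ ⊠ (powVar (suc k) ⊠ rev k L)
    lin-∣-fold zero L b = ∣-resp (P.sym eq) (∣-trans (lin-∣-odd 0) (∣-⊠ˡ _ ⟨ co L 0 ⟩))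
      where
      L≈ : L ≈ ⟨ co L 0 ⟩
      L≈ .at zero    = refl
      L≈ .at (suc k) = b (suc k) (s≤s z≤n)
      rev≈ : rev 0 L ≈ 𝟘 ⊞ ⟨ co L 0 ⟩ ⊠ powVar 0
      rev≈ .at zero    = sym (trans (K.+-identityˡ _) (⟨⟩-shift (co L 0) 0 0))
      rev≈ .at (suc k) = sym (trans (K.+-identityˡ _) (⟨⟩-shift (co L 0) 0 (suc k)))
      eq : L ⊟ ⟨ c ⟩ ⊠ (powVar 1 ⊠ rev 0 L) ≈ ⟨ co L 0 ⟩ ⊠ (⟨ 1# ⟩ ⊟ ⟨ c ⟩ ⊠ (var ⊠ (powVar 0 ⊠ powVar 0)))
      eq = begin
        L ⊟ ⟨ c ⟩ ⊠ (powVar 1 ⊠ rev 0 L)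
          ≈⟨ P.+-cong (P.trans L≈ (P.sym (P.trans (⊞-congˡ (P.zeroʳ var)) (P.+-identityʳ _)))) (P.-‿cong (⊠-congˡ (P.*-cong (powVar-suc 0) rev≈))) ⟩
        (⟨ co L 0 ⟩ ⊞ var ⊠ 𝟘) ⊟ ⟨ c ⟩ ⊠ ((var ⊠ powVar 0) ⊠ (𝟘 ⊞ ⟨ co L 0 ⟩ ⊠ powVar 0))
          ≈⟨ PL.peel ⟨ co L 0 ⟩ var 𝟘 ⟨ c ⟩ (powVar 0) 𝟘 ⟩
        ⟨ co L 0 ⟩ ⊠ (⟨ 1# ⟩ ⊟ ⟨ c ⟩ ⊠ (var ⊠ (powVar 0 ⊠ powVar 0))) ⊞ var ⊠ (𝟘 ⊟ ⟨ c ⟩ ⊠ (powVar 0 ⊠ 𝟘))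
          ≈⟨ ⊞-congˡ (P.trans (⊠-congˡ (P.trans (⊞-congˡ (P.-‿cong (P.trans (⊠-congˡ (P.zeroʳ _)) (P.zeroʳ _)))) (P.-‿inverseʳ 𝟘))) (P.zeroʳ _)) ⟩
        ⟨ co L 0 ⟩ ⊠ (⟨ 1# ⟩ ⊟ ⟨ c ⟩ ⊠ (var ⊠ (powVar 0 ⊠ powVar 0))) ⊞ 𝟘
          ≈⟨ P.+-identityʳ _ ⟩
        ⟨ co L 0 ⟩ ⊠ (⟨ 1# ⟩ ⊟ ⟨ c ⟩ ⊠ (var ⊠ (powVar 0 ⊠ powVar 0))) ∎
        where open P-Reasoning
    lin-∣-fold (suc k) L b = ∣-resp (P.sym eq)
      (∣-⊞ (∣-trans (lin-∣-odd (suc k)) (∣-⊠ˡ _ ⟨ co L 0 ⟩)) (∣-trans (lin-∣-fold k (tailP L) (bound-tail b)) (∣-⊠ˡ _ var)))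
      where
      y = powVar (suc k)
      rev≈ : rev (suc k) L ≈ rev k (tailP L) ⊞ ⟨ co L 0 ⟩ ⊠ y
      rev≈ .at j = trans (reverse-suc k (co L) j) (cong (reverse k (tail (co L)) j +_) (sym (⟨⟩-shift (co L 0) (suc k) j)))
      eq : L ⊟ ⟨ c ⟩ ⊠ (powVar (suc (suc k)) ⊠ rev (suc k) L) ≈
           ⟨ co L 0 ⟩ ⊠ (⟨ 1# ⟩ ⊟ ⟨ c ⟩ ⊠ (var ⊠ (y ⊠ y))) ⊞ var ⊠ (tailP L ⊟ ⟨ c ⟩ ⊠ (y ⊠ rev k (tailP L)))
      eq = P.trans (P.+-cong (head-tail L) (P.-‿cong (⊠-congˡ (P.*-cong (powVar-suc (suc k)) rev≈))))
        (PL.peel ⟨ co L 0 ⟩ var (tailP L) ⟨ c ⟩ y (rev k (tailP L)))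

    -- With `L` the part of `h` of degree at most k, the symmetry says h = L - c x^(k+1) L^, where
    -- L^ is the reversal of `L`; this is the shape treated by `lin-∣-fold`.
    lin-∣-antireciprocal : ∀ k h → Bound (suc k ℕ.+ suc k) (co h) → (∀ j → j ≤ k → co h (suc k ℕ.+ j) ≡ - (c * co h (k ∸ j))) → lin c ∣ h
    lin-∣-antireciprocal k h b sym-h = ∣-resp (mk≈ eq) (lin-∣-fold k L bL)
      where
      L : Pol
      L .co j    = if j ≤ᵇ k then co h j else 0#
      L .bnd     = suc k
      L .bound j k<j rewrite ≤ᵇ-false k<j = refl
      bL : Bound (suc k) (co L)
      bL j k<j rewrite ≤ᵇ-false k<j = refl
      L-≤ : ∀ {j} → j ≤ k → co L j ≡ co h j
      L-≤ j≤k rewrite ≤ᵇ-true j≤k = refl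
      high : ∀ j → co (⟨ c ⟩ ⊠ (powVar (suc k) ⊠ rev k L)) j ≡ c * shift (suc k) (reverse k (co L)) j
      high j = trans (⟨⟩-⊠ c (powVar (suc k) ⊠ rev k L) j) (cong (c *_) (x^-⊗ (suc k) (reverse k (co L)) j))
      eq : ∀ j → co (L ⊟ ⟨ c ⟩ ⊠ (powVar (suc k) ⊠ rev k L)) j ≡ co h j
      eq j with ℕₚ.≤-<-connex (suc k) j
      ... | inj₂ (s≤s j≤k) = begin
        co L j - co (⟨ c ⟩ ⊠ (powVar (suc k) ⊠ rev k L)) j   ≡⟨ cong₂ _-_ (L-≤ j≤k) (trans (high j) (trans (cong (c *_) (shift-< (suc k) _ j (s≤s j≤k))) (K.zeroʳ c))) ⟩
        co h j - 0#                                          ≡⟨ trans (cong (co h j +_) -0#≈0#) (K.+-identityʳ _) ⟩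
        co h j                                               ∎
        where open ≡-Reasoning
      ... | inj₁ k<j with ℕₚ.m≤n⇒∃[o]m+o≡n k<j
      ... | i , refl = trans (cong₂ _-_ (bL (suc k ℕ.+ i) k<j) (trans (high (suc k ℕ.+ i)) (cong (c *_) (shift-+ (suc k) (reverse k (co L)) i))))
          (trans (K.+-identityˡ _) (upper (ℕₚ.≤-<-connex i k)))
        where
        upper : i ≤ k ⊎ k < i → - (c * reverse k (co L) i) ≡ co h (suc k ℕ.+ i)
        upper (inj₁ i≤k) = trans (cong (λ z → - (c * z)) (trans (reverse-≤ (co L) i≤k) (L-≤ (ℕₚ.m∸n≤m k i)))) (sym (sym-h i i≤k))
        upper (inj₂ k<i) = trans (cong (λ z → - (c * z)) (reverse-> (co L) i k<i))
          (trans (trans (cong -_ (K.zeroʳ c)) -0#≈0#) (sym (b (suc k ℕ.+ i) (ℕₚ.+-monoʳ-≤ (suc k) k<i))))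

  -- Coefficient vectors, finite enumeration and the two notions of irreducibility.

  open Poly F using (coeff; Irreducible; IsUnit; IsPoly; one; convAux) renaming (_·_ to _·ᴾ_)

  elements : List Carrier
  elements = map to (allFin q)

  elements-unique : Unique elements
  elements-unique = Uniqueₚ.map⁺ (λ {i} {j} eq → trans (sym (strictlyInverseʳ i)) (trans (cong from eq) (strictlyInverseʳ j))) (Uniqueₚ.allFin⁺ q)

  ∈-elements : ∀ c → c ∈ elements
  ∈-elements c = subst (_∈ elements) (strictlyInverseˡ c) (∈-map⁺ to (∈-allFin (from c)))

  vectors : ∀ n → List (Vec Carrier n)
  vectors zero    = [] ∷ []
  vectors (suc n) = cartesianProductWith _∷_ elements (vectors n)

  vectors-unique : ∀ n → Unique (vectors n)
  vectors-unique zero    = [] ∷ []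
  vectors-unique (suc n) = Uniqueₚ.cartesianProductWith⁺ _∷_ (λ { refl → refl , refl }) elements-unique (vectors-unique n)

  ∈-vectors : ∀ {n} (v : Vec Carrier n) → v ∈ vectors n
  ∈-vectors []      = here refl
  ∈-vectors (c ∷ v) = ∈-cartesianProductWith⁺ _∷_ (∈-elements c) (∈-vectors v)

  coeff-< : ∀ {n k} (v : Vec Carrier n) (k<n : k < n) → coeff v k ≡ lookup v (fromℕ< k<n)
  coeff-< {n} {k} v k<n with k ℕ.<? n
  ... | yes k<n′ = cong (lookup v) (Finₚ.fromℕ<-cong k k refl k<n′ k<n)
  ... | no  k≮n  = ⊥-elim (k≮n k<n)

  coeff-≡ : ∀ {n} (v : Vec Carrier n) → coeff v n ≡ 1#
  coeff-≡ {n} v with n ℕ.<? n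
  ... | yes n<n = ⊥-elim (ℕₚ.<-irrefl refl n<n)
  ... | no  _ with n ℕ.≟ n
  ...   | yes _   = refl
  ...   | no  n≢n = ⊥-elim (n≢n refl)

  coeff-> : ∀ {n} (v : Vec Carrier n) → Bound (suc n) (coeff v)
  coeff-> {n} v k n<k with k ℕ.<? n
  ... | yes k<n = ⊥-elim (ℕₚ.<-asym n<k k<n)
  ... | no  _ with k ℕ.≟ n
  ...   | yes refl = ⊥-elim (ℕₚ.<-irrefl refl n<k)
  ...   | no  _    = refl

  lower : ∀ n → Ser → Vec Carrier n
  lower n f = tabulate (f ∘ toℕ)

  lower-cong : ∀ n {f g} → f ≋ g → lower n f ≡ lower n g
  lower-cong n eq = Vecₚ.tabulate-cong (eq ∘ toℕ)

  lower-coeff : ∀ {n} (v : Vec Carrier n) → lower n (coeff v) ≡ v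
  lower-coeff v = trans (Vecₚ.tabulate-cong (λ i → trans (coeff-< v (Finₚ.toℕ<n i)) (cong (lookup v) (Finₚ.fromℕ<-toℕ i (Finₚ.toℕ<n i)))))
    (Vecₚ.tabulate∘lookup v)

  coeff-lower : ∀ {n f} → f n ≡ 1# → Bound (suc n) f → coeff (lower n f) ≋ f
  coeff-lower {n} {f} top b k with ℕₚ.<-cmp k n
  ... | tri< k<n _ _ = trans (coeff-< (lower n f) k<n) (trans (Vecₚ.lookup∘tabulate (f ∘ toℕ) (fromℕ< k<n)) (cong f (Finₚ.toℕ-fromℕ< k<n)))
  ... | tri≈ _ refl _ = trans (coeff-≡ (lower n f)) (sym top)
  ... | tri> _ _ n<k = trans (coeff-> (lower n f) k n<k) (sym (b k n<k))

  ⌊_⌋ : ∀ {n} → Vec Carrier n → Pol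
  ⌊_⌋ {n} v .co    = coeff v
  ⌊_⌋ {n} v .bnd   = suc n
  ⌊_⌋ {n} v .bound = coeff-> v

  monic-⌊⌋ : ∀ {n} (v : Vec Carrier n) → Monic n ⌊ v ⌋
  monic-⌊⌋ v = mkMonic (coeff-≡ v) (coeff-> v)

  ⌊lower⌋ : ∀ {n p} → Monic n p → ⌊ lower n (co p) ⌋ ≈ p
  ⌊lower⌋ mp = mk≈ (coeff-lower (lead≡1 mp) (vanish mp))

  ⌊⌋-injective : ∀ {n} {v w : Vec Carrier n} → ⌊ v ⌋ ≈ ⌊ w ⌋ → v ≡ w
  ⌊⌋-injective {n} {v} {w} eq = trans (sym (lower-coeff v)) (trans (lower-cong n (at eq)) (lower-coeff w))

  ·-⊗ : ∀ f g → (f ·ᴾ g) ≋ f ⊗ g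
  ·-⊗ f g n = go f n
    where
    peel : ∀ f n i → convAux f g (suc n) (suc i) ≡ f 0 * g (suc n) + convAux (tail f) g n i
    peel f n zero    = trans (K.+-identityˡ _) (sym (K.+-identityʳ _))
    peel f n (suc i) = trans (cong (_+ f (suc i) * g (n ∸ i)) (peel f n i)) (K.+-assoc _ _ _)
    go : ∀ f n → convAux f g n (suc n) ≡ (f ⊗ g) n
    go f zero    = K.+-identityˡ _
    go f (suc n) = trans (peel f n (suc n)) (cong (f 0 * g (suc n) +_) (go (tail f) n))

  toPol : ∀ f → IsPoly f → Pol
  toPol f (b , isP) .co        = f
  toPol f (b , isP) .bnd       = suc b
  toPol f (b , isP) .bound k p = isP k p

  isPoly : ∀ f → IsPoly (co f)
  isPoly f = bnd f , λ k b<k → bound f k (ℕₚ.<⇒≤ b<k)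

  one-1S : one ≋ 1S
  one-1S zero    = refl
  one-1S (suc n) = refl

  degree-1 : HasDegree 0 ⟨ 1# ⟩
  degree-1 = mkDegree 1≢0 (bound-const 1#)

  unit-degree : ∀ {d g} → HasDegree d g → IsUnit (co g) → d ≡ 0
  unit-degree {d} {g} dg (h , hP , eq) with degree-factor (toPol h hP) dg
      (degree-≈ (mk≈ (λ n → sym (trans (sym (·-⊗ (co g) h n)) (trans (eq n) (one-1S n))))) degree-1)
  ... | c , 0≡d+c , _ = ℕₚ.m+n≡0⇒m≡0 d (sym 0≡d+c)

  degree-0-unit : ∀ {g} → HasDegree 0 g → IsUnit (co g)
  degree-0-unit {g} dg = co h , isPoly h , λ n → trans (·-⊗ (co g) (co h) n) (trans (unit n) (sym (one-1S n)))
    where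
    h : Pol
    h = ⟨ (co g 0) ⁻¹ ⟩
    unit : co (g ⊠ h) ≋ 1S
    unit zero    = ⁻¹-inv (co g 0) (lead≢0 dg)
    unit (suc n) = trans (bound₁-⊗ (co h) (bounded dg) (suc n)) (K.zeroʳ _)

  module _ {n} (v : Vec Carrier n) where

    irreducible⇒irr : Irreducible (coeff v) → Irr n ⌊ v ⌋
    irreducible⇒irr (_ , ¬unit , factor) = mkIrr (monic-⌊⌋ v) (pos n refl) divs
      where
      pos : ∀ m → m ≡ n → 0 < n
      pos zero    refl = ⊥-elim (¬unit (degree-0-unit (hasDegree (monic-⌊⌋ v))))
      pos (suc m) refl = s≤s z≤n
      divs : ∀ {d g} → HasDegree d g → g ∣ ⌊ v ⌋ → d ≡ 0 ⊎ d ≡ n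
      divs {d} {g} dg (h , eq) with factor (co g) (co h) (isPoly g) (isPoly h) (λ k → sym (trans (·-⊗ (co g) (co h) k) (at eq k)))
      ... | inj₁ unit-g = inj₁ (unit-degree dg unit-g)
      ... | inj₂ unit-h with degree-factor h dg (degree-≈ (P.sym eq) (hasDegree (monic-⌊⌋ v)))
      ... | c , n≡d+c , dh = inj₂ (sym (trans n≡d+c (trans (cong (d ℕ.+_) (unit-degree dh unit-h)) (ℕₚ.+-identityʳ d))))

    irr⇒irreducible : Irr n ⌊ v ⌋ → Irreducible (coeff v)
    irr⇒irreducible irr = (λ z → 1≢0 (trans (sym (coeff-≡ v)) (z n)))
      , (λ u → ℕₚ.<-irrefl (sym (unit-degree (hasDegree (monic irr)) u)) (positive irr))
      , factor
      where
      factor : ∀ g h → IsPoly g → IsPoly h → (∀ k → coeff v k ≡ (g ·ᴾ h) k) → IsUnit g ⊎ IsUnit h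
      factor g h gP hP eq = units (degree? g′)
        where
        g′ h′ : Pol
        g′ = toPol g gP
        h′ = toPol h hP
        product : g′ ⊠ h′ ≈ ⌊ v ⌋
        product = mk≈ λ k → sym (trans (eq k) (·-⊗ g h k))
        units : g′ ≈ 𝟘 ⊎ (Σ ℕ λ d → HasDegree d g′) → IsUnit g ⊎ IsUnit h
        units (inj₁ z) = ⊥-elim (degree-≉0 (hasDegree (monic irr)) (P.trans (P.sym product) (P.trans (⊠-congʳ z) (P.zeroˡ h′))))
        units (inj₂ (d , dg)) with divisors irr dg (h′ , product)
        ... | inj₁ refl = inj₁ (degree-0-unit dg)
        ... | inj₂ refl with degree-factor h′ dg (degree-≈ (P.sym product) (hasDegree (monic irr)))
        ... | c , d≡d+c , dh with ℕₚ.+-cancelˡ-≡ d c 0 (trans (sym d≡d+c) (sym (ℕₚ.+-identityʳ d)))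
        ... | refl = inj₂ (degree-0-unit dh)

  ⟨⁻¹⟩-⊠-∣ : ∀ {l g f} → l ≢ 0# → g ∣ f → ⟨ l ⁻¹ ⟩ ⊠ g ∣ f
  ⟨⁻¹⟩-⊠-∣ {l} {g} {f} l≢0 (h , eq) = ⟨ l ⟩ ⊠ h , (begin
    (⟨ l ⁻¹ ⟩ ⊠ g) ⊠ (⟨ l ⟩ ⊠ h)   ≈⟨ PL.*-exchange ⟨ l ⁻¹ ⟩ g ⟨ l ⟩ h ⟩
    ⟨ l ⁻¹ ⟩ ⊠ (⟨ l ⟩ ⊠ (g ⊠ h))   ≈⟨ ⟨⟩-cancel l (g ⊠ h) l≢0 ⟩
    g ⊠ h                          ≈⟨ eq ⟩
    f                              ∎)
    where open P-Reasoning

  monic-normalised : ∀ {d g} → HasDegree d g → Monic d (⟨ co g d ⁻¹ ⟩ ⊠ g)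
  monic-normalised {d} {g} dg = mkMonic
    (trans (⟨⟩-⊠ (co g d ⁻¹) g d) (trans (K.*-comm _ _) (⁻¹-inv (co g d) (lead≢0 dg))))
    (bound-≋ (λ k → sym (⟨⟩-⊠ (co g d ⁻¹) g k)) (bound-scale (co g d ⁻¹) (bounded dg)))

  -- Only finitely many monic polynomials have smaller degree, so a proper divisor can be searched
  -- for. One that is found is treated by strong induction; otherwise `f` itself is irreducible.
  irreducible-factor : ∀ n f → Monic n f → 0 < n → Σ ℕ λ m → Σ Pol λ p → Irr m p × p ∣ f
  irreducible-factor = <-rec _ step
    where
    step : ∀ n → (∀ {m} → m < n → ∀ f → Monic m f → 0 < m → Σ ℕ λ m → Σ Pol λ p → Irr m p × p ∣ f) →
           ∀ f → Monic n f → 0 < n → Σ ℕ λ m → Σ Pol λ p → Irr m p × p ∣ f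
    step n rec f mf 0<n with ℕₚ.anyUpTo? (λ d → (0 ℕ.<? d) ×-dec Any.any? (λ v → divides? (hasDegree (monic-⌊⌋ v)) f) (vectors d)) n
    ... | yes (d , d<n , 0<d , any) with find any
    ...   | v , _ , v∣f with rec d<n ⌊ v ⌋ (monic-⌊⌋ v) 0<d
    ...     | m , p , irr , p∣v = m , p , irr , ∣-trans p∣v v∣f
    step n rec f mf 0<n | no ¬any = n , f , mkIrr mf 0<n divs , ⟨ 1# ⟩ , P.*-identityʳ f
      where
      divs : ∀ {d g} → HasDegree d g → g ∣ f → d ≡ 0 ⊎ d ≡ n
      divs {zero} dg g∣f = inj₁ refl
      divs {suc d} {g} dg g∣f@(h , eq) with degree-factor h dg (degree-≈ (P.sym eq) (hasDegree mf))
      ... | c , n≡ , _ with ℕₚ.m≤n⇒m<n∨m≡n (subst (suc d ≤_) (sym n≡) (ℕₚ.m≤m+n (suc d) c))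
      ...   | inj₂ d≡n = inj₂ d≡n
      -- The search ran over monic polynomials only, so `g` is divided by its leading coefficient
      -- before it can contradict `¬any`.
      ...   | inj₁ d<n = ⊥-elim (¬any (suc d , d<n , s≤s z≤n , lose (∈-vectors (lower (suc d) (co (⟨ co g (suc d) ⁻¹ ⟩ ⊠ g))))
                (∣-≈ (P.sym (⌊lower⌋ (monic-normalised dg))) P.refl (⟨⁻¹⟩-⊠-∣ (lead≢0 dg) g∣f))))

-- The two families enumerated by F^n: monic and palindromic polynomials.

module Families (F : Field) (q : ℕ) (card : HasCard F q) where

  open import Data.Nat using (∣_-_∣)
  open PolynomialRing F q card
  open Series K
  open K using (_*_; 1#)
  open Field F using (Carrier)
  open Poly F using (coeff)
  module S = Sieve (Vec Carrier) vectors vectors-unique ∈-vectors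

  -- The grade is the number of free coefficients: the degree for monic polynomials, half of it for
  -- palindromic ones. Closure under products and under quotients by members makes multiplication by
  -- a member a bijection onto its multiples.
  record Family : Set₁ where
    field
      In            : ℕ → Pol → Set
      embed         : ∀ {n} → Vec Carrier n → Pol
      project       : ∀ n → Pol → Vec Carrier n
      in-embed      : ∀ {n} (v : Vec Carrier n) → In n (embed v)
      project-cong  : ∀ n {f g} → f ≈ g → project n f ≡ project n g
      project-embed : ∀ {n} (v : Vec Carrier n) → project n (embed v) ≡ v
      embed-project : ∀ {n f} → In n f → embed (project n f) ≈ f
      in-≈          : ∀ {n f g} → f ≈ g → In n f → In n g
      in-degree     : ∀ {n f} → In n f → Σ ℕ λ d → HasDegree d f
      in-⊠          : ∀ {c n p f} → In c p → In n f → In (c ℕ.+ n) (p ⊠ f)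
      in-quotient   : ∀ {c n p h} → In c p → In n (p ⊠ h) → Σ ℕ λ m → n ≡ c ℕ.+ m × In m h

    module _ {c p} (in-p : In c p) where
      private
        dp = proj₂ (in-degree in-p)

        embed-times : ∀ {n} (f : Vec Carrier n) → embed (project (c ℕ.+ n) (p ⊠ embed f)) ≈ p ⊠ embed f
        embed-times f = embed-project (in-⊠ in-p (in-embed f))

      generator : S.Generator
      generator = record
        { degree          = c
        ; Divides         = λ f → p ∣ embed f
        ; divides?        = λ f → divides? dp (embed f)
        ; times           = λ {n} f → project (c ℕ.+ n) (p ⊠ embed f)
        ; times-injective = λ {n} {f} {g} eq → trans (sym (project-embed f)) (trans (project-cong n
            (⊠-cancelˡ dp (P.trans (P.sym (embed-times f)) (P.trans (P.reflexive (cong embed eq)) (embed-times g))))) (project-embed g))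
        ; divides-times   = λ f → ∣-resp (P.sym (embed-times f)) (∣-⊠ʳ p (embed f))
        ; divides-degree  = λ { f (h , eq) → let m , n≡c+m , _ = in-quotient in-p (in-≈ (P.sym eq) (in-embed f))
                                               in subst (c ≤_) (sym n≡c+m) (ℕₚ.m≤m+n c m) }
        ; quotient        = quot′
        }
        where
        quot′ : ∀ {n} (f : Vec Carrier (c ℕ.+ n)) → p ∣ embed f → Σ (Vec Carrier n) λ g → f ≡ project (c ℕ.+ n) (p ⊠ embed g)
        quot′ {n} f (h , eq) with in-quotient in-p (in-≈ (P.sym eq) (in-embed f))
        ... | m , c+n≡c+m , in-h with ℕₚ.+-cancelˡ-≡ c n m c+n≡c+m
        ... | refl = project n h , trans (sym (project-embed f)) (project-cong (c ℕ.+ n)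
          (P.trans (P.sym eq) (⊠-congˡ (P.sym (embed-project in-h)))))

    -- Multiplication is by `p` and divisibility is by `q`, hence the reversed order in
    -- `Coprime q p`.
    coprime-independent : ∀ {c d p q} (in-p : In c p) (in-q : In d q) → Coprime q p → S.Independent (generator in-p) (generator in-q)
    coprime-independent {p = p} in-p in-q cqp n f =
        (λ q∣ → cancel cqp (∣-resp (embed-project (in-⊠ in-p (in-embed f))) q∣))
      , (λ q∣ → ∣-resp (P.sym (embed-project (in-⊠ in-p (in-embed f)))) (∣-trans q∣ (∣-⊠ˡ (embed f) p)))

  monic-≈ : ∀ {n f g} → f ≈ g → Monic n f → Monic n g
  monic-≈ eq mf = mkMonic (trans (sym (at eq _)) (lead≡1 mf)) (bound-≋ (at eq) (vanish mf))

  monic-⊠ : ∀ {c n p f} → Monic c p → Monic n f → Monic (c ℕ.+ n) (p ⊠ f)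
  monic-⊠ mp mf = mkMonic (trans (lead-⊗ (vanish mp) (vanish mf)) (trans (cong₂ _*_ (lead≡1 mp) (lead≡1 mf)) (K.*-identityˡ 1#)))
    (bound-suc-⊗ (vanish mp) (vanish mf))

  monic-quotient : ∀ {c n p h} → Monic c p → Monic n (p ⊠ h) → Σ ℕ λ m → n ≡ c ℕ.+ m × Monic m h
  monic-quotient {c} {n} {p} {h} mp mph with degree-factor h (hasDegree mp) (hasDegree mph)
  ... | m , refl , dh = m , refl , mkMonic (begin
      co h m                  ≡⟨ K.*-identityˡ _ ⟨
      1# * co h m             ≡⟨ cong (_* co h m) (lead≡1 mp) ⟨
      co p c * co h m         ≡⟨ lead-⊗ (vanish mp) (bounded dh) ⟨
      co (p ⊠ h) (c ℕ.+ m)    ≡⟨ lead≡1 mph ⟩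
      1#                      ∎) (bounded dh)
    where open ≡-Reasoning

  monics : Family
  monics = record
    { In            = Monic
    ; embed         = ⌊_⌋
    ; project       = λ n f → lower n (co f)
    ; in-embed      = monic-⌊⌋
    ; project-cong  = λ n eq → lower-cong n (at eq)
    ; project-embed = lower-coeff
    ; embed-project = ⌊lower⌋
    ; in-≈          = monic-≈
    ; in-degree     = λ mf → _ , hasDegree mf
    ; in-⊠          = monic-⊠
    ; in-quotient   = monic-quotient
    }

  record Palindromic (n : ℕ) (f : Pol) : Set where
    constructor mkPal
    field
      pal-monic : Monic (n ℕ.+ n) f
      pal-rev   : rev (n ℕ.+ n) f ≈ f
  open Palindromic public

  -- v lists the coefficients from the middle outwards: those of x^{n±j} are both coeff v j.
  palindrome : ∀ {n} → Vec Carrier n → Pol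
  palindrome {n} v .co k          = coeff v ∣ k - n ∣
  palindrome {n} v .bnd           = suc (n ℕ.+ n)
  palindrome {n} v .bound k 2n<k  = coeff-> v ∣ k - n ∣ (subst (suc n ≤_) (sym (ℕₚ.m≤n⇒∣n-m∣≡n∸m (ℕₚ.≤-trans (ℕₚ.m≤n+m n (suc n)) 2n<k)))
    (ℕₚ.m+n≤o⇒m≤o∸n (suc n) 2n<k))

  ∣m+n-m∣≡n : ∀ m n → ∣ m ℕ.+ n - m ∣ ≡ n
  ∣m+n-m∣≡n m n = trans (ℕₚ.∣-∣-comm (m ℕ.+ n) m) (ℕₚ.∣m-m+n∣≡n m n)

  n+n∸k : ∀ {n k} → k ≤ n → (n ℕ.+ n) ∸ k ≡ n ℕ.+ (n ∸ k)
  n+n∸k {n} {k} k≤n = ℕₚ.+-∸-assoc n k≤n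

  ∣2n-k-n∣ : ∀ {n k} → k ≤ n ℕ.+ n → ∣ (n ℕ.+ n) ∸ k - n ∣ ≡ ∣ k - n ∣
  ∣2n-k-n∣ {n} {k} k≤2n with ℕₚ.≤-total k n
  ... | inj₁ k≤n = begin
    ∣ (n ℕ.+ n) ∸ k - n ∣       ≡⟨ cong (∣_- n ∣) (n+n∸k k≤n) ⟩
    ∣ n ℕ.+ (n ∸ k) - n ∣       ≡⟨ ∣m+n-m∣≡n n (n ∸ k) ⟩
    n ∸ k                       ≡⟨ ℕₚ.m≤n⇒∣m-n∣≡n∸m k≤n ⟨
    ∣ k - n ∣                   ∎
    where open ≡-Reasoning
  ... | inj₂ n≤k with ℕₚ.m≤n⇒∃[o]m+o≡n n≤k
  ... | i , refl = begin
    ∣ (n ℕ.+ n) ∸ (n ℕ.+ i) - n ∣  ≡⟨ cong (∣_- n ∣) (ℕₚ.[m+n]∸[m+o]≡n∸o n n i) ⟩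
    ∣ n ∸ i - n ∣                  ≡⟨ ℕₚ.m≤n⇒∣m-n∣≡n∸m (ℕₚ.m∸n≤m n i) ⟩
    n ∸ (n ∸ i)                    ≡⟨ ℕₚ.m∸[m∸n]≡n (ℕₚ.+-cancelˡ-≤ n i n k≤2n) ⟩
    i                              ≡⟨ ∣m+n-m∣≡n n i ⟨
    ∣ n ℕ.+ i - n ∣                ∎
    where open ≡-Reasoning

  palindromic-palindrome : ∀ {n} (v : Vec Carrier n) → Palindromic n (palindrome v)
  palindromic-palindrome {n} v = mkPal
    (mkMonic (trans (cong (coeff v) (∣m+n-m∣≡n n n)) (coeff-≡ v)) (bound (palindrome v)))
    (mk≈ λ k → symmetric k (ℕₚ.≤-<-connex k (n ℕ.+ n)))
    where
    symmetric : ∀ k → k ≤ n ℕ.+ n ⊎ n ℕ.+ n < k → reverse (n ℕ.+ n) (co (palindrome v)) k ≡ co (palindrome v) k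
    symmetric k (inj₁ k≤2n) = trans (reverse-≤ (co (palindrome v)) k≤2n) (cong (coeff v) (∣2n-k-n∣ k≤2n))
    symmetric k (inj₂ 2n<k) = trans (reverse-> (co (palindrome v)) k 2n<k) (sym (bound (palindrome v) k 2n<k))

  upperHalf : ∀ n → Pol → Vec Carrier n
  upperHalf n f = lower n (λ k → co f (n ℕ.+ k))

  palindrome-upperHalf : ∀ {n f} → Palindromic n f → palindrome (upperHalf n f) ≈ f
  palindrome-upperHalf {n} {f} pf .at k = trans
    (coeff-lower (lead≡1 (pal-monic pf)) (λ j n<j → vanish (pal-monic pf) (n ℕ.+ j) (ℕₚ.≤-trans (ℕₚ.≤-reflexive (sym (ℕₚ.+-suc n n))) (ℕₚ.+-monoʳ-≤ n n<j))) ∣ k - n ∣)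
    (fold (ℕₚ.≤-total k n))
    where
    fold : k ≤ n ⊎ n ≤ k → co f (n ℕ.+ ∣ k - n ∣) ≡ co f k
    fold (inj₂ n≤k) = cong (co f) (trans (cong (n ℕ.+_) (ℕₚ.m≤n⇒∣n-m∣≡n∸m n≤k)) (ℕₚ.m+[n∸m]≡n n≤k))
    fold (inj₁ k≤n) = begin
      co f (n ℕ.+ ∣ k - n ∣)         ≡⟨ cong (λ j → co f (n ℕ.+ j)) (ℕₚ.m≤n⇒∣m-n∣≡n∸m k≤n) ⟩
      co f (n ℕ.+ (n ∸ k))           ≡⟨ cong (co f) (n+n∸k k≤n) ⟨
      co f ((n ℕ.+ n) ∸ k)           ≡⟨ reverse-≤ (co f) (ℕₚ.≤-trans k≤n (ℕₚ.m≤m+n n n)) ⟨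
      co (rev (n ℕ.+ n) f) k         ≡⟨ at (pal-rev pf) k ⟩
      co f k                         ∎
      where open ≡-Reasoning

  double-+ : ∀ c n → (c ℕ.+ c) ℕ.+ (n ℕ.+ n) ≡ (c ℕ.+ n) ℕ.+ (c ℕ.+ n)
  double-+ c n = +-interchange c c n n
    where open import Algebra.Properties.CommutativeSemigroup ℕₚ.+-commutativeSemigroup using () renaming (interchange to +-interchange)

  palindromic-⊠ : ∀ {c n p f} → Palindromic c p → Palindromic n f → Palindromic (c ℕ.+ n) (p ⊠ f)
  palindromic-⊠ {c} {n} {p} {f} pp pf = mkPal
    (subst (λ k → Monic k (p ⊠ f)) (double-+ c n) (monic-⊠ (pal-monic pp) (pal-monic pf)))
    (subst (λ k → rev k (p ⊠ f) ≈ p ⊠ f) (double-+ c n)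
      (P.trans (rev-⊠ (hasDegree (pal-monic pp)) (hasDegree (pal-monic pf))) (P.*-cong (pal-rev pp) (pal-rev pf))))

  -- The degree e of `h` satisfies 2n = 2c + e, so it is even. Reversing p h gives p times the
  -- reversal of `h`, and cancelling `p` leaves `h` palindromic.
  palindromic-quotient : ∀ {c n p h} → Palindromic c p → Palindromic n (p ⊠ h) → Σ ℕ λ m → n ≡ c ℕ.+ m × Palindromic m h
  palindromic-quotient {c} {n} {p} {h} pp pph with monic-quotient (pal-monic pp) (pal-monic pph)
  ... | e , 2n≡2c+e , mh with ℕₚ.≤-<-connex c n
  ... | inj₂ n<c = ⊥-elim (ℕₚ.<⇒≱ (ℕₚ.+-mono-< n<c n<c) (subst (c ℕ.+ c ≤_) (sym 2n≡2c+e) (ℕₚ.m≤m+n (c ℕ.+ c) e)))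
  ... | inj₁ c≤n with ℕₚ.m≤n⇒∃[o]m+o≡n c≤n
  ... | m , refl with ℕₚ.+-cancelˡ-≡ (c ℕ.+ c) e (m ℕ.+ m) (trans (sym 2n≡2c+e) (sym (double-+ c m)))
  ... | refl = m , refl , mkPal mh (⊠-cancelˡ (hasDegree (pal-monic pp)) (begin
      p ⊠ rev (m ℕ.+ m) h                       ≈⟨ ⊠-congʳ (pal-rev pp) ⟨
      rev (c ℕ.+ c) p ⊠ rev (m ℕ.+ m) h         ≈⟨ rev-⊠ (hasDegree (pal-monic pp)) (hasDegree mh) ⟨
      rev ((c ℕ.+ c) ℕ.+ (m ℕ.+ m)) (p ⊠ h)     ≡⟨ cong (λ k → rev k (p ⊠ h)) (double-+ c m) ⟩
      rev ((c ℕ.+ m) ℕ.+ (c ℕ.+ m)) (p ⊠ h)     ≈⟨ pal-rev pph ⟩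
      p ⊠ h                                     ∎))
    where open P-Reasoning

  palindromes : Family
  palindromes = record
    { In            = Palindromic
    ; embed         = palindrome
    ; project       = upperHalf
    ; in-embed      = palindromic-palindrome
    ; project-cong  = λ n eq → lower-cong n (λ k → at eq (n ℕ.+ k))
    ; project-embed = λ {n} v → trans (lower-cong n (λ k → cong (coeff v) (∣m+n-m∣≡n n k))) (lower-coeff v)
    ; embed-project = palindrome-upperHalf
    ; in-≈          = λ {n} eq pf → mkPal (monic-≈ eq (pal-monic pf)) (P.trans (rev-cong (n ℕ.+ n) (P.sym eq)) (P.trans (pal-rev pf) eq))
    ; in-degree     = λ pf → _ , hasDegree (pal-monic pf)
    ; in-⊠          = palindromic-⊠
    ; in-quotient   = palindromic-quotient
    }

-- Classification of the monic irreducible polynomials.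

module Classification (F : Field) (q : ℕ) (card : HasCard F q) (S⁻ S⁺ : ℕ → ℕ)
  (count⁻ : ∀ d → 1 ≤ d → CountsClasses (Poly.SRIMminusSet F d) _≡_ (S⁻ d))
  (count⁺ : ∀ d → 1 ≤ d → CountsClasses (Poly.SRIMplusSet F d) (Poly.SamePair F d) (S⁺ d)) where

  open import Data.Fin using (zero; suc)
  open PolynomialRing F q card
  open Families F q card using (monic-≈; monic-⊠)
  open Series K
  open K using (_*_; -_; 0#; 1#)
  open Field F using (Carrier; _⁻¹; ⁻¹-inv)
  open Poly F using (SRIMminusSet; SRIMplusSet; SamePair)
  open import Algebra.Properties.Ring K.ring using (-‿involutive; -‿injective; -‿distribˡ-*)
  module KL = RingLemmas K

  -- The solutions of c² = 1, kept as a list: two of them, or one in characteristic 2, and no case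
  -- distinction is made.
  square-roots : List Carrier
  square-roots = filter (λ c → (c * c) ≟ 1#) elements

  root : Fin (length square-roots) → Carrier
  root = List.lookup square-roots

  root² : ∀ i → root i * root i ≡ 1#
  root² i = proj₂ (∈-filter⁻ (λ c → (c * c) ≟ 1#) {xs = elements} (∈-lookup i))

  unique-lookup : ∀ {A : Set} {xs : List A} → Unique xs → ∀ {i j} → List.lookup xs i ≡ List.lookup xs j → i ≡ j
  unique-lookup (_ ∷ _)  {zero}  {zero}  eq = refl
  unique-lookup (x∉ ∷ _) {zero}  {suc j} eq = ⊥-elim (All.lookup x∉ (∈-lookup j) eq)
  unique-lookup (x∉ ∷ _) {suc i} {zero}  eq = ⊥-elim (All.lookup x∉ (∈-lookup i) (sym eq))
  unique-lookup (_ ∷ u)  {suc i} {suc j} eq = cong suc (unique-lookup u eq)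

  root-injective : ∀ {i j} → root i ≡ root j → i ≡ j
  root-injective = unique-lookup (Uniqueₚ.filter⁺ _ elements-unique)

  root-surjective : ∀ c → c * c ≡ 1# → Σ (Fin (length square-roots)) λ i → c ≡ root i
  root-surjective c c²≡1 = Any.index c∈ , Anyₚ.lookup-index c∈
    where c∈ = ∈-filter⁺ (λ c → (c * c) ≟ 1#) (∈-elements c) c²≡1

  root≢0 : ∀ {c} → c * c ≡ 1# → c ≢ 0#
  root≢0 c²≡1 refl = 1≢0 (trans (sym c²≡1) (K.zeroˡ 0#))

  -square : ∀ {c} → c * c ≡ 1# → (- c) * (- c) ≡ 1#
  -square {c} c²≡1 = trans (KL.-‿square c) c²≡1

  ⟨⟩⟨⟩ : ∀ a b → ⟨ a ⟩ ⊠ ⟨ b ⟩ ≈ ⟨ a * b ⟩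
  ⟨⟩⟨⟩ a b .at zero    = refl
  ⟨⟩⟨⟩ a b .at (suc k) = trans (⟨⟩-⊠ a ⟨ b ⟩ (suc k)) (K.zeroʳ a)

  rev-lin : ∀ {c} → c * c ≡ 1# → rev 1 (lin c) ≈ ⟨ - c ⟩ ⊠ lin c
  rev-lin {c} c²≡1 .at zero = trans (lead≡1 (monic-lin c)) (sym (trans (cong (- c *_) (lin-0 c)) (-square c²≡1)))
  rev-lin {c} c²≡1 .at (suc zero) = trans (lin-0 c) (sym (trans (⟨⟩-⊠ (- c) (lin c) 1) (trans (cong (- c *_) (lead≡1 (monic-lin c))) (K.*-identityʳ (- c)))))
  rev-lin {c} c²≡1 .at (suc (suc k)) = sym (trans (⟨⟩-⊠ (- c) (lin c) (suc (suc k)))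
    (trans (cong (- c *_) (vanish (monic-lin c) (suc (suc k)) (s≤s (s≤s z≤n)))) (K.zeroʳ (- c))))

  lin-injective : ∀ {c d} → lin c ≈ lin d → c ≡ d
  lin-injective {c} {d} eq = -‿injective (trans (sym (lin-0 c)) (trans (at eq 0) (lin-0 d)))

  -- Since 1/c = c and the degree 2k+1 is odd, evaluating at c gives c h(c) = -c h(c), which is
  -- empty in characteristic 2. The equation is read instead as a relation between opposite
  -- coefficients.
  lin-∣-rev : ∀ {c} → c * c ≡ 1# → ∀ k h → Bound (suc (suc k ℕ.+ k)) (co h) → rev (suc k ℕ.+ k) h ≈ ⟨ - c ⟩ ⊠ h → lin c ∣ h
  lin-∣-rev {c} c²≡1 k h b eq = lin-∣-antireciprocal c²≡1 k h (subst (λ n → Bound n (co h)) (sym (ℕₚ.+-suc (suc k) k)) b) λ j j≤k → begin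
    co h (suc k ℕ.+ j)                                   ≡⟨ cong (λ i → co h (suc k ℕ.+ i)) (ℕₚ.m∸[m∸n]≡n j≤k) ⟨
    co h (suc k ℕ.+ (k ∸ (k ∸ j)))                       ≡⟨ cong (co h) (ℕₚ.+-∸-assoc (suc k) (ℕₚ.m∸n≤m k j)) ⟨
    co h ((suc k ℕ.+ k) ∸ (k ∸ j))                       ≡⟨ reverse-≤ (co h) (ℕₚ.≤-trans (ℕₚ.m∸n≤m k j) (ℕₚ.m≤n+m k (suc k))) ⟨
    reverse (suc k ℕ.+ k) (co h) (k ∸ j)                 ≡⟨ at eq (k ∸ j) ⟩
    co (⟨ - c ⟩ ⊠ h) (k ∸ j)                             ≡⟨ ⟨⟩-⊠ (- c) h (k ∸ j) ⟩
    - c * co h (k ∸ j)                                   ≡⟨ -‿distribˡ-* c (co h (k ∸ j)) ⟨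
    - (c * co h (k ∸ j))                                 ∎
    where open ≡-Reasoning

  parity : ∀ n → Σ ℕ λ m → n ≡ m ℕ.+ m ⊎ n ≡ suc m ℕ.+ m
  parity zero = 0 , inj₁ refl
  parity (suc n) with parity n
  ... | m , inj₁ refl = m , inj₂ refl
  ... | m , inj₂ refl = suc m , inj₁ (cong suc (sym (ℕₚ.+-suc m m)))

  1≢m+m : ∀ m → 1 ≢ m ℕ.+ m
  1≢m+m (suc m) eq = ℕₚ.0≢1+n (trans (ℕₚ.suc-injective eq) (ℕₚ.+-suc m m))

  m+m-injective : ∀ {m n} → m ℕ.+ m ≡ n ℕ.+ n → m ≡ n
  m+m-injective {m} {n} eq with ℕₚ.<-cmp m n
  ... | tri< m<n _ _ = ⊥-elim (ℕₚ.<-irrefl eq (ℕₚ.+-mono-< m<n m<n))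
  ... | tri≈ _ m≡n _ = m≡n
  ... | tri> _ _ n<m = ⊥-elim (ℕₚ.<-irrefl (sym eq) (ℕₚ.+-mono-< n<m n<m))

  ≈? : ∀ f g → Dec (f ≈ g)
  ≈? f g with degree? (f ⊟ g)
  ... | inj₁ z       = yes (x∙y⁻¹≈ε⇒x≈y f g z)
    where open import Algebra.Properties.Group P.+-group using (x∙y⁻¹≈ε⇒x≈y)
  ... | inj₂ (_ , d) = no λ f≈g → degree-≉0 d (P.trans (⊞-congʳ f≈g) (P.-‿inverseʳ g))

  irr-≈ : ∀ {n p r} → p ≈ r → Irr n p → Irr n r
  irr-≈ eq irr = mkIrr (monic-≈ eq (monic irr)) (positive irr) λ dg g∣r → divisors irr dg (∣-resp (P.sym eq) g∣r)

  irr-lin : ∀ c → Irr 1 (lin c)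
  irr-lin c = irr-linear (monic-lin c)

  irr-var : Irr 1 var
  irr-var = irr-linear (mkMonic refl (bound var))

  rev-scaled⇒star : ∀ {n p} → co p 0 ≢ 0# → rev n p ≈ ⟨ co p 0 ⟩ ⊠ p → star n p ≈ p
  rev-scaled⇒star {n} {p} nz eq = P.trans (star-rev n p) (P.trans (⊠-congˡ eq) (⟨⟩-cancel (co p 0) p nz))

  module SelfConjugate {n p} (irr : Irr n p) (nz : co p 0 ≢ 0#) (self : star n p ≈ p) where

    private a = co p 0

    a²≡1 : a * a ≡ 1#
    a²≡1 = trans (cong (a *_) (trans (sym (at self 0)) (star-0 (monic irr)))) (⁻¹-inv a nz)

    rev≈ : rev n p ≈ ⟨ a ⟩ ⊠ p
    rev≈ .at k = begin
      reverse n (co p) k                       ≡⟨ K.*-identityʳ _ ⟨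
      reverse n (co p) k * 1#                  ≡⟨ cong (reverse n (co p) k *_) (trans (K.*-comm _ _) (⁻¹-inv a nz)) ⟨
      reverse n (co p) k * (a ⁻¹ * a)          ≡⟨ K.*-assoc _ _ _ ⟨
      co (star n p) k * a                      ≡⟨ cong (_* a) (at self k) ⟩
      co p k * a                               ≡⟨ K.*-comm _ _ ⟩
      a * co p k                               ≡⟨ ⟨⟩-⊠ a p k ⟨
      co (⟨ a ⟩ ⊠ p) k                         ∎
      where open ≡-Reasoning

    -- With c = -a the equation "reversal of p = a p" is the one required by `lin-∣-rev`, so x + a
    -- divides the irreducible `p` and equals it.
    odd⇒linear : ∀ {k} → n ≡ suc k ℕ.+ k → Σ Carrier λ c → c * c ≡ 1# × p ≈ lin c
    odd⇒linear {k} refl = - a , -square a²≡1 , P.sym (irr-∣-irr (irr-lin (- a)) irr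
      (lin-∣-rev (-square a²≡1) k p (vanish (monic irr)) (subst (λ b → rev n p ≈ ⟨ b ⟩ ⊠ p) (sym (-‿involutive a)) rev≈)))

    -- If a ≠ 1 then (x − 1) p is anti-reciprocal of odd degree, so x − a divides it, hence divides p.
    even⇒a≡1 : ∀ {m} → n ≡ m ℕ.+ m → a ≡ 1#
    even⇒a≡1 {m} refl with a ≟ 1#
    ... | yes a≡1 = a≡1
    ... | no  a≢1 with euclid (irr-lin a) (lin 1#) p (lin-∣-rev a²≡1 m (lin 1# ⊠ p)
          (vanish (monic-⊠ (monic-lin 1#) (monic irr))) (begin
        rev (1 ℕ.+ n) (lin 1# ⊠ p)                      ≈⟨ rev-⊠ (hasDegree (monic-lin 1#)) (hasDegree (monic irr)) ⟩
        rev 1 (lin 1#) ⊠ rev n p                        ≈⟨ P.*-cong (rev-lin (K.*-identityˡ 1#)) rev≈ ⟩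
        (⟨ - 1# ⟩ ⊠ lin 1#) ⊠ (⟨ a ⟩ ⊠ p)               ≈⟨ PL.*-medial ⟨ - 1# ⟩ (lin 1#) ⟨ a ⟩ p ⟩
        (⟨ - 1# ⟩ ⊠ ⟨ a ⟩) ⊠ (lin 1# ⊠ p)               ≈⟨ ⊠-congʳ (P.trans (⟨⟩⟨⟩ (- 1#) a) (P.reflexive (cong ⟨_⟩ (-1*x≈-x a)))) ⟩
        ⟨ - a ⟩ ⊠ (lin 1# ⊠ p)                          ∎))
      where
      open P-Reasoning
      open import Algebra.Properties.Ring K.ring using (-1*x≈-x)
    ...   | inj₁ a∣1 = ⊥-elim (a≢1 (lin-injective (irr-∣-irr (irr-lin a) (irr-lin 1#) a∣1)))
    ...   | inj₂ a∣p = ⊥-elim (1≢m+m m (monic-degree (monic-lin a) (monic-≈ (P.sym (irr-∣-irr (irr-lin a) irr a∣p)) (monic irr))))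

  -- A representative of class `i`, supplied by surjectivity of the class map. The counts are given
  -- from 1 on, so `d` stands for half-degree `suc d`, here and for `Plus`.
  module Minus d (i : Fin (S⁻ (suc d))) where
    private rep = proj₂ (proj₂ (proj₂ (count⁻ (suc d) (s≤s z≤n)))) i
    vec : Vec Carrier (suc d ℕ.+ suc d)
    vec = proj₁ rep
    member : SRIMminusSet (suc d) vec
    member = proj₁ (proj₂ rep)
    class : proj₁ (count⁻ (suc d) (s≤s z≤n)) vec member ≡ i
    class = proj₂ (proj₂ rep)
    irr : Irr (suc d ℕ.+ suc d) ⌊ vec ⌋
    irr = irreducible⇒irr vec (proj₁ (proj₂ member))
    rev≈ : rev (suc d ℕ.+ suc d) ⌊ vec ⌋ ≈ ⌊ vec ⌋
    rev≈ = mk≈ (proj₂ (proj₂ member))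
    head≡1 : co ⌊ vec ⌋ 0 ≡ 1#
    head≡1 = trans (sym (at rev≈ 0)) (trans (reverse-≤ {suc d ℕ.+ suc d} (co ⌊ vec ⌋) z≤n) (coeff-≡ vec))
    self : star (suc d ℕ.+ suc d) ⌊ vec ⌋ ≈ ⌊ vec ⌋
    self = rev-scaled⇒star (proj₁ member) (P.trans rev≈ (P.sym (P.trans (⊠-congʳ (P.reflexive (cong ⟨_⟩ head≡1))) (P.*-identityˡ ⌊ vec ⌋))))

  module Plus d (i : Fin (S⁺ (suc d))) where
    private rep = proj₂ (proj₂ (proj₂ (count⁺ (suc d) (s≤s z≤n)))) i
    vec : Vec Carrier (suc d)
    vec = proj₁ rep
    member : SRIMplusSet (suc d) vec
    member = proj₁ (proj₂ rep)
    class : proj₁ (count⁺ (suc d) (s≤s z≤n)) vec member ≡ i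
    class = proj₂ (proj₂ rep)
    head≢0 : co ⌊ vec ⌋ 0 ≢ 0#
    head≢0 = proj₁ member
    irr : Irr (suc d) ⌊ vec ⌋
    irr = irreducible⇒irr vec (proj₁ (proj₂ member))
    irr* : Irr (suc d) (star (suc d) ⌊ vec ⌋)
    irr* = irr-star irr head≢0
    distinct : ¬ ⌊ vec ⌋ ≈ star (suc d) ⌊ vec ⌋
    distinct eq = proj₂ (proj₂ member) (at eq)

  minus-class : ∀ {d} {i j : Fin (S⁻ (suc d))} → Minus.vec d i ≡ Minus.vec d j → i ≡ j
  minus-class {d} {i} {j} eq = trans (sym (Minus.class d i)) (trans
    (proj₁ (proj₂ (proj₂ (count⁻ (suc d) (s≤s z≤n)))) _ _ (Minus.member d i) (Minus.member d j) eq) (Minus.class d j))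

  plus-class : ∀ {d} {i j : Fin (S⁺ (suc d))} → SamePair (suc d) (Plus.vec d i) (Plus.vec d j) → i ≡ j
  plus-class {d} {i} {j} same = trans (sym (Plus.class d i)) (trans
    (proj₁ (proj₂ (proj₂ (count⁺ (suc d) (s≤s z≤n)))) _ _ (Plus.member d i) (Plus.member d j) same) (Plus.class d j))

  -- Names for all monic irreducibles: `ram` for the x - c with c² = 1, `plus` for the chosen member
  -- of each reciprocal pair and `plus*` for the other one. `poly-injective` excludes repetitions
  -- and `classify` omissions.
  data Index : Set where
    x            : Index
    ram          : Fin (length square-roots) → Index
    minus        : Σ ℕ (λ d → Fin (S⁻ (suc d))) → Index
    plus plus*   : Σ ℕ (λ d → Fin (S⁺ (suc d))) → Index

  deg : Index → ℕ
  deg x               = 1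
  deg (ram i)         = 1
  deg (minus (d , i)) = suc d ℕ.+ suc d
  deg (plus (d , i))  = suc d
  deg (plus* (d , i)) = suc d

  poly : Index → Pol
  poly x               = var
  poly (ram i)         = lin (root i)
  poly (minus (d , i)) = ⌊ Minus.vec d i ⌋
  poly (plus (d , i))  = ⌊ Plus.vec d i ⌋
  poly (plus* (d , i)) = star (suc d) ⌊ Plus.vec d i ⌋

  poly-irr : ∀ i → Irr (deg i) (poly i)
  poly-irr x               = irr-var
  poly-irr (ram i)         = irr-lin (root i)
  poly-irr (minus (d , i)) = Minus.irr d i
  poly-irr (plus (d , i))  = Plus.irr d i
  poly-irr (plus* (d , i)) = Plus.irr* d i

  data Conjugate : Index → Set where
    self⁰ : ∀ {i} → Conjugate (ram i)
    self⁻ : ∀ {di} → Conjugate (minus di)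

  conjugate-self : ∀ {i} → Conjugate i → star (deg i) (poly i) ≈ poly i
  conjugate-self {ram i} self⁰ = rev-scaled⇒star (λ z → root≢0 (-square (root² i)) (trans (sym (lin-0 (root i))) z))
    (P.trans (rev-lin (root² i)) (⊠-congʳ (P.reflexive (cong ⟨_⟩ (sym (lin-0 (root i)))))))
  conjugate-self {minus (d , i)} self⁻ = Minus.self d i

  data Paired : Index → Set where
    pair⁺ : ∀ {di} → Paired (plus di)
    pair* : ∀ {di} → Paired (plus* di)

  paired-not-self : ∀ {i} → Paired i → ¬ star (deg i) (poly i) ≈ poly i
  paired-not-self {plus (d , i)} pair⁺ eq = Plus.distinct d i (P.sym eq)
  paired-not-self {plus* (d , i)} pair* eq = Plus.distinct d i (P.trans (P.sym (star-involutive (monic (Plus.irr d i)) (Plus.head≢0 d i))) eq)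

  poly-head : ∀ {i} → Conjugate i ⊎ Paired i → co (poly i) 0 ≢ 0#
  poly-head {ram i} (inj₁ self⁰) z = root≢0 (-square (root² i)) (trans (sym (lin-0 (root i))) z)
  poly-head {minus (d , i)} (inj₁ self⁻) = proj₁ (Minus.member d i)
  poly-head {plus (d , i)} (inj₂ pair⁺) = Plus.head≢0 d i
  poly-head {plus* (d , i)} (inj₂ pair*) = star-0≢0 (monic (Plus.irr d i)) (Plus.head≢0 d i)

  same-degree : ∀ i j → poly i ≈ poly j → deg i ≡ deg j
  same-degree i j eq = monic-degree (monic-≈ eq (monic (poly-irr i))) (monic (poly-irr j))

  self≉paired : ∀ {i j} → Conjugate i → Paired j → ¬ poly i ≈ poly j
  self≉paired {i} {j} ci pj eq = paired-not-self pj (P.trans (star-cong (deg j) (P.sym eq))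
    (P.trans (P.reflexive (cong (λ n → star n (poly i)) (sym (same-degree i j eq)))) (P.trans (conjugate-self ci) eq)))

  x≉ : ∀ {j} → Conjugate j ⊎ Paired j → ¬ var ≈ poly j
  x≉ cj eq = poly-head cj (sym (at eq 0))

  minus-injective : ∀ {di ej} → poly (minus di) ≈ poly (minus ej) → di ≡ ej
  minus-injective {d , i} {e , j} eq with m+m-injective {suc d} {suc e} (same-degree (minus (d , i)) (minus (e , j)) eq)
  ... | refl = cong (d ,_) (minus-class (⌊⌋-injective eq))

  plus-injective : ∀ {di ej} → poly (plus di) ≈ poly (plus ej) → di ≡ ej
  plus-injective {d , i} {e , j} eq with same-degree (plus (d , i)) (plus (e , j)) eq
  ... | refl = cong (d ,_) (plus-class (inj₁ (sym (⌊⌋-injective eq))))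

  -- An equality would put both representatives in one reciprocal pair, hence i = j; but then f =
  -- f*/f(0), which membership excludes.
  plus≉plus* : ∀ {di ej} → ¬ poly (plus di) ≈ poly (plus* ej)
  plus≉plus* {d , i} {e , j} eq with same-degree (plus (d , i)) (plus* (e , j)) eq
  ... | refl with plus-class {d} {j} {i} (inj₂ (at eq))
  ... | refl = Plus.distinct d i eq

  plus*-injective : ∀ {di ej} → poly (plus* di) ≈ poly (plus* ej) → di ≡ ej
  plus*-injective {d , i} {e , j} eq with same-degree (plus* (d , i)) (plus* (e , j)) eq
  ... | refl = plus-injective (P.trans (P.sym (star-involutive (monic (Plus.irr d i)) (Plus.head≢0 d i)))
    (P.trans (star-cong (suc d) eq) (star-involutive (monic (Plus.irr d j)) (Plus.head≢0 d j))))

  ram≉minus : ∀ {i dj} → ¬ poly (ram i) ≈ poly (minus dj)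
  ram≉minus {i} {dj@(d , j)} eq = 1≢m+m (suc d) (same-degree (ram i) (minus dj) eq)

  poly-injective : ∀ i j → poly i ≈ poly j → i ≡ j
  poly-injective x         x         eq = refl
  poly-injective (ram i)   (ram j)   eq = cong ram (root-injective (lin-injective eq))
  poly-injective (minus _) (minus _) eq = cong minus (minus-injective eq)
  poly-injective (plus _)  (plus _)  eq = cong plus (plus-injective eq)
  poly-injective (plus* _) (plus* _) eq = cong plus* (plus*-injective eq)
  poly-injective x         (ram _)   eq = ⊥-elim (x≉ (inj₁ self⁰) eq)
  poly-injective x         (minus _) eq = ⊥-elim (x≉ (inj₁ self⁻) eq)
  poly-injective x         (plus _)  eq = ⊥-elim (x≉ (inj₂ pair⁺) eq)
  poly-injective x         (plus* _) eq = ⊥-elim (x≉ (inj₂ pair*) eq)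
  poly-injective (ram _)   x         eq = ⊥-elim (x≉ (inj₁ self⁰) (P.sym eq))
  poly-injective (minus _) x         eq = ⊥-elim (x≉ (inj₁ self⁻) (P.sym eq))
  poly-injective (plus _)  x         eq = ⊥-elim (x≉ (inj₂ pair⁺) (P.sym eq))
  poly-injective (plus* _) x         eq = ⊥-elim (x≉ (inj₂ pair*) (P.sym eq))
  poly-injective (ram _)   (minus _) eq = ⊥-elim (ram≉minus eq)
  poly-injective (minus _) (ram _)   eq = ⊥-elim (ram≉minus (P.sym eq))
  poly-injective (ram _)   (plus _)  eq = ⊥-elim (self≉paired self⁰ pair⁺ eq)
  poly-injective (ram _)   (plus* _) eq = ⊥-elim (self≉paired self⁰ pair* eq)
  poly-injective (minus _) (plus _)  eq = ⊥-elim (self≉paired self⁻ pair⁺ eq)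
  poly-injective (minus _) (plus* _) eq = ⊥-elim (self≉paired self⁻ pair* eq)
  poly-injective (plus _)  (ram _)   eq = ⊥-elim (self≉paired self⁰ pair⁺ (P.sym eq))
  poly-injective (plus* _) (ram _)   eq = ⊥-elim (self≉paired self⁰ pair* (P.sym eq))
  poly-injective (plus _)  (minus _) eq = ⊥-elim (self≉paired self⁻ pair⁺ (P.sym eq))
  poly-injective (plus* _) (minus _) eq = ⊥-elim (self≉paired self⁻ pair* (P.sym eq))
  poly-injective (plus _)  (plus* _) eq = ⊥-elim (plus≉plus* eq)
  poly-injective (plus* _) (plus _)  eq = ⊥-elim (plus≉plus* (P.sym eq))

  classify-minus : ∀ {d p} → Irr (suc d ℕ.+ suc d) p → co p 0 ≢ 0# → rev (suc d ℕ.+ suc d) p ≈ p → Σ Index λ i → p ≈ poly i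
  classify-minus {d} {p} irr nz rev≈p = minus (d , i) , P.trans (P.sym v≈p) (P.reflexive (cong ⌊_⌋ (sym w≡v)))
    where
    v = lower (suc d ℕ.+ suc d) (co p)
    v≈p : ⌊ v ⌋ ≈ p
    v≈p = ⌊lower⌋ (monic irr)
    member : SRIMminusSet (suc d) v
    member = (λ z → nz (trans (sym (at v≈p 0)) z)) , irr⇒irreducible v (irr-≈ (P.sym v≈p) irr)
      , at (P.trans (rev-cong (suc d ℕ.+ suc d) v≈p) (P.trans rev≈p (P.sym v≈p)))
    i = proj₁ (count⁻ (suc d) (s≤s z≤n)) v member
    w≡v : Minus.vec d i ≡ v
    w≡v = proj₁ (proj₂ (count⁻ (suc d) (s≤s z≤n))) _ _ (Minus.member d i) member (Minus.class d i)

  classify-plus : ∀ {d p} → Irr (suc d) p → co p 0 ≢ 0# → ¬ star (suc d) p ≈ p → Σ Index λ i → p ≈ poly i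
  classify-plus {d} {p} irr nz ¬self = found (proj₁ (proj₂ (count⁺ (suc d) (s≤s z≤n))) _ _ (Plus.member d i) member (Plus.class d i))
    where
    v = lower (suc d) (co p)
    v≈p : ⌊ v ⌋ ≈ p
    v≈p = ⌊lower⌋ (monic irr)
    member : SRIMplusSet (suc d) v
    member = (λ z → nz (trans (sym (at v≈p 0)) z)) , irr⇒irreducible v (irr-≈ (P.sym v≈p) irr)
      , λ eq → ¬self (P.trans (star-cong (suc d) (P.sym v≈p)) (P.trans (P.sym (mk≈ {f = ⌊ v ⌋} {g = star (suc d) ⌊ v ⌋} eq)) v≈p))
    i = proj₁ (count⁺ (suc d) (s≤s z≤n)) v member
    found : SamePair (suc d) (Plus.vec d i) v → Σ Index λ i → p ≈ poly i
    found (inj₁ v≡w) = plus (d , i) , P.trans (P.sym v≈p) (P.reflexive (cong ⌊_⌋ v≡w))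
    found (inj₂ eq)  = plus* (d , i) , P.trans (P.sym v≈p) (mk≈ eq)

  classify-self : ∀ {n p} → Irr n p → co p 0 ≢ 0# → star n p ≈ p → Σ Index λ i → p ≈ poly i
  classify-self {n} {p} irr nz self with parity n
  ... | k , inj₂ n≡ with SelfConjugate.odd⇒linear irr nz self {k} n≡
  ...   | c , c²≡1 , p≈lin with root-surjective c c²≡1
  ...     | i , c≡ = ram i , P.trans p≈lin (P.reflexive (cong lin c≡))
  classify-self irr nz self | zero , inj₁ refl = ⊥-elim (ℕₚ.<-irrefl refl (positive irr))
  classify-self {p = p} irr nz self | suc d , inj₁ refl = classify-minus {d} irr nz (P.trans rev≈
      (P.trans (⊠-congʳ (P.reflexive (cong ⟨_⟩ (even⇒a≡1 {suc d} refl)))) (P.*-identityˡ p)))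
    where open SelfConjugate irr nz self

  -- A zero constant term makes x a divisor. Otherwise `p` either differs from its reciprocal and
  -- lies in a pair, or is fixed; then odd degree forces x - c, and even degree forces constant term
  -- 1, hence genuine self-reciprocity.
  classify : ∀ {n p} → Irr n p → Σ Index λ i → p ≈ poly i
  classify {n} {p} irr with co p 0 ≟ 0#
  ... | yes z = x , P.sym (irr-∣-irr irr-var irr (tailP p , P.sym (P.trans (head-tail p)
        (P.trans (⊞-congʳ {g = var ⊠ tailP p} (mk≈ λ { zero → z ; (suc k) → refl })) (P.+-identityˡ _)))))
  ... | no nz with ≈? (star n p) p
  ...   | yes self = classify-self irr nz self
  classify {zero}  irr | no nz | no ¬self = ⊥-elim (ℕₚ.<-irrefl refl (positive irr))
  classify {suc d} irr | no nz | no ¬self = classify-plus irr nz ¬self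

-- Palindromic primes and the Euler products of both families.

module EulerProducts (F : Field) (q : ℕ) (card : HasCard F q) (S⁻ S⁺ : ℕ → ℕ)
  (count⁻ : ∀ d → 1 ≤ d → CountsClasses (Poly.SRIMminusSet F d) _≡_ (S⁻ d))
  (count⁺ : ∀ d → 1 ≤ d → CountsClasses (Poly.SRIMplusSet F d) (Poly.SamePair F d) (S⁺ d)) where

  open PolynomialRing F q card
  open Families F q card
  open Classification F q card S⁻ S⁺ count⁻ count⁺
  open K using (_*_; -_; 0#; 1#)
  open Field F using (Carrier; _⁻¹)
  open PartitionSeries using (ℚring; 1-x; 1-x^_; 1+_·x^_; _^^_; powProd; Truncated)
  open Series ℚring hiding (x^-⊗)

  data PalIndex : Set where
    ramᴾ   : Fin (length square-roots) → PalIndex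
    minusᴾ : Σ ℕ (λ d → Fin (S⁻ (suc d))) → PalIndex
    plusᴾ  : Σ ℕ (λ d → Fin (S⁺ (suc d))) → PalIndex

  first second : PalIndex → Index
  first (ramᴾ i)    = ram i
  first (minusᴾ di) = minus di
  first (plusᴾ di)  = plus di
  second (ramᴾ i)    = ram i
  second (minusᴾ di) = minus di
  second (plusᴾ di)  = plus* di

  -- The palindromic prime in which an irreducible occurs. Distinct palindromic primes share no
  -- irreducible factor because owners are unique; x occurs in none.
  owner : Index → Maybe PalIndex
  owner x          = nothing
  owner (ram i)    = just (ramᴾ i)
  owner (minus di) = just (minusᴾ di)
  owner (plus di)  = just (plusᴾ di)
  owner (plus* di) = just (plusᴾ di)

  owner-first : ∀ j → owner (first j) ≡ just j
  owner-first (ramᴾ i)    = refl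
  owner-first (minusᴾ di) = refl
  owner-first (plusᴾ di)  = refl

  owner-second : ∀ j → owner (second j) ≡ just j
  owner-second (ramᴾ i)    = refl
  owner-second (minusᴾ di) = refl
  owner-second (plusᴾ di)  = refl

  -- Half the polynomial degree, the grade of the palindromic family.
  palDeg : PalIndex → ℕ
  palDeg (ramᴾ i)         = 1
  palDeg (minusᴾ (d , i)) = suc d
  palDeg (plusᴾ (d , i))  = suc d

  palPoly : PalIndex → Pol
  palPoly (ramᴾ i)    = poly (ram i) ⊠ poly (ram i)
  palPoly (minusᴾ di) = poly (minus di)
  palPoly (plusᴾ di)  = poly (plus di) ⊠ poly (plus* di)

  palindromic-square : ∀ {c} → c * c ≡ 1# → Palindromic 1 (lin c ⊠ lin c)
  palindromic-square {c} c²≡1 = mkPal (monic-⊠ (monic-lin c) (monic-lin c)) (begin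
    rev 2 (lin c ⊠ lin c)                        ≈⟨ rev-⊠ (hasDegree (monic-lin c)) (hasDegree (monic-lin c)) ⟩
    rev 1 (lin c) ⊠ rev 1 (lin c)                ≈⟨ P.*-cong (rev-lin c²≡1) (rev-lin c²≡1) ⟩
    (⟨ - c ⟩ ⊠ lin c) ⊠ (⟨ - c ⟩ ⊠ lin c)        ≈⟨ PL.*-medial ⟨ - c ⟩ (lin c) ⟨ - c ⟩ (lin c) ⟩
    (⟨ - c ⟩ ⊠ ⟨ - c ⟩) ⊠ (lin c ⊠ lin c)        ≈⟨ ⊠-congʳ (P.trans (⟨⟩⟨⟩ (- c) (- c)) (P.reflexive (cong ⟨_⟩ (-square c²≡1)))) ⟩
    ⟨ 1# ⟩ ⊠ (lin c ⊠ lin c)                     ≈⟨ P.*-identityˡ (lin c ⊠ lin c) ⟩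
    lin c ⊠ lin c                                ∎)
    where open P-Reasoning

  palindromic-pair : ∀ {n p} → Monic n p → co p 0 ≢ 0# → Palindromic n (p ⊠ star n p)
  palindromic-pair {n} {p} mp nz = mkPal (monic-⊠ mp (monic-star nz)) (begin
    rev (n ℕ.+ n) (p ⊠ star n p)                 ≈⟨ rev-⊠ (hasDegree mp) (hasDegree (monic-star nz)) ⟩
    rev n p ⊠ rev n (star n p)                   ≈⟨ ⊠-congˡ (rev-star mp) ⟩
    rev n p ⊠ (⟨ (co p 0) ⁻¹ ⟩ ⊠ p)              ≈⟨ PL.*-cross (rev n p) ⟨ (co p 0) ⁻¹ ⟩ p ⟩
    p ⊠ (⟨ (co p 0) ⁻¹ ⟩ ⊠ rev n p)              ≈⟨ ⊠-congˡ (star-rev n p) ⟨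
    p ⊠ star n p                                 ∎)
    where open P-Reasoning

  palPoly-palindromic : ∀ j → Palindromic (palDeg j) (palPoly j)
  palPoly-palindromic (ramᴾ i)         = palindromic-square (root² i)
  palPoly-palindromic (minusᴾ (d , i)) = mkPal (monic (Minus.irr d i)) (Minus.rev≈ d i)
  palPoly-palindromic (plusᴾ (d , i))  = palindromic-pair (monic (Plus.irr d i)) (Plus.head≢0 d i)

  poly-coprime : ∀ {i j} → i ≢ j → Coprime (poly i) (poly j)
  poly-coprime {i} {j} i≢j = irr-coprime (poly-irr i) (poly-irr j) (i≢j ∘ poly-injective i j)

  poly-palPoly-coprime : ∀ a j → a ≢ first j → a ≢ second j → Coprime (poly a) (palPoly j)
  poly-palPoly-coprime a (ramᴾ i)    p q = coprime-⊠ʳ (poly-coprime p) (poly-coprime q)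
  poly-palPoly-coprime a (minusᴾ di) p q = poly-coprime p
  poly-palPoly-coprime a (plusᴾ di)  p q = coprime-⊠ʳ (poly-coprime p) (poly-coprime q)

  owner-coprime : ∀ {i j} a → i ≢ j → owner a ≡ just i → Coprime (poly a) (palPoly j)
  owner-coprime {i} {j} a i≢j own = poly-palPoly-coprime a j
    (λ a≡ → i≢j (just-injective (trans (sym own) (trans (cong owner a≡) (owner-first j)))))
    (λ a≡ → i≢j (just-injective (trans (sym own) (trans (cong owner a≡) (owner-second j)))))

  palPoly-coprime : ∀ i j → i ≢ j → Coprime (palPoly i) (palPoly j)
  palPoly-coprime (ramᴾ i)    j i≢j = coprime-⊠ˡ (hasDegree (monic (poly-irr (ram i)))) (owner-coprime (ram i) i≢j refl) (owner-coprime (ram i) i≢j refl)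
  palPoly-coprime (minusᴾ di) j i≢j = owner-coprime (minus di) i≢j refl
  palPoly-coprime (plusᴾ di)  j i≢j = coprime-⊠ˡ (hasDegree (monic (poly-irr (plus di)))) (owner-coprime (plus di) i≢j refl) (owner-coprime (plus* di) i≢j refl)

  module _ {n f} (pf : Palindromic (suc n) f) where
    private
      df : HasDegree (suc n ℕ.+ suc n) f
      df = hasDegree (pal-monic pf)

      head≢0 : co f 0 ≢ 0#
      head≢0 z = 1≢0 (trans (sym (lead≡1 (pal-monic pf))) (trans (sym (reverse-≤ {suc n ℕ.+ suc n} (co f) z≤n)) (trans (at (pal-rev pf) 0) z)))

    star-∣-palindromic : ∀ {m p} → Monic m p → p ∣ f → star m p ∣ f
    star-∣-palindromic {m} {p} mp p∣f = ∣-≈ (P.sym (star-rev m p)) P.refl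
      (⟨⁻¹⟩-⊠-∣ (head-∣ p∣f head≢0) (∣-resp (pal-rev pf) (rev-∣ (hasDegree mp) df p∣f)))

    -- Write f = (x - c) h. Reversing and cancelling x - c gives reversal -c h for `h`, whose degree
    -- 2n+1 is odd, so `lin-∣-rev` finds a second factor.
    lin²-∣-palindromic : ∀ {c} → c * c ≡ 1# → lin c ∣ f → lin c ⊠ lin c ∣ f
    lin²-∣-palindromic {c} c²≡1 (h , eq) = quotient-∣ (monic-quotient (monic-lin c) (monic-≈ (P.sym eq) (pal-monic pf)))
      where
      quotient-∣ : (Σ ℕ λ m → suc n ℕ.+ suc n ≡ 1 ℕ.+ m × Monic m h) → lin c ⊠ lin c ∣ f
      quotient-∣ (m , 2n≡ , mh) with trans (sym (ℕₚ.+-suc n n)) (ℕₚ.suc-injective 2n≡)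
      ... | refl = lin²-∣ (lin-∣-rev c²≡1 n h (vanish mh) rev-h)
        where
        open P-Reasoning
        lin⊠rev : lin c ⊠ (⟨ - c ⟩ ⊠ rev m h) ≈ lin c ⊠ h
        lin⊠rev = begin
          lin c ⊠ (⟨ - c ⟩ ⊠ rev m h)              ≈⟨ PL.*-swap (lin c) ⟨ - c ⟩ (rev m h) ⟩
          (⟨ - c ⟩ ⊠ lin c) ⊠ rev m h              ≈⟨ ⊠-congʳ (rev-lin c²≡1) ⟨
          rev 1 (lin c) ⊠ rev m h                  ≈⟨ rev-⊠ (hasDegree (monic-lin c)) (hasDegree mh) ⟨
          rev (1 ℕ.+ m) (lin c ⊠ h)                ≈⟨ rev-cong (1 ℕ.+ m) eq ⟩
          rev (1 ℕ.+ m) f                          ≡⟨ cong (λ k → rev k f) 2n≡ ⟨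
          rev (suc n ℕ.+ suc n) f                  ≈⟨ pal-rev pf ⟩
          f                                        ≈⟨ eq ⟨
          lin c ⊠ h                                ∎
        rev-h : rev m h ≈ ⟨ - c ⟩ ⊠ h
        rev-h = begin
          rev m h                                  ≈⟨ P.sym (P.*-identityˡ (rev m h)) ⟩
          ⟨ 1# ⟩ ⊠ rev m h                         ≈⟨ ⊠-congʳ (P.sym (P.trans (⟨⟩⟨⟩ (- c) (- c)) (P.reflexive (cong ⟨_⟩ (-square c²≡1))))) ⟩
          (⟨ - c ⟩ ⊠ ⟨ - c ⟩) ⊠ rev m h            ≈⟨ P.*-assoc ⟨ - c ⟩ ⟨ - c ⟩ (rev m h) ⟩
          ⟨ - c ⟩ ⊠ (⟨ - c ⟩ ⊠ rev m h)            ≈⟨ ⊠-congˡ (⊠-cancelˡ (hasDegree (monic-lin c)) lin⊠rev) ⟩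
          ⟨ - c ⟩ ⊠ h                              ∎
        lin²-∣ : lin c ∣ h → lin c ⊠ lin c ∣ f
        lin²-∣ (k , lk≈h) = k , P.trans (P.*-assoc (lin c) (lin c) k) (P.trans (⊠-congˡ lk≈h) eq)

    pair-∣ : ∀ di → poly (plus di) ∣ f → poly (plus* di) ∣ f → palPoly (plusᴾ di) ∣ f
    pair-∣ di = coprime-∣ (poly-coprime {plus* di} {plus di} λ ())

    -- Turns an irreducible divisor of a palindrome into a palindromic prime divisor. The index `x`
    -- is impossible because a monic palindrome has constant term 1; a member of a pair brings its
    -- partner along, and the two are coprime.
    palPoly-∣ : ∀ i → poly i ∣ f → Σ PalIndex λ j → palPoly j ∣ f
    palPoly-∣ x               d = ⊥-elim (head-∣ d head≢0 refl)
    palPoly-∣ (ram i)         d = ramᴾ i , lin²-∣-palindromic (root² i) d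
    palPoly-∣ (minus di)      d = minusᴾ di , d
    palPoly-∣ (plus (e , i))  d = plusᴾ (e , i) , pair-∣ (e , i) d (star-∣-palindromic (monic (Plus.irr e i)) d)
    palPoly-∣ (plus* (e , i)) d = plusᴾ (e , i) , pair-∣ (e , i)
      (∣-≈ (star-involutive (monic (Plus.irr e i)) (Plus.head≢0 e i)) P.refl (star-∣-palindromic (monic (Plus.irr* e i)) d)) d

  poly-∣ : ∀ {n f} → Monic n f → 0 < n → Σ Index λ i → poly i ∣ f
  poly-∣ {n} {f} mf 0<n with irreducible-factor n f mf 0<n
  ... | m , p , irr , p∣f with classify irr
  ... | i , p≈ = i , ∣-≈ p≈ P.refl p∣f

  -- An entry with first component d belongs to (half-)degree `suc d`, so the strict bound d < N
  -- means degree at most `N`.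
  pairsBelow : (f : ℕ → ℕ) → ℕ → List (Σ ℕ λ d → Fin (f d))
  pairsBelow f zero    = []
  pairsBelow f (suc N) = map (N ,_) (allFin (f N)) ++ pairsBelow f N

  pairsBelow-< : ∀ f N {d i} → (d , i) ∈ pairsBelow f N → d < N
  pairsBelow-< f (suc N) p with ∈-++⁻ (map (N ,_) (allFin (f N))) p
  ... | inj₂ q = ℕₚ.m≤n⇒m≤1+n (pairsBelow-< f N q)
  ... | inj₁ q with ∈-map⁻ (N ,_) q
  ... | _ , _ , refl = ℕₚ.≤-refl

  pairsBelow-unique : ∀ f N → Unique (pairsBelow f N)
  pairsBelow-unique f zero    = []
  pairsBelow-unique f (suc N) = Uniqueₚ.++⁺ (Uniqueₚ.map⁺ (λ { refl → refl }) (Uniqueₚ.allFin⁺ (f N))) (pairsBelow-unique f N) disjoint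
    where
    disjoint : ∀ {p} → p ∈ map (N ,_) (allFin (f N)) × p ∈ pairsBelow f N → ⊥
    disjoint (p∈ , p∈′) with ∈-map⁻ (N ,_) p∈
    ... | _ , _ , refl = ℕₚ.<-irrefl refl (pairsBelow-< f N p∈′)

  ∈-pairsBelow : ∀ f N {d} (i : Fin (f d)) → d < N → (d , i) ∈ pairsBelow f N
  ∈-pairsBelow f (suc N) {d} i (s≤s d≤N) with ℕₚ.m≤n⇒m<n∨m≡n d≤N
  ... | inj₁ d<N  = ∈-++⁺ʳ (map (N ,_) (allFin (f N))) (∈-pairsBelow f N i d<N)
  ... | inj₂ refl = ∈-++⁺ˡ (∈-map⁺ (N ,_) (∈-allFin i))

  map-disjoint : ∀ {A B C : Set} (f : A → C) (g : B → C) {as bs} → (∀ a b → f a ≢ g b) →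
                 ∀ {c} → c ∈ map f as × c ∈ map g bs → ⊥
  map-disjoint f g f≢g (p , q) with ∈-map⁻ f p | ∈-map⁻ g q
  ... | a , _ , refl | b , _ , eq = f≢g a b eq

  disjoint-++ : ∀ {A : Set} {as} (bs : List A) {cs} → (∀ {c} → c ∈ as × c ∈ bs → ⊥) → (∀ {c} → c ∈ as × c ∈ cs → ⊥) →
                ∀ {c} → c ∈ as × c ∈ bs ++ cs → ⊥
  disjoint-++ bs p q (c∈as , c∈) with ∈-++⁻ bs c∈
  ... | inj₁ c∈bs = p (c∈as , c∈bs)
  ... | inj₂ c∈cs = q (c∈as , c∈cs)

  gen : Index → S.Generator
  gen i = Family.generator monics (monic (poly-irr i))

  palGen : PalIndex → S.Generator
  palGen j = Family.generator palindromes (palPoly-palindromic j)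

  module _ (N : ℕ) where
    private
      roots  = allFin (length square-roots)
      pairs⁻ = pairsBelow (S⁻ ∘ suc) N
      pairs⁺ = pairsBelow (S⁺ ∘ suc) N

    palIndices : List PalIndex
    palIndices = map ramᴾ roots ++ (map minusᴾ pairs⁻ ++ map plusᴾ pairs⁺)

    palIndices-unique : Unique palIndices
    palIndices-unique =
      Uniqueₚ.++⁺ {xs = map ramᴾ roots} {ys = map minusᴾ pairs⁻ ++ map plusᴾ pairs⁺}
        (Uniqueₚ.map⁺ (λ { refl → refl }) (Uniqueₚ.allFin⁺ (length square-roots)))
        (Uniqueₚ.++⁺ {xs = map minusᴾ pairs⁻} {ys = map plusᴾ pairs⁺}
          (Uniqueₚ.map⁺ (λ { refl → refl }) (pairsBelow-unique (S⁻ ∘ suc) N))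
          (Uniqueₚ.map⁺ (λ { refl → refl }) (pairsBelow-unique (S⁺ ∘ suc) N))
          (map-disjoint minusᴾ plusᴾ λ _ _ ()))
        (disjoint-++ (map minusᴾ pairs⁻) (map-disjoint ramᴾ minusᴾ λ _ _ ()) (map-disjoint ramᴾ plusᴾ λ _ _ ()))

    ∈-palIndices : ∀ j → palDeg j ≤ N → j ∈ palIndices
    ∈-palIndices (ramᴾ i)         _   = ∈-++⁺ˡ (∈-map⁺ ramᴾ (∈-allFin i))
    ∈-palIndices (minusᴾ (d , i)) d<N = ∈-++⁺ʳ (map ramᴾ roots) (∈-++⁺ˡ (∈-map⁺ minusᴾ (∈-pairsBelow _ N i d<N)))
    ∈-palIndices (plusᴾ (d , i))  d<N = ∈-++⁺ʳ (map ramᴾ roots) (∈-++⁺ʳ (map minusᴾ pairs⁻) (∈-map⁺ plusᴾ (∈-pairsBelow _ N i d<N)))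

    -- The self-reciprocal primes run over half-degrees up to `N`, that is degrees up to 2N, the
    -- same range as in `palIndices`; this makes the two products comparable level by level.
    indices : List Index
    indices = x ∷ (map ram roots ++ (map minus pairs⁻ ++ (map plus pairs⁺ ++ map plus* pairs⁺)))

    indices-unique : Unique indices
    indices-unique =
      Allₚ.++⁺ (Allₚ.map⁺ (All.universal (λ _ ()) roots))
        (Allₚ.++⁺ (Allₚ.map⁺ (All.universal (λ _ ()) pairs⁻))
          (Allₚ.++⁺ (Allₚ.map⁺ (All.universal (λ _ ()) pairs⁺)) (Allₚ.map⁺ (All.universal (λ _ ()) pairs⁺))))
      ∷ Uniqueₚ.++⁺ {xs = map ram roots} {ys = map minus pairs⁻ ++ (map plus pairs⁺ ++ map plus* pairs⁺)}
          (Uniqueₚ.map⁺ (λ { refl → refl }) (Uniqueₚ.allFin⁺ (length square-roots)))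
          (Uniqueₚ.++⁺ {xs = map minus pairs⁻} {ys = map plus pairs⁺ ++ map plus* pairs⁺}
            (Uniqueₚ.map⁺ (λ { refl → refl }) (pairsBelow-unique (S⁻ ∘ suc) N))
            (Uniqueₚ.++⁺ {xs = map plus pairs⁺} {ys = map plus* pairs⁺}
              (Uniqueₚ.map⁺ (λ { refl → refl }) (pairsBelow-unique (S⁺ ∘ suc) N))
              (Uniqueₚ.map⁺ (λ { refl → refl }) (pairsBelow-unique (S⁺ ∘ suc) N))
              (map-disjoint plus plus* λ _ _ ()))
            (disjoint-++ (map plus pairs⁺) (map-disjoint minus plus λ _ _ ()) (map-disjoint minus plus* λ _ _ ())))
          (disjoint-++ (map minus pairs⁻) (map-disjoint ram minus λ _ _ ())
            (disjoint-++ (map plus pairs⁺) (map-disjoint ram plus λ _ _ ()) (map-disjoint ram plus* λ _ _ ())))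

    ∈-indices : ∀ i → deg i ≤ N → i ∈ indices
    ∈-indices x               _   = here refl
    ∈-indices (ram i)         _   = there (∈-++⁺ˡ (∈-map⁺ ram (∈-allFin i)))
    ∈-indices (minus (d , i)) le  = there (∈-++⁺ʳ (map ram roots) (∈-++⁺ˡ
      (∈-map⁺ minus (∈-pairsBelow _ N i (ℕₚ.≤-trans (ℕₚ.m≤m+n (suc d) (suc d)) le)))))
    ∈-indices (plus (d , i))  d<N = there (∈-++⁺ʳ (map ram roots) (∈-++⁺ʳ (map minus pairs⁻) (∈-++⁺ˡ
      (∈-map⁺ plus (∈-pairsBelow _ N i d<N)))))
    ∈-indices (plus* (d , i)) d<N = there (∈-++⁺ʳ (map ram roots) (∈-++⁺ʳ (map minus pairs⁻) (∈-++⁺ʳ (map plus pairs⁺)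
      (∈-map⁺ plus* (∈-pairsBelow _ N i d<N)))))

    euler-monics : ∀ n → n ≤ N → (S.eulerProduct (map gen indices) ⊗ S.freeSeries []) n ≡ 1S n
    euler-monics = S.euler-identity N refl
      (AllPairsₚ.map⁺ {f = gen} (AllPairs.map (λ {i} {j} i≢j → Family.coprime-independent monics (monic (poly-irr i)) (monic (poly-irr j))
        (poly-coprime (i≢j ∘ sym))) indices-unique))
      (Allₚ.map⁺ (All.universal (λ i → positive (poly-irr i)) indices))
      cover
      where
      cover : ∀ {n} → 0 < n → n ≤ N → (f : Vec Carrier n) → Any (λ g → S.Generator.Divides g f) (map gen indices)
      cover 0<n n≤N f = at-index (poly-∣ (monic-⌊⌋ f) 0<n)
        where
        at-index : (Σ Index λ i → poly i ∣ ⌊ f ⌋) → Any (λ g → S.Generator.Divides g f) (map gen indices)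
        at-index (i , d) = Anyₚ.map⁺ (lose (∈-indices i (ℕₚ.≤-trans (S.Generator.divides-degree (gen i) f d) n≤N)) d)

    euler-palindromes : ∀ n → n ≤ N → (S.eulerProduct (map palGen palIndices) ⊗ S.freeSeries []) n ≡ 1S n
    euler-palindromes = S.euler-identity N refl
      (AllPairsₚ.map⁺ {f = palGen} (AllPairs.map (λ {i} {j} i≢j → Family.coprime-independent palindromes (palPoly-palindromic i) (palPoly-palindromic j)
        (palPoly-coprime j i (i≢j ∘ sym))) palIndices-unique))
      (Allₚ.map⁺ (All.universal positive-degree palIndices))
      cover
      where
      positive-degree : ∀ j → 0 < palDeg j
      positive-degree (ramᴾ _)   = s≤s z≤n
      positive-degree (minusᴾ _) = s≤s z≤n
      positive-degree (plusᴾ _)  = s≤s z≤n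
      cover : ∀ {n} → 0 < n → n ≤ N → (f : Vec Carrier n) → Any (λ g → S.Generator.Divides g f) (map palGen palIndices)
      cover {suc n} 0<n n≤N f = at-index (poly-∣ (pal-monic pf) (s≤s z≤n))
        where
        pf = palindromic-palindrome f
        at-palIndex : (Σ PalIndex λ j → palPoly j ∣ palindrome f) → Any (λ g → S.Generator.Divides g f) (map palGen palIndices)
        at-palIndex (j , d) = Anyₚ.map⁺ (lose (∈-palIndices j (ℕₚ.≤-trans (S.Generator.divides-degree (palGen j) f d) n≤N)) d)
        at-index : (Σ Index λ i → poly i ∣ palindrome f) → Any (λ g → S.Generator.Divides g f) (map palGen palIndices)
        at-index (i , d) = at-palIndex (palPoly-∣ pf i d)

  -- Comparison of the two Euler products.

  degreeProduct : List ℕ → Ser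
  degreeProduct []       = 1S
  degreeProduct (d ∷ ds) = 1-x^ d ⊗ degreeProduct ds

  eulerProduct-map : ∀ {I : Set} (g : I → S.Generator) L → S.eulerProduct (map g L) ≡ degreeProduct (map (S.Generator.degree ∘ g) L)
  eulerProduct-map g []      = refl
  eulerProduct-map g (i ∷ L) = cong (1-x^ (S.Generator.degree (g i)) ⊗_) (eulerProduct-map g L)

  degreeProduct-++ : ∀ ds es → degreeProduct (ds ++ es) ≋ degreeProduct ds ⊗ degreeProduct es
  degreeProduct-++ []       es n = sym (⊗-identityˡ (degreeProduct es) n)
  degreeProduct-++ (d ∷ ds) es n = trans (⊗-congˡ (1-x^ d) (degreeProduct-++ ds es) n)
    (sym (⊗-assoc (1-x^ d) (degreeProduct ds) (degreeProduct es) n))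

  degreeProduct-map-++ : ∀ {I : Set} (δ : I → ℕ) is js → degreeProduct (map δ (is ++ js)) ≋ degreeProduct (map δ is) ⊗ degreeProduct (map δ js)
  degreeProduct-map-++ δ is js n = trans (cong (λ l → degreeProduct l n) (Listₚ.map-++ δ is js)) (degreeProduct-++ (map δ is) (map δ js) n)

  levelProduct : (g f : ℕ → ℕ) → ℕ → Ser
  levelProduct g f zero    = 1S
  levelProduct g f (suc N) = 1-x^ (g N) ^^ f N ⊗ levelProduct g f N

  degreeProduct-const : ∀ {I : Set} d (is : List I) → degreeProduct (map (λ _ → d) is) ≡ 1-x^ d ^^ length is
  degreeProduct-const d []       = refl
  degreeProduct-const d (_ ∷ is) = cong (1-x^ d ⊗_) (degreeProduct-const d is)

  degreeProduct-pairs : ∀ {I : Set} (g f : ℕ → ℕ) (c : Σ ℕ (λ d → Fin (f d)) → I) (δ : I → ℕ) → (∀ d i → δ (c (d , i)) ≡ g d) →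
    ∀ N → degreeProduct (map δ (map c (pairsBelow f N))) ≋ levelProduct g f N
  degreeProduct-pairs g f c δ eq zero    n = refl
  degreeProduct-pairs g f c δ eq (suc N) n = begin
    degreeProduct (map δ (map c (map (N ,_) (allFin (f N)) ++ pairsBelow f N))) n
      ≡⟨ cong (λ l → degreeProduct (map δ l) n) (Listₚ.map-++ c (map (N ,_) (allFin (f N))) (pairsBelow f N)) ⟩
    degreeProduct (map δ (map c (map (N ,_) (allFin (f N))) ++ map c (pairsBelow f N))) n
      ≡⟨ degreeProduct-map-++ δ (map c (map (N ,_) (allFin (f N)))) (map c (pairsBelow f N)) n ⟩
    (degreeProduct (map δ (map c (map (N ,_) (allFin (f N))))) ⊗ degreeProduct (map δ (map c (pairsBelow f N)))) n
      ≡⟨ ⊗-cong {degreeProduct (map δ (map c (map (N ,_) (allFin (f N)))))} (λ m → cong (λ h → h m) level) (degreeProduct-pairs g f c δ eq N) n ⟩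
    levelProduct g f (suc N) n ∎
    where
    open ≡-Reasoning
    level : degreeProduct (map δ (map c (map (N ,_) (allFin (f N))))) ≡ 1-x^ (g N) ^^ f N
    level = begin
      degreeProduct (map δ (map c (map (N ,_) (allFin (f N)))))
        ≡⟨ cong degreeProduct (trans (sym (Listₚ.map-∘ (map (N ,_) (allFin (f N))))) (sym (Listₚ.map-∘ (allFin (f N))))) ⟩
      degreeProduct (map (λ i → δ (c (N , i))) (allFin (f N)))
        ≡⟨ cong degreeProduct (Listₚ.map-cong (eq N) (allFin (f N))) ⟩
      degreeProduct (map (λ _ → g N) (allFin (f N)))
        ≡⟨ degreeProduct-const (g N) (allFin (f N)) ⟩
      1-x^ (g N) ^^ length (allFin (f N))
        ≡⟨ cong (1-x^ (g N) ^^_) {length (allFin (f N))} {f N} (Listₚ.length-tabulate (λ i → i)) ⟩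
      1-x^ (g N) ^^ f N ∎

  seriesRing : CommutativeRing _ _
  seriesRing = ringOn (λ _ → ⊤) (λ _ _ → tt)

  module SR = CommutativeRing seriesRing

  ^^-cong : ∀ {f g} → f ≋ g → ∀ s → f ^^ s ≋ g ^^ s
  ^^-cong eq zero    n = refl
  ^^-cong eq (suc s)   = ⊗-cong eq (^^-cong eq s)

  ^^-⊗ : ∀ f g s → (f ⊗ g) ^^ s ≋ f ^^ s ⊗ g ^^ s
  ^^-⊗ f g zero    n = sym (⊗-identityˡ 1S n)
  ^^-⊗ f g (suc s) n = trans (⊗-congˡ (f ⊗ g) (^^-⊗ f g s) n) (RingLemmas.*-medial seriesRing f g (f ^^ s) (g ^^ s) n tt)

  difference-of-squares : ∀ d → 1-x^ (d ℕ.+ d) ≋ 1-x^ d ⊗ (1+ 1ℚ ·x^ d)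
  difference-of-squares d n = begin
    1S n ℚ.+ (ℚ.- 1ℚ) ℚ.* x^ (d ℕ.+ d) n           ≡⟨ cong (1S n ℚ.+_) (trans (-1*x≈-x (x^ (d ℕ.+ d) n)) (cong ℚ.-_ (sym (x^-+ d d n)))) ⟩
    1S n ℚ.- (x^ d ⊗ x^ d) n                       ≡⟨ RingLemmas.conjugates seriesRing (x^ d) n tt ⟨
    ((1S ⊕ ⊖ x^ d) ⊗ (1S ⊕ x^ d)) n                ≡⟨ ⊗-cong (λ m → cong (1S m ℚ.+_) (-1*x≈-x (x^ d m))) (λ m → cong (1S m ℚ.+_) (ℚₚ.*-identityˡ (x^ d m))) n ⟨
    (1-x^ d ⊗ (1+ 1ℚ ·x^ d)) n                 ∎
    where
    open ≡-Reasoning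
    open import Algebra.Properties.Ring (CommutativeRing.ring ℚring) using (-1*x≈-x)

  -- The origin of the factors 1 + x^d: a self-reciprocal prime contributes 1 - x^(2d) among the
  -- monic polynomials and 1 - x^d among the palindromes, with quotient 1 + x^d.
  levelProduct-double : ∀ N → levelProduct (λ d → suc d ℕ.+ suc d) (S⁻ ∘ suc) N ≋ levelProduct suc (S⁻ ∘ suc) N ⊗ powProd Sign.+ S⁻ N
  levelProduct-double zero    n = sym (⊗-identityˡ 1S n)
  levelProduct-double (suc N) n = trans
    (⊗-cong (λ m → trans (^^-cong (difference-of-squares (suc N)) (S⁻ (suc N)) m) (^^-⊗ (1-x^ (suc N)) (1+ 1ℚ ·x^ (suc N)) (S⁻ (suc N)) m))
      (levelProduct-double N) n)
    (RingLemmas.*-medial seriesRing (1-x^ (suc N) ^^ S⁻ (suc N)) ((1+ 1ℚ ·x^ (suc N)) ^^ S⁻ (suc N))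
      (levelProduct suc (S⁻ ∘ suc) N) (powProd Sign.+ S⁻ N) n tt)

  levelProduct-suc : ∀ N → levelProduct suc (S⁺ ∘ suc) N ≡ powProd Sign.- S⁺ N
  levelProduct-suc zero    = refl
  levelProduct-suc (suc N) = cong (1-x^ (suc N) ^^ S⁺ (suc N) ⊗_) (levelProduct-suc N)

  module _ (N : ℕ) where
    private
      ρ  = degreeProduct (map deg (map ram (allFin (length square-roots))))
      A⁻ = levelProduct suc (S⁻ ∘ suc) N
      U  = powProd Sign.+ S⁻ N
      V  = powProd Sign.- S⁺ N
      Y  = 1-x ⊗ (U ⊗ V)
      pairs⁻ = pairsBelow (S⁻ ∘ suc) N
      pairs⁺ = pairsBelow (S⁺ ∘ suc) N
      open import Relation.Binary.Reasoning.Setoid SR.setoid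

      lift : ∀ {f g} → f ≋ g → SR._≈_ f g
      lift eq n _ = eq n

    plus-product : ∀ {I : Set} (c : Σ ℕ (λ d → Fin (S⁺ (suc d))) → I) (δ : I → ℕ) → (∀ d i → δ (c (d , i)) ≡ suc d) →
                   degreeProduct (map δ (map c pairs⁺)) ≋ V
    plus-product c δ eq n = trans (degreeProduct-pairs suc (S⁺ ∘ suc) c δ eq N n) (cong (λ f → f n) (levelProduct-suc N))

    indices-product : SR._≈_ (S.eulerProduct (map gen (indices N))) (1-x ⊗ (ρ ⊗ ((A⁻ ⊗ U) ⊗ (V ⊗ V))))
    indices-product = begin
      S.eulerProduct (map gen (indices N))
        ≡⟨ eulerProduct-map gen (indices N) ⟩
      1-x ⊗ degreeProduct (map deg (map ram (allFin (length square-roots)) ++ (map minus pairs⁻ ++ (map plus pairs⁺ ++ map plus* pairs⁺))))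
        ≈⟨ SR.*-cong SR.refl (SR.trans (lift (degreeProduct-map-++ deg (map ram (allFin (length square-roots))) _)) (SR.*-cong (SR.refl {ρ})
             (SR.trans (lift (degreeProduct-map-++ deg (map minus pairs⁻) _)) (SR.*-cong
               (lift (λ n → trans (degreeProduct-pairs (λ d → suc d ℕ.+ suc d) (S⁻ ∘ suc) minus deg (λ _ _ → refl) N n) (levelProduct-double N n)))
               (SR.trans (lift (degreeProduct-map-++ deg (map plus pairs⁺) _)) (SR.*-cong
                 (lift (plus-product plus deg (λ _ _ → refl))) (lift (plus-product plus* deg (λ _ _ → refl))))))))) ⟩
      1-x ⊗ (ρ ⊗ ((A⁻ ⊗ U) ⊗ (V ⊗ V))) ∎

    palIndices-product : SR._≈_ (S.eulerProduct (map palGen (palIndices N))) (ρ ⊗ (A⁻ ⊗ V))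
    palIndices-product = begin
      S.eulerProduct (map palGen (palIndices N))
        ≡⟨ eulerProduct-map palGen (palIndices N) ⟩
      degreeProduct (map palDeg (map ramᴾ (allFin (length square-roots)) ++ (map minusᴾ pairs⁻ ++ map plusᴾ pairs⁺)))
        ≈⟨ SR.trans (lift (degreeProduct-map-++ palDeg (map ramᴾ (allFin (length square-roots))) _)) (SR.*-cong ramified
             (SR.trans (lift (degreeProduct-map-++ palDeg (map minusᴾ pairs⁻) _)) (SR.*-cong
               (lift (degreeProduct-pairs suc (S⁻ ∘ suc) minusᴾ palDeg (λ _ _ → refl) N)) (lift (plus-product plusᴾ palDeg (λ _ _ → refl)))))) ⟩
      ρ ⊗ (A⁻ ⊗ V) ∎
      where
      -- x - c has degree 1 and (x - c)² has half-degree 1, so both sides carry the same power of 1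
      -- - x, whatever the number of roots.
      ramified : SR._≈_ (degreeProduct (map palDeg (map ramᴾ (allFin (length square-roots))))) ρ
      ramified = SR.reflexive (cong degreeProduct (trans (sym (Listₚ.map-∘ (allFin (length square-roots)))) (Listₚ.map-∘ (allFin (length square-roots)))))

    products-ratio : SR._≈_ (S.eulerProduct (map gen (indices N))) (S.eulerProduct (map palGen (palIndices N)) ⊗ Y)
    products-ratio = begin
      S.eulerProduct (map gen (indices N))          ≈⟨ indices-product ⟩
      1-x ⊗ (ρ ⊗ ((A⁻ ⊗ U) ⊗ (V ⊗ V)))                  ≈⟨ RingLemmas.euler-ratio seriesRing 1-x ρ A⁻ U V ⟩
      (ρ ⊗ (A⁻ ⊗ V)) ⊗ Y                                ≈⟨ SR.*-cong palIndices-product SR.refl ⟨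
      S.eulerProduct (map palGen (palIndices N)) ⊗ Y ∎

  -- From B′ Q = 1, A Q = 1 and A = B′ Y follows Y = (B′ Q) Y = Q (B′ Y) = Q A = 1: one inverse pair
  -- replaces any division of series.
  product-identity : ∀ N n → n ≤ N → (1-x ⊗ (powProd Sign.+ S⁻ N ⊗ powProd Sign.- S⁺ N)) n ≡ 1S n
  product-identity N = begin
    Y                  ≈⟨ T.*-identityˡ Y ⟨
    1S ⊗ Y             ≈⟨ T.*-cong (λ n n≤N → euler-palindromes N n n≤N) (T.refl {Y}) ⟨
    (B′ ⊗ Q) ⊗ Y       ≈⟨ T.*-cong (T.*-comm B′ Q) (T.refl {Y}) ⟩
    (Q ⊗ B′) ⊗ Y       ≈⟨ T.*-assoc Q B′ Y ⟩
    Q ⊗ (B′ ⊗ Y)       ≈⟨ T.*-cong (T.refl {Q}) (λ n _ → products-ratio N n tt) ⟨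
    Q ⊗ A              ≈⟨ T.*-comm Q A ⟩
    A ⊗ Q              ≈⟨ euler-monics N ⟩
    1S                 ∎
    where
    module T = CommutativeRing (Truncated N)
    open import Relation.Binary.Reasoning.Setoid T.setoid
    A B′ Q Y : Ser
    A = S.eulerProduct (map gen (indices N))
    B′ = S.eulerProduct (map palGen (palIndices N))
    Q = S.freeSeries []
    Y = 1-x ⊗ (powProd Sign.+ S⁻ N ⊗ powProd Sign.- S⁺ N)

theorem6p6 : (F : Field) (q : ℕ) → HasCard F q →
    (SRIM⁻ SRIM⁺ : ℕ → ℕ) →
    (∀ d → 1 ≤ d → CountsClasses (Poly.SRIMminusSet F d) _≡_ (SRIM⁻ d)) →
    (∀ d → 1 ≤ d → CountsClasses (Poly.SRIMplusSet F d) (Poly.SamePair F d) (SRIM⁺ d)) →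
    (ε : Sign) → ∀ n →
    convℚ (seriesFrom Sign.+ (signℤ ε) SRIM⁻) (seriesFrom Sign.- (signℤ ε) SRIM⁺) n
    ≡ geomPow ε n
theorem6p6 F q card SRIM⁻ SRIM⁺ count⁻ count⁺ ε n =
  PartitionSeries.conv-geomPow SRIM⁻ SRIM⁺ n (EulerProducts.product-identity F q card SRIM⁻ SRIM⁺ count⁻ count⁺ n) ε
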